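{- Let $p$ be an odd prime, let $1\le w<p$ be an integer, let $2\le N\le p$, and let $s\ge3$ be an integer. There is a constant $C>0$ (not depending on $p,w,N$) such that if $$\gcd(w,p-1)^{s-1}\ge C\, p^{11s/8+1/4}N^{ -s/2-1}\log^2 N,$$ then $g(w,N,p)\le s$.
   Context: For an odd prime $p$ and an integer $w\ge1$, the polynomial quotient $q_{p,w}(u)$ of an integer $u\ge0$ is the unique integer with $0\le q_{p,w}(u)\le p-1$ and $q_{p,w}(u)\equiv \frac{u^w-u^{wp}}{p}\bmod p$. For $N\le p$, the Waring number $g(w,N,p)$ is the smallest positive integer $s$ such that for every $c\in\mathbb{F}_p$ the congruence $q_{p,w}(u_1)+\cdots+q_{p,w}(u_s)\equiv c\bmod p$ has a solution with integers $0\le u_1,\ldots,u_s<N$; if no such $s$ exists, $g(w,N,p)=\infty$. -}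

module Defs where

open import Data.Nat using (ℕ; zero; suc; _+_; _*_; _^_; _<_; _≤_; NonZero)
open import Data.Nat.DivMod using (_%_)
open import Data.Fin using (Fin)
import Data.Fin as F
open import Data.Integer as ℤ using (ℤ; +_)
open import Data.Integer.DivMod using (_/ℕ_; _%ℕ_)
open import Data.Product using (Σ; _×_)
open import Relation.Binary.PropositionalEquality using (_≡_)

-- polynomial quotient q_{p,w}(u) ∈ {0,…,p-1},
-- q ≡ (u^w - u^{wp}) / p  (mod p)   (the division is exact by Fermat)
q : (p w u : ℕ) .{{_ : NonZero p}} → ℕ
q p w u = ((+ (u ^ w) ℤ.- + (u ^ (w * p))) /ℕ p) %ℕ p

sumFin : ∀ {n} → (Fin n → ℕ) → ℕ
sumFin {zero}  f = 0
sumFin {suc n} f = f F.zero + sumFin (λ i → f (F.suc i))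

WaringSolvable : (w N p s : ℕ) .{{_ : NonZero p}} → Set
WaringSolvable w N p s =
  (c : ℕ) → c < p →
  Σ (Fin s → Fin N) λ u → sumFin (λ i → q p w (F.toℕ (u i))) % p ≡ c

-- g(w,N,p) ≤ s : the least positive s' with the property exists and is ≤ s
WaringNumber≤ : (w N p s : ℕ) .{{_ : NonZero p}} → Set
WaringNumber≤ w N p s = Σ ℕ λ s' → 1 ≤ s' × s' ≤ s × WaringSolvable w N p s'

{-# OPTIONS --safe #-}
-- Modulo p, q_{p,w}(u) ≡ −w u^w f(u), where f is the Fermat quotient, a homomorphism from the units modulo p² to ℤ/p
-- with f(x + pz) ≡ f(x) − z/x.  The values u^w form at most e = (p−1)/gcd(w,p−1) classes.
--
-- Two of the s variables run over the primes l < N in one class.  If two of these primes have equal values, their ratio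
-- modulo p is a w-th root of unity; it determines the pair, because products of two of the primes are below p².  So there
-- are at most 2 gcd(w,p−1) coincidences, and Chebyshev's bound makes the set of these primes large.
--
-- The other s−2 variables have the form u = v + ab with a, v coprime and u in one class.  For p-periodic g of mean zero,
-- the operator T g(c) = ∑ g(c − q(u)) has small L² norm by Burgess' argument: v + ab ≡ a(x + b) with x ≡ v/a (mod p²),
-- distinct coprime pairs give distinct x, and after two applications of Cauchy–Schwarz the sum over all x = y + pz
-- vanishes along z unless 1/(y+b₁) + 1/(y+b₄) ≡ 1/(y+b₂) + 1/(y+b₃), which is a quadratic equation in y.  Using only
-- coprime pairs avoids the logarithm that Burgess' method usually loses.  Everything is an inequality between integer
-- sums, so no characters are needed: autocorrelations of g take their place.

module Submission where

open import Data.Nat as ℕ using (ℕ; suc; zero)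
import Data.Nat.Properties as ℕ
import Data.Nat.Divisibility as ℕ
import Data.Nat.DivMod as ℕ
open import Data.Nat.Primality using (Prime; euclidsLemma; ¬prime[1]; prime⇒nonZero; prime⇒nonTrivial; prime⇒irreducible; prime?)
open import Data.Nat.Coprimality as Coprime using (Coprime; coprime-divisor; coprime?; gcd≡1⇒coprime)
open import Data.List using (List; []; _∷_; _++_; [_]; map; length; filter; cartesianProduct; applyUpTo; upTo; downFrom)
open import Data.List.Properties using (length-++; length-map; ++-identityʳ; length-applyUpTo; length-upTo; length-filter)
open import Data.List.Membership.Propositional using (_∈_)
open import Data.List.Membership.Propositional.Properties using (∈-∃++; ∈-++⁻; ∈-++⁺ˡ; ∈-++⁺ʳ; ∈-map⁻; ∈-applyUpTo⁺; ∈-applyUpTo⁻; ∈-upTo⁺; ∈-upTo⁻; ∈-filter⁻; ∈-cartesianProduct⁻; ∈-cartesianProduct⁺; ∈-filter⁺; ∈-map⁺; ∈-downFrom⁺)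
open import Data.List.Relation.Unary.Any using (here; there)
open import Data.List.Relation.Unary.All as All using (All; []; _∷_)
open import Data.List.Relation.Unary.AllPairs using ([]; _∷_)
open import Data.List.Relation.Unary.Unique.Propositional using (Unique)
import Data.List.Relation.Unary.Unique.Propositional.Properties as Unique
open import Data.Product using (∃; _×_; _,_; proj₁; proj₂; ∃₂)
open import Data.Sum using (inj₁; inj₂; _⊎_; [_,_]′)
import Data.Sum as Sum
open import Data.Empty using (⊥-elim)
open import Relation.Nullary using (¬_; Dec; yes; no; contradiction; ¬?; _×-dec_)
open import Relation.Binary.PropositionalEquality using (_≡_; _≢_; refl; sym; trans; cong; cong₂; subst; module ≡-Reasoning; subst₂)
import Relation.Binary.Reasoning.Setoid as SetoidReasoning

-- Fixing the class of `u ^ w` costs a factor e = (p-1)/gcd(w,p-1) per variable, but makes q a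
-- constant multiple of f, hence additive over products. The prime variables enter the error through
-- the number E of coincidences among their values, so that E ≤ 2 gcd(w,p-1) bounds two variables at
-- once. Each other variable is one application of T, with norm(T g)^2 ≤ Λ norm(g)^2 and Λ = J^3
-- (2B^4 + 2pB^2) p for J pairs (a, v) and b < B; norm is the sum of squares. The first term counts
-- roots of the quadratic, the second the degenerate quadruples; they balance at B = ⌊√p⌋. Members v
-- + ab below N leave room for J of order N^2/B pairs, so Λ is of order N^6 p^(3/2). With k = s-2, n
-- primes and W members in the chosen classes, the count of solutions is positive once (n^2 W^k)^4 >
-- (pE)^4 Λ^k. Here n is at least of order N/(e log N) and W at least of order N^2/e, which gives
-- the bound on the gcd; squaring once more clears the half-integral power of p, whence the eighth
-- power of the stated inequality.

module ListSum where
  open import Data.Integer hiding (suc)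
  open import Data.Integer.Properties
  open import Data.Integer.Tactic.RingSolver using (solve-∀)
  open import Data.List.Relation.Binary.Subset.Propositional using (_⊆_)
  open import Data.List.Relation.Binary.Permutation.Propositional as Perm using (_↭_; ↭-sym; ↭-trans; ↭-refl; prep)
  open import Data.List.Relation.Binary.Permutation.Propositional.Properties using (shift; ↭-length)
  open import Function using (_∘_)
  open import Relation.Unary using (Pred; Decidable)

  private
    variable
      A B : Set

  double : ∀ a → a + a ≡ + 2 * a
  double = solve-∀

  0≤i*i : ∀ i → 0ℤ ≤ i * i
  0≤i*i (+ n)      = subst (0ℤ ≤_) (pos-* n n) (+≤+ ℕ.z≤n)
  0≤i*i -[1+ n ]   = +≤+ ℕ.z≤n

  0≤* : ∀ {a b} → 0ℤ ≤ a → 0ℤ ≤ b → 0ℤ ≤ a * b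
  0≤* {a} 0≤a 0≤b = ≤-trans (≤-reflexive (sym (*-zeroʳ a))) (*-monoˡ-≤-nonNeg a {{nonNegative 0≤a}} 0≤b)

  0≤^ : ∀ {a} → 0ℤ ≤ a → ∀ k → 0ℤ ≤ a ^ k
  0≤^ 0≤a ℕ.zero    = +≤+ ℕ.z≤n
  0≤^ 0≤a (ℕ.suc k) = 0≤* 0≤a (0≤^ 0≤a k)

  *-mono-≤-nonNeg : ∀ {a b c d} → 0ℤ ≤ a → 0ℤ ≤ d → a ≤ b → c ≤ d → a * c ≤ b * d
  *-mono-≤-nonNeg {a} {b} {c} {d} 0≤a 0≤d a≤b c≤d =
    ≤-trans (*-monoˡ-≤-nonNeg a {{nonNegative 0≤a}} c≤d) (*-monoʳ-≤-nonNeg d {{nonNegative 0≤d}} a≤b)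

  square-mono-≤ : ∀ {a b} → 0ℤ ≤ a → a ≤ b → a * a ≤ b * b
  square-mono-≤ 0≤a a≤b = *-mono-≤-nonNeg 0≤a (≤-trans 0≤a a≤b) a≤b a≤b

  -- Finite integer sums over lists, injections, pigeonhole, Cauchy-Schwarz.

  ∑ : List A → (A → ℤ) → ℤ
  ∑ []       f = 0ℤ
  ∑ (x ∷ xs) f = f x + ∑ xs f

  syntax ∑ xs (λ x → e) = ∑[ x ∈ xs ] e
  infix 5 ∑

  ∑-cong-∈ : (xs : List A) {f g : A → ℤ} → (∀ x → x ∈ xs → f x ≡ g x) → ∑ xs f ≡ ∑ xs g
  ∑-cong-∈ []       e = refl
  ∑-cong-∈ (x ∷ xs) e = cong₂ _+_ (e x (here refl)) (∑-cong-∈ xs λ y y∈ → e y (there y∈))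

  ∑-cong : (xs : List A) {f g : A → ℤ} → (∀ x → f x ≡ g x) → ∑ xs f ≡ ∑ xs g
  ∑-cong xs e = ∑-cong-∈ xs λ x _ → e x

  ∑-mono : (xs : List A) {f g : A → ℤ} → (∀ x → x ∈ xs → f x ≤ g x) → ∑ xs f ≤ ∑ xs g
  ∑-mono []       e = ≤-refl
  ∑-mono (x ∷ xs) e = +-mono-≤ (e x (here refl)) (∑-mono xs λ y y∈ → e y (there y∈))

  ∑-zero : (xs : List A) → ∑[ x ∈ xs ] 0ℤ ≡ 0ℤ
  ∑-zero []       = refl
  ∑-zero (x ∷ xs) = trans (+-identityˡ _) (∑-zero xs)

  ∑-nonneg : (xs : List A) {f : A → ℤ} → (∀ x → 0ℤ ≤ f x) → 0ℤ ≤ ∑ xs f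
  ∑-nonneg xs e = ≤-trans (≤-reflexive (sym (∑-zero xs))) (∑-mono xs λ x _ → e x)

  ∑-distrib-+ : (xs : List A) (f g : A → ℤ) → ∑[ x ∈ xs ] (f x + g x) ≡ ∑ xs f + ∑ xs g
  ∑-distrib-+ []       f g = refl
  ∑-distrib-+ (x ∷ xs) f g = trans (cong (_+_ ((f x + g x))) (∑-distrib-+ xs f g)) (lem (f x) (g x) _ _)
    where
    lem : ∀ a b c d → a + b + (c + d) ≡ a + c + (b + d)
    lem = solve-∀

  ∑-*ˡ : (c : ℤ) (xs : List A) (f : A → ℤ) → ∑[ x ∈ xs ] (c * f x) ≡ c * ∑ xs f
  ∑-*ˡ c []       f = sym (*-zeroʳ c)
  ∑-*ˡ c (x ∷ xs) f = trans (cong (_+_ (c * f x)) (∑-*ˡ c xs f)) (sym (*-distribˡ-+ c (f x) _))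

  ∑-*ʳ : (c : ℤ) (xs : List A) (f : A → ℤ) → ∑[ x ∈ xs ] (f x * c) ≡ ∑ xs f * c
  ∑-*ʳ c xs f = trans (∑-cong xs λ x → *-comm (f x) c) (trans (∑-*ˡ c xs f) (*-comm c _))

  ∑-distrib-- : (xs : List A) (f g : A → ℤ) → ∑[ x ∈ xs ] (f x - g x) ≡ ∑ xs f - ∑ xs g
  ∑-distrib-- xs f g = begin
    ∑[ x ∈ xs ] (f x - g x)               ≡⟨ ∑-distrib-+ xs f (λ x → - g x) ⟩
    ∑ xs f + (∑[ x ∈ xs ] - g x)          ≡⟨ cong (_+_ (∑ xs f)) (∑-cong xs λ x → sym (-1*i≡-i (g x))) ⟩
    ∑ xs f + (∑[ x ∈ xs ] -1ℤ * g x)      ≡⟨ cong (_+_ (∑ xs f)) (trans (∑-*ˡ -1ℤ xs g) (-1*i≡-i _)) ⟩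
    ∑ xs f - ∑ xs g                       ∎
    where open ≡-Reasoning

  ∑-const : (xs : List A) (c : ℤ) → ∑[ x ∈ xs ] c ≡ + length xs * c
  ∑-const []       c = sym (*-zeroˡ c)
  ∑-const (x ∷ xs) c = trans (cong (_+_ (c)) (∑-const xs c)) (sym (suc-* (+ length xs) c))

  ∑-swap : (xs : List A) (ys : List B) (f : A → B → ℤ) →
           ∑[ x ∈ xs ] ∑[ y ∈ ys ] f x y ≡ ∑[ y ∈ ys ] ∑[ x ∈ xs ] f x y
  ∑-swap []       ys f = sym (∑-zero ys)
  ∑-swap (x ∷ xs) ys f = trans (cong (_+_ (∑ ys (f x))) (∑-swap xs ys f)) (sym (∑-distrib-+ ys (f x) _))

  ∑-* : (xs : List A) (ys : List B) (f : A → ℤ) (g : B → ℤ) →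
        ∑ xs f * ∑ ys g ≡ ∑[ x ∈ xs ] ∑[ y ∈ ys ] f x * g y
  ∑-* xs ys f g = trans (sym (∑-*ʳ (∑ ys g) xs f)) (∑-cong xs λ x → sym (∑-*ˡ (f x) ys g))

  ∑-++ : (xs ys : List A) (f : A → ℤ) → ∑ (xs ++ ys) f ≡ ∑ xs f + ∑ ys f
  ∑-++ []       ys f = sym (+-identityˡ _)
  ∑-++ (x ∷ xs) ys f = trans (cong (_+_ (f x)) (∑-++ xs ys f)) (sym (+-assoc (f x) _ _))

  ∑-map : (m : A → B) (xs : List A) (f : B → ℤ) → ∑ (map m xs) f ≡ ∑[ x ∈ xs ] f (m x)
  ∑-map m []       f = refl
  ∑-map m (x ∷ xs) f = cong (_+_ (f (m x))) (∑-map m xs f)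

  ∑-cartesianProduct : (xs : List A) (ys : List B) (f : A × B → ℤ) →
                       ∑ (cartesianProduct xs ys) f ≡ ∑[ x ∈ xs ] ∑[ y ∈ ys ] f (x , y)
  ∑-cartesianProduct []       ys f = refl
  ∑-cartesianProduct (x ∷ xs) ys f =
    trans (∑-++ (map (x ,_) ys) _ f) (cong₂ _+_ (∑-map (x ,_) ys f) (∑-cartesianProduct xs ys f))

  length-cartesianProduct : (xs : List A) (ys : List B) → length (cartesianProduct xs ys) ≡ length xs ℕ.* length ys
  length-cartesianProduct []       ys = refl
  length-cartesianProduct (x ∷ xs) ys =
    trans (length-++ (map (x ,_) ys)) (cong₂ ℕ._+_ (length-map (x ,_) ys) (length-cartesianProduct xs ys))

  ∑-↭ : {xs ys : List A} → xs ↭ ys → (f : A → ℤ) → ∑ xs f ≡ ∑ ys f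
  ∑-↭ Perm.refl         f = refl
  ∑-↭ (Perm.prep x r)   f = cong (_+_ (f x)) (∑-↭ r f)
  ∑-↭ (Perm.swap x y r) f = trans (cong (λ t → f x + (f y + t)) (∑-↭ r f)) (lem (f x) (f y) _)
    where
    lem : ∀ a b c → a + (b + c) ≡ b + (a + c)
    lem = solve-∀
  ∑-↭ (Perm.trans r s)  f = trans (∑-↭ r f) (∑-↭ s f)

  ⟦_⟧ : {P : Set} → Dec P → ℤ
  ⟦ yes _ ⟧ = 1ℤ
  ⟦ no  _ ⟧ = 0ℤ

  ⟦⟧-yes : {P : Set} (d : Dec P) → P → ⟦ d ⟧ ≡ 1ℤ
  ⟦⟧-yes (yes _) _ = refl
  ⟦⟧-yes (no ¬p) p = ⊥-elim (¬p p)

  ⟦⟧-no : {P : Set} (d : Dec P) → ¬ P → ⟦ d ⟧ ≡ 0ℤ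
  ⟦⟧-no (yes p) ¬p = ⊥-elim (¬p p)
  ⟦⟧-no (no _)  _  = refl

  ⟦⟧-cong : {P Q : Set} (d : Dec P) (e : Dec Q) → (P → Q) → (Q → P) → ⟦ d ⟧ ≡ ⟦ e ⟧
  ⟦⟧-cong (yes p) e f g = sym (⟦⟧-yes e (f p))
  ⟦⟧-cong (no ¬p) e f g = sym (⟦⟧-no e (¬p ∘ g))

  0≤⟦⟧ : {P : Set} (d : Dec P) → 0ℤ ≤ ⟦ d ⟧
  0≤⟦⟧ (yes _) = +≤+ ℕ.z≤n
  0≤⟦⟧ (no _)  = ≤-refl

  ⟦⟧≤1 : {P : Set} (d : Dec P) → ⟦ d ⟧ ≤ 1ℤ
  ⟦⟧≤1 (yes _) = ≤-refl
  ⟦⟧≤1 (no _)  = +≤+ ℕ.z≤n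

  0≤⟦⟧*⟦⟧ : {P Q : Set} (d : Dec P) (e : Dec Q) → 0ℤ ≤ ⟦ d ⟧ * ⟦ e ⟧
  0≤⟦⟧*⟦⟧ d e = 0≤* (0≤⟦⟧ d) (0≤⟦⟧ e)

  ∑-filter : {P : Pred A _} (P? : Decidable P) (xs : List A) (f : A → ℤ) →
             ∑ (filter P? xs) f ≡ ∑[ x ∈ xs ] (⟦ P? x ⟧ * f x)
  ∑-filter P? []       f = refl
  ∑-filter P? (x ∷ xs) f with P? x
  ... | yes _ = cong₂ _+_ (sym (*-identityˡ (f x))) (∑-filter P? xs f)
  ... | no _  = trans (∑-filter P? xs f) (sym (+-identityˡ _))

  ∑-⟦⟧ : {P : Pred A _} (P? : Decidable P) (xs : List A) →
         ∑[ x ∈ xs ] ⟦ P? x ⟧ ≡ + length (filter P? xs)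
  ∑-⟦⟧ P? xs = sym (trans (sym (trans (∑-const (filter P? xs) 1ℤ) (*-identityʳ _)))
                    (trans (∑-filter P? xs (λ _ → 1ℤ)) (∑-cong xs λ x → *-identityʳ _)))

  private
    drop-other : {x y : A} (ys zs : List A) → y ≢ x → y ∈ ys ++ [ x ] ++ zs → y ∈ ys ++ zs
    drop-other ys zs y≢x y∈ with ∈-++⁻ ys y∈
    ... | inj₁ i           = ∈-++⁺ˡ i
    ... | inj₂ (here y≡x)  = ⊥-elim (y≢x y≡x)
    ... | inj₂ (there i)   = ∈-++⁺ʳ ys i

  -- The elements of `xs` are extracted from `ys` one at a time. Every comparison of sums or lengths
  -- along an injection rests on this splitting.
  Unique-⊆-complement : {xs ys : List A} → Unique xs → xs ⊆ ys → ∃ λ zs → ys ↭ xs ++ zs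
  Unique-⊆-complement {xs = []}     {ys} []       sub = ys , ↭-refl
  Unique-⊆-complement {xs = x ∷ xs} {ys} (x∉ ∷ u) sub with ∈-∃++ (sub (here refl))
  ... | as , bs , refl with Unique-⊆-complement u
          (λ {y} y∈ → drop-other as bs (λ y≡x → All.lookup x∉ y∈ (sym y≡x)) (sub (there y∈)))
  ... | zs , r = zs , ↭-trans (shift x as bs) (prep x r)

  Unique-map-∈ : (m : A → B) {xs : List A} → (∀ {x y} → x ∈ xs → y ∈ xs → m x ≡ m y → x ≡ y) →
                 Unique xs → Unique (map m xs)
  Unique-map-∈ m {[]}     inj []       = []
  Unique-map-∈ m {x ∷ xs} inj (x∉ ∷ u) =
    All.tabulate (λ {z} z∈ mx≡z → let (y , y∈ , z≡my) = ∈-map⁻ m z∈ in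
      All.lookup x∉ y∈ (inj (here refl) (there y∈) (trans mx≡z z≡my)))
    ∷ Unique-map-∈ m (λ i j → inj (there i) (there j)) u

  module _ (m : A → B) {xs : List A} {ys : List B} (u : Unique xs)
           (inj : ∀ {x y} → x ∈ xs → y ∈ xs → m x ≡ m y → x ≡ y)
           (into : ∀ {x} → x ∈ xs → m x ∈ ys) where

    private
      complement : ∃ λ zs → ys ↭ map m xs ++ zs
      complement = Unique-⊆-complement (Unique-map-∈ m inj u) λ z∈ →
        let (x , x∈ , z≡mx) = ∈-map⁻ m z∈ in subst (_∈ ys) (sym z≡mx) (into x∈)

    -- The members of `ys` outside the image contribute a nonnegative amount.
    ∑-injection : (f : B → ℤ) → (∀ y → 0ℤ ≤ f y) → ∑[ x ∈ xs ] f (m x) ≤ ∑ ys f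
    ∑-injection f f≥0 = begin
      ∑[ x ∈ xs ] f (m x)            ≡⟨ ∑-map m xs f ⟨
      ∑ (map m xs) f                 ≡⟨ +-identityʳ _ ⟨
      ∑ (map m xs) f + 0ℤ            ≤⟨ +-monoʳ-≤ (∑ (map m xs) f) (∑-nonneg zs f≥0) ⟩
      ∑ (map m xs) f + ∑ zs f        ≡⟨ ∑-++ (map m xs) zs f ⟨
      ∑ (map m xs ++ zs) f           ≡⟨ ∑-↭ (proj₂ complement) f ⟨
      ∑ ys f                         ∎
      where
      open ≤-Reasoning
      zs = proj₁ complement

    private
      length-complement : ∀ {zs} → ys ↭ map m xs ++ zs → length ys ≡ length xs ℕ.+ length zs
      length-complement {zs} r =
        trans (↭-length r) (trans (length-++ (map m xs)) (cong (ℕ._+ length zs) (length-map m xs)))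

    length-injection : length xs ℕ.≤ length ys
    length-injection = ℕ.≤-trans (ℕ.m≤m+n _ _) (ℕ.≤-reflexive (sym (length-complement (proj₂ complement))))

    -- Equal lengths leave an empty complement. This gives the change of variables in complete
    -- residue systems.
    map-↭ : length xs ≡ length ys → map m xs ↭ ys
    map-↭ same with complement
    ... | []     , r = ↭-sym (subst (ys ↭_) (++-identityʳ (map m xs)) r)
    ... | z ∷ zs , r = contradiction (trans (sym (length-complement r)) (sym same)) (ℕ.m+1+n≢m (length xs))

  ∑-single : {xs : List A} {x : A} (f : A → ℤ) → Unique xs → x ∈ xs →
             (∀ y → y ∈ xs → y ≢ x → f y ≡ 0ℤ) → ∑ xs f ≡ f x
  ∑-single {xs = _ ∷ xs} f (x∉ ∷ u) (here refl) z =
    trans (cong (_+_ (f _)) (trans (∑-cong-∈ xs λ y y∈ → z y (there y∈) λ y≡x → All.lookup x∉ y∈ (sym y≡x)) (∑-zero xs)))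
          (+-identityʳ _)
  ∑-single f (x∉ ∷ u) (there x∈) z =
    trans (cong₂ _+_ (z _ (here refl) λ { refl → All.lookup x∉ x∈ refl }) (∑-single f u x∈ λ y y∈ → z y (there y∈)))
          (+-identityˡ _)

  ∑-member : {xs : List A} {x : A} (f : A → ℤ) → (∀ y → 0ℤ ≤ f y) → x ∈ xs → f x ≤ ∑ xs f
  ∑-member {xs = x ∷ xs} f f≥0 (here refl) =
    ≤-trans (≤-reflexive (sym (+-identityʳ (f x)))) (+-monoʳ-≤ (f x) (∑-nonneg xs f≥0))
  ∑-member {xs = y ∷ xs} f f≥0 (there x∈) =
    ≤-trans (≤-trans (∑-member f f≥0 x∈) (≤-reflexive (sym (+-identityˡ (∑ xs f))))) (+-monoˡ-≤ (∑ xs f) (f≥0 y))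

  ∑-positive : (xs : List A) (f : A → ℤ) → 0ℤ < ∑ xs f → ∃ λ x → x ∈ xs × 0ℤ < f x
  ∑-positive []       f 0<0 = ⊥-elim (<-irrefl refl 0<0)
  ∑-positive (x ∷ xs) f pos with 0ℤ <? f x
  ... | yes q = x , here refl , q
  ... | no q  = let (y , y∈ , r) = ∑-positive xs f (<-≤-trans pos
                       (≤-trans (+-monoˡ-≤ (∑ xs f) (≮⇒≥ q)) (≤-reflexive (+-identityˡ _)))) in y , there y∈ , r

  -- With l entries of sum S, the numbers 1 + l f(x) - S add up to l, so one of them is positive;
  -- over the integers S < 1 + l f(x) means S ≤ l f(x). Positivity of S guarantees that there is an
  -- entry at all.
  pigeonhole : (xs : List A) (f : A → ℤ) (n : ℕ) → length xs ℕ.≤ n → (∀ x → 0ℤ ≤ f x) → 0ℤ < ∑ xs f →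
               ∃ λ x → x ∈ xs × ∑ xs f ≤ + n * f x
  pigeonhole xs f n le f≥0 pos with ∑-positive xs (λ x → 1ℤ + + length xs * f x - ∑ xs f) pos′
    where
    open ≡-Reasoning
    l = + length xs
    S = ∑ xs f
    lem : ∀ l S → l * 1ℤ + l * S - l * S ≡ l
    lem = solve-∀
    value : ∑[ x ∈ xs ] (1ℤ + l * f x - S) ≡ l
    value = begin
      ∑[ x ∈ xs ] (1ℤ + l * f x - S)                     ≡⟨ ∑-distrib-- xs (λ x → 1ℤ + l * f x) (λ _ → S) ⟩
      (∑[ x ∈ xs ] (1ℤ + l * f x)) - (∑[ x ∈ xs ] S)     ≡⟨ cong₂ _-_ (trans (∑-distrib-+ xs (λ _ → 1ℤ) (λ x → l * f x))
                                                                (cong₂ _+_ (∑-const xs 1ℤ) (∑-*ˡ l xs f))) (∑-const xs S) ⟩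
      l * 1ℤ + l * S - l * S                             ≡⟨ lem l S ⟩
      l                                                  ∎
    nonempty : ∀ ys → 0ℤ < ∑ ys f → 0ℤ < + length ys
    nonempty []      p = ⊥-elim (<-irrefl refl p)
    nonempty (_ ∷ _) _ = +<+ (ℕ.s≤s ℕ.z≤n)
    pos′ : 0ℤ < ∑[ x ∈ xs ] (1ℤ + l * f x - S)
    pos′ = <-≤-trans (nonempty xs pos) (≤-reflexive (sym value))
  ... | x , x∈ , r = x , x∈ , (begin
    ∑ xs f               ≤⟨ i<j+1⇒i≤j (∑ xs f) (+ length xs * f x) (0<j-i⇒i<j _ _ r) ⟩
    + length xs * f x    ≤⟨ *-monoʳ-≤-nonNeg (f x) {{nonNegative (f≥0 x)}} (+≤+ le) ⟩
    + n * f x            ∎)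
    where
    open ≤-Reasoning
    0<j-i⇒i<j : ∀ i j → 0ℤ < j - i → i < j
    0<j-i⇒i<j i j q = <-≤-trans (≤-<-trans (≤-reflexive (sym (+-identityˡ i))) (+-monoˡ-< i q)) (≤-reflexive (lem j i))
      where
      lem : ∀ j i → j - i + i ≡ j
      lem = solve-∀
    i<j+1⇒i≤j : ∀ i j → i < 1ℤ + j → i ≤ j
    i<j+1⇒i≤j i j q = suc-pred-lem (i<j⇒i≤pred[j] q)
      where
      suc-pred-lem : i ≤ pred (1ℤ + j) → i ≤ j
      suc-pred-lem = subst (i ≤_) (pred-suc j)

  -- From ∑ᵢⱼ (fᵢ gⱼ − fⱼ gᵢ)² ≥ 0.
  cauchy-schwarz : (xs : List A) (f g : A → ℤ) →
    (∑[ x ∈ xs ] f x * g x) * (∑[ x ∈ xs ] f x * g x) ≤ (∑[ x ∈ xs ] f x * f x) * (∑[ x ∈ xs ] g x * g x)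
  cauchy-schwarz xs f g = *-cancelˡ-≤-pos _ _ (+ 2) (0≤i-j⇒j≤i (subst (0ℤ ≤_) value
      (∑-nonneg xs λ x → ∑-nonneg xs λ y → 0≤i*i (f x * g y - f y * g x))))
    where
    open ≡-Reasoning
    F = ∑[ x ∈ xs ] f x * f x
    G = ∑[ x ∈ xs ] g x * g x
    H = ∑[ x ∈ xs ] f x * g x
    expand : ∀ a b c d → (a * d - b * c) * (a * d - b * c) ≡ a * a * (d * d) + c * c * (b * b) - + 2 * (a * c * (b * d))
    expand = solve-∀
    collect : ∀ F G H → F * G + G * F - + 2 * (H * H) ≡ + 2 * (F * G) - + 2 * (H * H)
    collect = solve-∀
    inner : ∀ x → ∑[ y ∈ xs ] (f x * g y - f y * g x) * (f x * g y - f y * g x)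
                ≡ f x * f x * G + g x * g x * F - + 2 * (f x * g x * H)
    inner x = begin
      ∑[ y ∈ xs ] (f x * g y - f y * g x) * (f x * g y - f y * g x)
        ≡⟨ ∑-cong xs (λ y → expand (f x) (f y) (g x) (g y)) ⟩
      ∑[ y ∈ xs ] (f x * f x * (g y * g y) + g x * g x * (f y * f y) - + 2 * (f x * g x * (f y * g y)))
        ≡⟨ ∑-distrib-- xs (λ y → f x * f x * (g y * g y) + g x * g x * (f y * f y)) (λ y → + 2 * (f x * g x * (f y * g y))) ⟩
      (∑[ y ∈ xs ] (f x * f x * (g y * g y) + g x * g x * (f y * f y))) - (∑[ y ∈ xs ] + 2 * (f x * g x * (f y * g y)))
        ≡⟨ cong₂ _-_ (trans (∑-distrib-+ xs (λ y → f x * f x * (g y * g y)) (λ y → g x * g x * (f y * f y)))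
                       (cong₂ _+_ (∑-*ˡ (f x * f x) xs (λ y → g y * g y)) (∑-*ˡ (g x * g x) xs (λ y → f y * f y))))
             (trans (∑-*ˡ (+ 2) xs (λ y → f x * g x * (f y * g y))) (cong (+ 2 *_) (∑-*ˡ (f x * g x) xs (λ y → f y * g y)))) ⟩
      f x * f x * G + g x * g x * F - + 2 * (f x * g x * H) ∎
    value : ∑[ x ∈ xs ] ∑[ y ∈ xs ] (f x * g y - f y * g x) * (f x * g y - f y * g x) ≡ + 2 * (F * G) - + 2 * (H * H)
    value = begin
      ∑[ x ∈ xs ] ∑[ y ∈ xs ] (f x * g y - f y * g x) * (f x * g y - f y * g x)
        ≡⟨ ∑-cong xs inner ⟩
      ∑[ x ∈ xs ] (f x * f x * G + g x * g x * F - + 2 * (f x * g x * H))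
        ≡⟨ ∑-distrib-- xs (λ x → f x * f x * G + g x * g x * F) (λ x → + 2 * (f x * g x * H)) ⟩
      (∑[ x ∈ xs ] (f x * f x * G + g x * g x * F)) - (∑[ x ∈ xs ] + 2 * (f x * g x * H))
        ≡⟨ cong₂ _-_ (trans (∑-distrib-+ xs (λ x → f x * f x * G) (λ x → g x * g x * F))
                       (cong₂ _+_ (∑-*ʳ G xs (λ x → f x * f x)) (∑-*ʳ F xs (λ x → g x * g x))))
             (trans (∑-*ˡ (+ 2) xs (λ x → f x * g x * H)) (cong (+ 2 *_) (∑-*ʳ H xs (λ x → f x * g x)))) ⟩
      F * G + G * F - + 2 * (H * H)
        ≡⟨ collect F G H ⟩
      + 2 * (F * G) - + 2 * (H * H) ∎

  cauchy-schwarz-1 : (xs : List A) (f : A → ℤ) → ∑ xs f * ∑ xs f ≤ + length xs * (∑[ x ∈ xs ] f x * f x)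
  cauchy-schwarz-1 xs f = begin
    ∑ xs f * ∑ xs f                                      ≡⟨ cong₂ _*_ one one ⟨
    (∑[ x ∈ xs ] 1ℤ * f x) * (∑[ x ∈ xs ] 1ℤ * f x)      ≤⟨ cauchy-schwarz xs (λ _ → 1ℤ) f ⟩
    (∑[ x ∈ xs ] 1ℤ * 1ℤ) * (∑[ x ∈ xs ] f x * f x)      ≡⟨ cong (_* (∑[ x ∈ xs ] f x * f x)) (trans (∑-const xs 1ℤ) (*-identityʳ (+ length xs))) ⟩
    + length xs * (∑[ x ∈ xs ] f x * f x)                ∎
    where
    open ≤-Reasoning
    one : ∑[ x ∈ xs ] 1ℤ * f x ≡ ∑ xs f
    one = ∑-cong xs λ x → *-identityˡ (f x)

-- Congruences between integers, and their cancellation laws modulo a prime.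

module Congruence where
  open import Data.Integer hiding (suc)
  open import Data.Integer.Properties
  open import Data.Integer.DivMod using (_%ℕ_; _/ℕ_; n%ℕd<d; a≡a%ℕn+[a/ℕn]*n)
  open import Data.Integer.Divisibility.Signed
  open import Data.Integer.Tactic.RingSolver using (solve-∀)
  open import Relation.Nullary.Decidable using (map′)
  open import Relation.Binary using (Setoid)

  module Mod (n : ℕ) where

    infix 4 _≈_ _≈?_

    -- A record lets unification recover `x` and `y`; the bare divisibility exhibits only their
    -- difference, which reduces.
    record _≈_ (x y : ℤ) : Set where
      constructor mk
      field div : + n ∣ x - y
    open _≈_ public

    ≡⇒≈ : ∀ {x y} → x ≡ y → x ≈ y
    ≡⇒≈ {x} refl = mk (divides 0ℤ (trans (+-inverseʳ x) (sym (*-zeroˡ (+ n)))))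

    ≈-refl : ∀ {x} → x ≈ x
    ≈-refl = ≡⇒≈ refl

    ≈-sym : ∀ {x y} → x ≈ y → y ≈ x
    ≈-sym {x} {y} (mk d) = mk (subst (+ n ∣_) (lem x y) (∣m⇒∣-m d))
      where
      lem : ∀ x y → - (x - y) ≡ y - x
      lem = solve-∀

    ≈-trans : ∀ {x y z} → x ≈ y → y ≈ z → x ≈ z
    ≈-trans {x} {y} {z} (mk d) (mk e) = mk (subst (+ n ∣_) (lem x y z) (∣m∣n⇒∣m+n d e))
      where
      lem : ∀ x y z → x - y + (y - z) ≡ x - z
      lem = solve-∀

    ≈-setoid : Setoid _ _
    ≈-setoid = record { isEquivalence = record { refl = λ {x} → ≈-refl {x} ; sym = ≈-sym ; trans = ≈-trans } }

    +-cong : ∀ {x y u v} → x ≈ y → u ≈ v → x + u ≈ y + v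
    +-cong {x} {y} {u} {v} (mk d) (mk e) = mk (subst (+ n ∣_) (lem x y u v) (∣m∣n⇒∣m+n d e))
      where
      lem : ∀ x y u v → x - y + (u - v) ≡ x + u - (y + v)
      lem = solve-∀

    neg-cong : ∀ {x y} → x ≈ y → - x ≈ - y
    neg-cong {x} {y} (mk d) = mk (subst (+ n ∣_) (lem x y) (∣m⇒∣-m d))
      where
      lem : ∀ x y → - (x - y) ≡ - x - - y
      lem = solve-∀

    sub-cong : ∀ {x y u v} → x ≈ y → u ≈ v → x - u ≈ y - v
    sub-cong d e = +-cong d (neg-cong e)

    *-cong : ∀ {x y u v} → x ≈ y → u ≈ v → x * u ≈ y * v
    *-cong {x} {y} {u} {v} (mk d) (mk e) =
      mk (subst (+ n ∣_) (lem x y u v) (∣m∣n⇒∣m+n (∣m⇒∣m*n u d) (∣n⇒∣m*n y e)))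
      where
      lem : ∀ x y u v → (x - y) * u + y * (u - v) ≡ x * u - y * v
      lem = solve-∀

    ^-cong : ∀ {x y} k → x ≈ y → x ^ k ≈ y ^ k
    ^-cong ℕ.zero  d = ≈-refl
    ^-cong (suc k) d = *-cong d (^-cong k d)

    multiple≈0 : ∀ x → + n * x ≈ 0ℤ
    multiple≈0 x = mk (divides x (trans (+-identityʳ _) (*-comm (+ n) x)))

    add-multiple : ∀ x y → x + + n * y ≈ x
    add-multiple x y = ≈-trans (+-cong (≈-refl {x}) (multiple≈0 y)) (≡⇒≈ (+-identityʳ x))

    x-y≈0 : ∀ {x y} → x ≈ y → x - y ≈ 0ℤ
    x-y≈0 {x} {y} (mk d) = mk (subst (+ n ∣_) (sym (+-identityʳ (x - y))) d)

    x-y≈0⇒ : ∀ {x y} → x - y ≈ 0ℤ → x ≈ y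
    x-y≈0⇒ {x} {y} (mk d) = mk (subst (+ n ∣_) (+-identityʳ (x - y)) d)

    _≈?_ : ∀ x y → Dec (x ≈ y)
    x ≈? y = map′ mk div (+ n ∣? x - y)

    ≈0⇒∣ : ∀ {i} → + i ≈ 0ℤ → n ℕ.∣ i
    ≈0⇒∣ {i} (mk d) = ∣⇒∣ᵤ (subst (+ n ∣_) (+-identityʳ (+ i)) d)

    residue-unique : ∀ {i j} → i ℕ.< n → j ℕ.< n → + i ≈ + j → i ≡ j
    residue-unique {i} {j} i<n j<n (mk d) = ℕ.≤-antisym (half i<n d) (half j<n (div (≈-sym {+ i} {+ j} (mk d))))
      where
      half : ∀ {i j} → i ℕ.< n → + n ∣ + i - + j → i ℕ.≤ j
      half {i} {j} i<n d with i ℕ.≤? j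
      ... | yes i≤j = i≤j
      ... | no i≰j  = contradiction (ℕ.∣⇒≤ {{ℕ.>-nonZero (ℕ.m<n⇒0<n∸m j<i)}} (∣⇒∣ᵤ (subst (+ n ∣_) (trans (m-n≡m⊖n i j) (⊖-≥ (ℕ.<⇒≤ j<i))) d)))
                                    (ℕ.<⇒≱ (ℕ.≤-<-trans (ℕ.m∸n≤m i j) i<n))
        where j<i = ℕ.≰⇒> i≰j

    module _ .{{_ : ℕ.NonZero n}} where

      ≈-residue : ∀ x → x ≈ + (x %ℕ n)
      ≈-residue x = mk (divides (x /ℕ n)
        (trans (cong (_- + (x %ℕ n)) (a≡a%ℕn+[a/ℕn]*n x n)) (lem (+ (x %ℕ n)) _)))
        where
        lem : ∀ a b → a + b - a ≡ b
        lem = solve-∀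

      %ℕ-small : ∀ {i} x → i ℕ.< n → x ≈ + i → x %ℕ n ≡ i
      %ℕ-small x i<n d = residue-unique (n%ℕd<d x n) i<n (≈-trans (≈-sym (≈-residue x)) d)

  pos-^ : ∀ a k → + (a ℕ.^ k) ≡ (+ a) ^ k
  pos-^ a ℕ.zero  = refl
  pos-^ a (suc k) = trans (pos-* a (a ℕ.^ k)) (cong (+ a *_) (pos-^ a k))

  module PrimeMod {p : ℕ} (pr : Prime p) where
    open Mod p

    zero-product : ∀ x y → x * y ≈ 0ℤ → x ≈ 0ℤ ⊎ y ≈ 0ℤ
    zero-product x y d = Sum.map (lift x) (lift y)
      (euclidsLemma ∣ x ∣ ∣ y ∣ pr (subst (p ℕ.∣_) (abs-* x y)
        (∣⇒∣ᵤ (subst (+ p ∣_) (+-identityʳ (x * y)) (div d)))))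
      where
      lift : ∀ z → p ℕ.∣ ∣ z ∣ → z ≈ 0ℤ
      lift z e = mk (subst (+ p ∣_) (sym (+-identityʳ z)) (∣ᵤ⇒∣ e))

    *-cancelˡ-≈ : ∀ a {x y} → ¬ a ≈ 0ℤ → a * x ≈ a * y → x ≈ y
    *-cancelˡ-≈ a {x} {y} a≉0 d = [ (λ e → contradiction e a≉0) , x-y≈0⇒ ]′
      (zero-product a (x - y) (≈-trans (≡⇒≈ (lem a x y)) (x-y≈0 d)))
      where
      lem : ∀ a x y → a * (x - y) ≡ a * x - a * y
      lem = solve-∀

    *-≉0 : ∀ {x y} → ¬ x ≈ 0ℤ → ¬ y ≈ 0ℤ → ¬ x * y ≈ 0ℤ
    *-≉0 {x} {y} nx ny d = [ nx , ny ]′ (zero-product x y d)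

    ^-≈0 : ∀ x k → x ^ k ≈ 0ℤ → x ≈ 0ℤ
    ^-≈0 x ℕ.zero  d = contradiction (ℕ.∣1⇒≡1 (≈0⇒∣ d)) λ { refl → ¬prime[1] pr }
    ^-≈0 x (suc k) d = [ (λ e → e) , ^-≈0 x k ]′ (zero-product x (x ^ k) d)

    small≉0 : ∀ {i} → 0 ℕ.< i → i ℕ.< p → ¬ + i ≈ 0ℤ
    small≉0 0<i i<p d = ℕ.<⇒≢ 0<i (sym (residue-unique i<p (ℕ.≤-<-trans ℕ.z≤n i<p) d))

    -- Invertibility of the variables is read off from their membership in a class, so that it need
    -- not be carried along separately.
    unit-of : ∀ {x h w} → ¬ h ≈ 0ℤ → 0 ℕ.< w → x ^ w ≈ h → ¬ x ≈ 0ℤ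
    unit-of {x} {h} {w} h≉0 0<w e d = h≉0 (≈-trans (≈-sym e) (≈-trans (^-cong w d) (≡⇒≈ (0^ w 0<w))))
      where
      0^ : ∀ w → 0 ℕ.< w → 0ℤ ^ w ≡ 0ℤ
      0^ (suc w) _ = *-zeroˡ (0ℤ ^ w)

-- Roots of polynomials modulo p and Fermat's little theorem.

module PrimeField where
  open ListSum using (map-↭)
  open Congruence
  open import Data.Nat.ListAction using (product)
  open import Data.Nat.ListAction.Properties using (product-↭)
  open import Data.Integer hiding (suc)
  open import Data.Integer.Properties hiding (*-cancelˡ-≤-pos)
  open import Data.Integer.DivMod using (_%ℕ_; n%ℕd<d)
  open import Data.Integer.Tactic.RingSolver using (solve-∀)

  -- Coefficients in ascending order. The index is a formal degree: the leading coefficient may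
  -- vanish modulo p, and `roots-bound` excludes this separately.
  data Poly : ℕ → Set where
    const : ℤ → Poly 0
    _∷_   : ∀ {n} → ℤ → Poly n → Poly (suc n)

  eval : ∀ {n} → Poly n → ℤ → ℤ
  eval (const c) x = c
  eval (c ∷ P)   x = c + x * eval P x

  lead : ∀ {n} → Poly n → ℤ
  lead (const c) = c
  lead (c ∷ P)   = lead P

  addScaled : ∀ {n} → Poly (suc n) → ℤ → Poly n → Poly (suc n)
  addScaled (c ∷ P) r (const d) = (c + r * d) ∷ P
  addScaled (c ∷ P) r (d ∷ Q)   = (c + r * d) ∷ addScaled P r Q

  eval-addScaled : ∀ {n} (P : Poly (suc n)) r Q x → eval (addScaled P r Q) x ≡ eval P x + r * eval Q x
  eval-addScaled (c ∷ P) r (const d) x = lem c (r * d) (x * eval P x)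
    where
    lem : ∀ a b c → a + b + c ≡ a + c + b
    lem = solve-∀
  eval-addScaled (c ∷ P) r (d ∷ Q) x =
    trans (cong (λ t → c + r * d + x * t) (eval-addScaled P r Q x)) (lem c r d x (eval P x) (eval Q x))
    where
    lem : ∀ c r d x P Q → c + r * d + x * (P + r * Q) ≡ c + x * P + r * (d + x * Q)
    lem = solve-∀

  lead-addScaled : ∀ {n} (P : Poly (suc n)) r Q → lead (addScaled P r Q) ≡ lead P
  lead-addScaled (c ∷ P) r (const d) = refl
  lead-addScaled (c ∷ P) r (d ∷ Q)   = lead-addScaled P r Q

  -- Synthetic division by x - r: if P(x) = (x - r) Q(x) + P(r), then c + x P(x) = (x - r)(P(x) + r
  -- Q(x)) + c + r P(r).
  quot : ∀ {n} → Poly (suc n) → ℤ → Poly n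
  quot (c ∷ const d) r = const d
  quot (c ∷ (d ∷ P)) r = addScaled (d ∷ P) r (quot (d ∷ P) r)

  eval-quot : ∀ {n} (P : Poly (suc n)) r x → eval P x ≡ (x - r) * eval (quot P r) x + eval P r
  eval-quot (c ∷ const d) r x = lem c d r x
    where
    lem : ∀ c d r x → c + x * d ≡ (x - r) * d + (c + r * d)
    lem = solve-∀
  eval-quot (c ∷ P@(d ∷ _)) r x =
    trans (lem₁ c x r (eval P x)) (trans (cong (λ t → c + (x - r) * eval P x + r * t) (eval-quot P r x))
      (trans (lem₂ c x r (eval P x) (eval (quot P r) x) (eval P r))
        (cong (λ t → (x - r) * t + (c + r * eval P r)) (sym (eval-addScaled P r (quot P r) x)))))
    where
    lem₁ : ∀ c x r P → c + x * P ≡ c + (x - r) * P + r * P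
    lem₁ = solve-∀
    lem₂ : ∀ c x r P Q R → c + (x - r) * P + r * ((x - r) * Q + R) ≡ (x - r) * (P + r * Q) + (c + r * R)
    lem₂ = solve-∀

  lead-quot : ∀ {n} (P : Poly (suc n)) r → lead (quot P r) ≡ lead P
  lead-quot (c ∷ const d) r = refl
  lead-quot (c ∷ (d ∷ P)) r = lead-addScaled (d ∷ P) r (quot (d ∷ P) r)

  monomial : ∀ n → Poly n
  monomial zero    = const 1ℤ
  monomial (suc n) = 0ℤ ∷ monomial n

  eval-monomial : ∀ n x → eval (monomial n) x ≡ x ^ n
  eval-monomial zero    x = refl
  eval-monomial (suc n) x = trans (+-identityˡ _) (cong (x *_) (eval-monomial n x))

  lead-monomial : ∀ n → lead (monomial n) ≡ 1ℤ
  lead-monomial zero    = refl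
  lead-monomial (suc n) = lead-monomial n

  module _ {p : ℕ} (pr : Prime p) where
    open Mod p
    open PrimeMod pr
    private instance
      p≢0 : ℕ.NonZero p
      p≢0 = prime⇒nonZero pr

    1≉0 : ¬ 1ℤ ≈ 0ℤ
    1≉0 = small≉0 (ℕ.s≤s ℕ.z≤n) (ℕ.nonTrivial⇒n>1 p {{prime⇒nonTrivial pr}})

    -- Divide out one root r. The other roots are distinct residues, so x - r is invertible there
    -- and they are roots of the quotient, which has the same leading coefficient.
    roots-bound : ∀ {n} (P : Poly n) → ¬ lead P ≈ 0ℤ → {rs : List ℕ} → Unique rs → All (ℕ._< p) rs →
                  All (λ r → eval P (+ r) ≈ 0ℤ) rs → length rs ℕ.≤ n
    roots-bound P         l≉0 {[]}     _        _         _        = ℕ.z≤n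
    roots-bound (const c) l≉0 {r ∷ rs} _        _         (e ∷ _)  = contradiction e l≉0
    roots-bound (c ∷ P)   l≉0 {r ∷ rs} (r∉ ∷ u) (r<p ∷ b) (e ∷ es) =
      ℕ.s≤s (roots-bound (quot (c ∷ P) (+ r)) (λ d → l≉0 (subst (_≈ 0ℤ) (lead-quot (c ∷ P) (+ r)) d)) u b
        (All.tabulate λ {x} x∈ → root x (All.lookup r∉ x∈) (All.lookup b x∈) (All.lookup es x∈)))
      where
      Q = quot (c ∷ P) (+ r)
      cancel : ∀ a b → a ≡ a + b - b
      cancel = solve-∀
      factor : ∀ x → eval (c ∷ P) (+ x) ≈ 0ℤ → (+ x - + r) * eval Q (+ x) ≈ 0ℤ
      factor x d = begin
        (+ x - + r) * eval Q (+ x)                  ≡⟨ cancel ((+ x - + r) * eval Q (+ x)) Pr ⟩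
        (+ x - + r) * eval Q (+ x) + Pr - Pr        ≡⟨ cong (λ t → t - Pr) (eval-quot (c ∷ P) (+ r) (+ x)) ⟨
        eval (c ∷ P) (+ x) - Pr                     ≈⟨ sub-cong d e ⟩
        0ℤ                                          ∎
        where
        open SetoidReasoning ≈-setoid
        Pr = eval (c ∷ P) (+ r)
      root : ∀ x → r ≢ x → x ℕ.< p → eval (c ∷ P) (+ x) ≈ 0ℤ → eval Q (+ x) ≈ 0ℤ
      root x r≢x x<p d = [ (λ x≈r → contradiction (sym (residue-unique x<p r<p (x-y≈0⇒ x≈r))) r≢x) , (λ q → q) ]′
        (zero-product (+ x - + r) (eval Q (+ x)) (factor x d))

    power-roots-bound : ∀ n → 0 ℕ.< n → {rs : List ℕ} → Unique rs → All (ℕ._< p) rs →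
                        All (λ r → (+ r) ^ n ≈ 1ℤ) rs → length rs ℕ.≤ n
    power-roots-bound (suc n) _ u b es = roots-bound (-1ℤ ∷ monomial n)
      (λ d → 1≉0 (subst (_≈ 0ℤ) (lead-monomial n) d)) u b
      (All.map (λ {r} e → ≈-trans (≡⇒≈ (cong (λ t → -1ℤ + + r * t) (eval-monomial n (+ r)))) (+-cong (≈-refl { -1ℤ}) e)) es)

    private
      units : List ℕ
      units = applyUpTo suc (ℕ.pred p)

      unit-bounds : ∀ {i} → i ∈ units → 0 ℕ.< i × i ℕ.< p
      unit-bounds i∈ with ∈-applyUpTo⁻ suc i∈
      ... | j , j< , refl = ℕ.s≤s ℕ.z≤n , ℕ.≤-trans (ℕ.s≤s j<) (ℕ.≤-reflexive (ℕ.suc-pred p))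

      bounds-unit : ∀ {i} → 0 ℕ.< i → i ℕ.< p → i ∈ units
      bounds-unit {suc i} _ i<p = ∈-applyUpTo⁺ suc (ℕ.s<s⁻¹ (ℕ.≤-trans i<p (ℕ.≤-reflexive (sym (ℕ.suc-pred p)))))

      product-scaled : ∀ a xs → + product (map (λ i → (a * + i) %ℕ p) xs) ≈ a ^ length xs * + product xs
      product-scaled a []       = ≈-refl
      product-scaled a (x ∷ xs) = begin
        + product (map m (x ∷ xs))                  ≡⟨ pos-* (m x) _ ⟩
        + m x * + product (map m xs)                ≈⟨ *-cong (≈-sym (≈-residue (a * + x))) (product-scaled a xs) ⟩
        a * + x * (a ^ length xs * + product xs)    ≡⟨ lem a (+ x) (a ^ length xs) (+ product xs) ⟩
        a * a ^ length xs * (+ x * + product xs)    ≡⟨ cong (a * a ^ length xs *_) (sym (pos-* x _)) ⟩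
        a * a ^ length xs * + product (x ∷ xs)      ∎
        where
        open SetoidReasoning ≈-setoid
        m : ℕ → ℕ
        m i = (a * + i) %ℕ p
        lem : ∀ a x b c → a * x * (b * c) ≡ a * b * (x * c)
        lem = solve-∀

      product-unit : ∀ xs → (∀ {x} → x ∈ xs → ¬ + x ≈ 0ℤ) → ¬ + product xs ≈ 0ℤ
      product-unit []       _ = 1≉0
      product-unit (x ∷ xs) h d = *-≉0 (h (here refl)) (product-unit xs λ x∈ → h (there x∈))
        (≈-trans (≡⇒≈ (sym (pos-* x _))) d)

    -- Multiplication by a permutes the nonzero residues; comparing the two products and cancelling
    -- their common value leaves the power of a.
    fermat : ∀ a → ¬ a ≈ 0ℤ → a ^ (ℕ.pred p) ≈ 1ℤ
    fermat a a≉0 = *-cancelˡ-≈ (+ product units) (product-unit units λ i∈ → let (l , u) = unit-bounds i∈ in small≉0 l u) (begin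
      + product units * a ^ ℕ.pred p               ≡⟨ *-comm (+ product units) _ ⟩
      a ^ ℕ.pred p * + product units               ≡⟨ cong (λ k → a ^ k * + product units) (sym (length-applyUpTo suc (ℕ.pred p))) ⟩
      a ^ length units * + product units           ≈⟨ product-scaled a units ⟨
      + product (map m units)                      ≡⟨ cong +_ (product-↭ (map-↭ m (Unique.applyUpTo⁺₁ suc _ (λ i<j _ e → ℕ.<⇒≢ i<j (ℕ.suc-injective e))) inj into refl)) ⟩
      + product units                              ≡⟨ *-identityʳ _ ⟨
      + product units * 1ℤ                         ∎)
      where
      open SetoidReasoning ≈-setoid
      m : ℕ → ℕ
      m i = (a * + i) %ℕ p
      inj : ∀ {i j} → i ∈ units → j ∈ units → m i ≡ m j → i ≡ j
      inj {i} {j} i∈ j∈ e = residue-unique (proj₂ (unit-bounds i∈)) (proj₂ (unit-bounds j∈))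
        (*-cancelˡ-≈ a a≉0 (≈-trans (≈-residue (a * + i)) (≈-trans (≡⇒≈ (cong +_ e)) (≈-sym (≈-residue (a * + j))))))
      into : ∀ {i} → i ∈ units → m i ∈ units
      into {i} i∈ with m i in e
      ... | zero  = contradiction (≈-trans (≈-residue (a * + i)) (≡⇒≈ (cong +_ e)))
                      (*-≉0 a≉0 (let (l , u) = unit-bounds i∈ in small≉0 l u))
      ... | suc k = bounds-unit (ℕ.s≤s ℕ.z≤n) (subst (ℕ._< p) e (n%ℕd<d (a * + i) p))

-- Functions of period p: sums over a period, autocorrelation, convolution.

module Periodic where
  open ListSum
  open Congruence
  open PrimeField using (1≉0)
  open import Data.Integer hiding (suc)
  open import Data.Integer.Properties hiding (_≟_)
  open import Data.Integer.DivMod using (_%ℕ_; n%ℕd<d)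
  open import Data.Integer.Tactic.RingSolver using (solve-∀)
  open import Data.List.Relation.Unary.Unique.Propositional.Properties using (upTo⁺)

  module Period {p : ℕ} (pr : Prime p) where
    open Mod p
    open PrimeMod pr
    private instance
      p≢0 : ℕ.NonZero p
      p≢0 = prime⇒nonZero pr

    Periodic : (ℤ → ℤ) → Set
    Periodic g = ∀ {x y} → x ≈ y → g x ≡ g y

    ∑ₚ : (ℤ → ℤ) → ℤ
    ∑ₚ g = ∑[ z ∈ upTo p ] g (+ z)

    -- As c is invertible, z ↦ t + zc permutes the residues. All cancellation in the moment bound
    -- comes from this substitution.
    ∑ₚ-affine : ∀ {g} → Periodic g → ∀ t c → ¬ c ≈ 0ℤ → ∑ₚ (λ z → g (t + z * c)) ≡ ∑ₚ g
    ∑ₚ-affine {g} per t c c≉0 = begin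
      ∑ₚ (λ z → g (t + z * c))              ≡⟨ ∑-cong (upTo p) (λ z → per (≈-residue (t + + z * c))) ⟩
      ∑[ z ∈ upTo p ] g (+ m z)             ≡⟨ ∑-map m (upTo p) (λ z → g (+ z)) ⟨
      ∑ (map m (upTo p)) (λ z → g (+ z))    ≡⟨ ∑-↭ (map-↭ m (upTo⁺ p) inj into refl) (λ z → g (+ z)) ⟩
      ∑ₚ g                                  ∎
      where
      open ≡-Reasoning
      m : ℕ → ℕ
      m z = (t + + z * c) %ℕ p
      cancel : ∀ t z c → t + z * c - t ≡ c * z
      cancel = solve-∀
      inj : ∀ {i j} → i ∈ upTo p → j ∈ upTo p → m i ≡ m j → i ≡ j
      inj {i} {j} i∈ j∈ e = residue-unique (∈-upTo⁻ i∈) (∈-upTo⁻ j∈) (*-cancelˡ-≈ c c≉0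
        (≈-trans (≡⇒≈ (sym (cancel t (+ i) c))) (≈-trans (sub-cong i≈j (≈-refl {t})) (≡⇒≈ (cancel t (+ j) c)))))
        where
        i≈j : t + + i * c ≈ t + + j * c
        i≈j = ≈-trans (≈-residue (t + + i * c)) (≈-trans (≡⇒≈ (cong +_ e)) (≈-sym (≈-residue (t + + j * c))))
      into : ∀ {i} → i ∈ upTo p → m i ∈ upTo p
      into {i} _ = ∈-upTo⁺ (n%ℕd<d (t + + i * c) p)


    ∑ₚ-translate : ∀ {g} → Periodic g → ∀ t → ∑ₚ (λ z → g (z + t)) ≡ ∑ₚ g
    ∑ₚ-translate {g} per t = trans (∑-cong (upTo p) λ z → cong g (lem (+ z) t)) (∑ₚ-affine per t 1ℤ (1≉0 pr))
      where
      lem : ∀ z t → z + t ≡ t + z * 1ℤ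
      lem = solve-∀

    ∑ₚ-reflect : ∀ {g} → Periodic g → ∀ t → ∑ₚ (λ z → g (t - z)) ≡ ∑ₚ g
    ∑ₚ-reflect {g} per t = trans (∑-cong (upTo p) λ z → cong g (lem (+ z) t))
      (∑ₚ-affine per t -1ℤ (λ d → 1≉0 pr (neg-cong d)))
      where
      lem : ∀ z t → t - z ≡ t + z * -1ℤ
      lem = solve-∀

    ∑ₚ-pick : ∀ {g} → Periodic g → ∀ t → ∑ₚ (λ z → ⟦ z ≈? t ⟧ * g z) ≡ g t
    ∑ₚ-pick {g} per t = begin
      ∑ₚ (λ z → ⟦ z ≈? t ⟧ * g z)      ≡⟨ ∑-single (λ z → ⟦ + z ≈? t ⟧ * g (+ z)) (upTo⁺ p) (∈-upTo⁺ r<p) other ⟩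
      ⟦ + r ≈? t ⟧ * g (+ r)           ≡⟨ cong₂ _*_ (⟦⟧-yes (+ r ≈? t) (≈-sym (≈-residue t))) (per (≈-sym (≈-residue t))) ⟩
      1ℤ * g t                         ≡⟨ *-identityˡ (g t) ⟩
      g t                              ∎
      where
      open ≡-Reasoning
      r = t %ℕ p
      r<p = n%ℕd<d t p
      other : ∀ z → z ∈ upTo p → ¬ z ≡ r → ⟦ + z ≈? t ⟧ * g (+ z) ≡ 0ℤ
      other z z∈ z≢r = trans (cong (_* g (+ z)) (⟦⟧-no (+ z ≈? t) λ d → z≢r (residue-unique (∈-upTo⁻ z∈) r<p (≈-trans d (≈-residue t)))))
                             (*-zeroˡ (g (+ z)))

    norm : (ℤ → ℤ) → ℤ
    norm g = ∑ₚ (λ c → g c * g c)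

    ρ : (ℤ → ℤ) → ℤ → ℤ
    ρ g t = ∑ₚ (λ c → g (c + t) * g c)

    0≤norm : ∀ g → 0ℤ ≤ norm g
    0≤norm g = ∑-nonneg (upTo p) λ c → 0≤i*i (g (+ c))

    module Correlation {g : ℤ → ℤ} (per : Periodic g) where

      ρ-periodic : Periodic (ρ g)
      ρ-periodic d = ∑-cong (upTo p) λ c → cong (_* g (+ c)) (per (+-cong (≈-refl {+ c}) d))

      sq-periodic : Periodic (λ x → g x * g x)
      sq-periodic d = cong₂ _*_ (per d) (per d)

      ∑ₚ-shifted-* : ∀ s t → ∑ₚ (λ c → g (c + s) * g (c + t)) ≡ ρ g (s - t)
      ∑ₚ-shifted-* s t = trans (sym (∑ₚ-translate {λ c → g (c + s) * g (c + t)}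
          (λ d → cong₂ _*_ (per (+-cong d (≈-refl {s}))) (per (+-cong d (≈-refl {t})))) (- t)))
        (∑-cong (upTo p) λ c → cong₂ _*_ (cong g (lem₁ (+ c) s t)) (cong g (lem₂ (+ c) t)))
        where
        lem₁ : ∀ c s t → c + - t + s ≡ c + (s - t)
        lem₁ = solve-∀
        lem₂ : ∀ c t → c + - t + t ≡ c
        lem₂ = solve-∀

      ρ≤norm : ∀ t → ρ g t ≤ norm g
      ρ≤norm t = *-cancelˡ-≤-pos (ρ g t) (norm g) (+ 2) (begin
        + 2 * ρ g t                                         ≡⟨ ∑-*ˡ (+ 2) (upTo p) (λ c → g (+ c + t) * g (+ c)) ⟨
        ∑ₚ (λ c → + 2 * (g (c + t) * g c))                  ≤⟨ ∑-mono (upTo p) (λ c _ → am-gm (g (+ c + t)) (g (+ c))) ⟩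
        ∑ₚ (λ c → g (c + t) * g (c + t) + g c * g c)        ≡⟨ ∑-distrib-+ (upTo p) (λ c → g (+ c + t) * g (+ c + t)) (λ c → g (+ c) * g (+ c)) ⟩
        ∑ₚ (λ c → g (c + t) * g (c + t)) + norm g           ≡⟨ cong (_+ norm g) (∑ₚ-translate sq-periodic t) ⟩
        norm g + norm g                                     ≡⟨ double (norm g) ⟩
        + 2 * norm g                                        ∎)
        where
        open ≤-Reasoning
        am-gm : ∀ a b → + 2 * (a * b) ≤ a * a + b * b
        am-gm a b = 0≤i-j⇒j≤i (subst (0ℤ ≤_) (lem a b) (0≤i*i (a - b)))
          where
          lem : ∀ a b → (a - b) * (a - b) ≡ a * a + b * b - + 2 * (a * b)
          lem = solve-∀

      ∑ρ≡0 : ∑ₚ g ≡ 0ℤ → ∑ₚ (ρ g) ≡ 0ℤ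
      ∑ρ≡0 mean0 = begin
        ∑ₚ (λ t → ∑ₚ (λ c → g (c + t) * g c))      ≡⟨ ∑-swap (upTo p) (upTo p) (λ t c → g (+ c + + t) * g (+ c)) ⟩
        ∑ₚ (λ c → ∑ₚ (λ t → g (c + t) * g c))      ≡⟨ ∑-cong (upTo p) (λ c → inner (+ c)) ⟩
        ∑[ c ∈ upTo p ] 0ℤ                         ≡⟨ ∑-zero (upTo p) ⟩
        0ℤ                                         ∎
        where
        open ≡-Reasoning
        inner : ∀ c → ∑ₚ (λ t → g (c + t) * g c) ≡ 0ℤ
        inner c = begin
          ∑ₚ (λ t → g (c + t) * g c)    ≡⟨ ∑-*ʳ (g c) (upTo p) (λ t → g (c + + t)) ⟩
          ∑ₚ (λ t → g (c + t)) * g c    ≡⟨ cong (_* g c) (∑-cong (upTo p) λ t → cong g (+-comm c (+ t))) ⟩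
          ∑ₚ (λ t → g (t + c)) * g c    ≡⟨ cong (_* g c) (trans (∑ₚ-translate per c) mean0) ⟩
          0ℤ * g c                      ≡⟨ *-zeroˡ (g c) ⟩
          0ℤ                            ∎

      ∑ρ-affine≡0 : ∑ₚ g ≡ 0ℤ → ∀ t c → ¬ c ≈ 0ℤ → ∑ₚ (λ z → ρ g (t + z * c)) ≡ 0ℤ
      ∑ρ-affine≡0 mean0 t c c≉0 = trans (∑ₚ-affine ρ-periodic t c c≉0) (∑ρ≡0 mean0)

      module _ {B : Set} (bs : List B) (ι t : B → ℤ) where

        -- The convolution of g with the measure that puts mass ι(b) at t(b).
        combination : ℤ → ℤ
        combination c = ∑[ b ∈ bs ] ι b * g (c - t b)

        private
          bb = cartesianProduct bs bs
          ι₂ : B × B → ℤ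
          ι₂ (b , b′) = ι b * ι b′
          t₂ : B × B → ℤ
          t₂ (b , b′) = t b′ - t b
          -- For the convolution operator K with K g = `combination`, this is K*K g, so that the
          -- squared norm of K g is the inner product of g and `Z`.
          Z : ℤ → ℤ
          Z c = ∑[ q ∈ bb ] ι₂ q * g (c + t₂ q)

          norm-combination : norm combination ≡ ∑ₚ (λ c → g c * Z c)
          norm-combination = begin
            ∑ₚ (λ c → combination c * combination c)
              ≡⟨ ∑-cong (upTo p) (λ c → trans (∑-* bs bs (λ b → ι b * g (+ c - t b)) (λ b → ι b * g (+ c - t b)))
                                           (sym (∑-cartesianProduct bs bs (λ q → term q (+ c))))) ⟩
            ∑ₚ (λ c → ∑[ q ∈ bb ] term q c)
              ≡⟨ ∑-swap (upTo p) bb (λ c q → term q (+ c)) ⟩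
            ∑[ q ∈ bb ] ∑ₚ (term q)
              ≡⟨ ∑-cong bb inner ⟩
            ∑[ q ∈ bb ] ∑ₚ (λ c → g c * (ι₂ q * g (c + t₂ q)))
              ≡⟨ ∑-swap bb (upTo p) (λ q c → g (+ c) * (ι₂ q * g (+ c + t₂ q))) ⟩
            ∑ₚ (λ c → ∑[ q ∈ bb ] g c * (ι₂ q * g (c + t₂ q)))
              ≡⟨ ∑-cong (upTo p) (λ c → ∑-*ˡ (g (+ c)) bb (λ q → ι₂ q * g (+ c + t₂ q))) ⟩
            ∑ₚ (λ c → g c * Z c) ∎
            where
            open ≡-Reasoning
            term : B × B → ℤ → ℤ
            term (b , b′) c = ι b * g (c - t b) * (ι b′ * g (c - t b′))
            lem₁ : ∀ a x b y → a * x * (b * y) ≡ a * b * (x * y)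
            lem₁ = solve-∀
            lem₂ : ∀ a x y → a * (x * y) ≡ y * (a * x)
            lem₂ = solve-∀
            lem₃ : ∀ a b → - a - - b ≡ b - a
            lem₃ = solve-∀
            inner : ∀ q → ∑ₚ (term q) ≡ ∑ₚ (λ c → g c * (ι₂ q * g (c + t₂ q)))
            inner (b , b′) = begin
              ∑ₚ (term (b , b′))
                ≡⟨ ∑-cong (upTo p) (λ c → lem₁ (ι b) (g (+ c - t b)) (ι b′) (g (+ c - t b′))) ⟩
              ∑ₚ (λ c → ι b * ι b′ * (g (c - t b) * g (c - t b′)))
                ≡⟨ ∑-*ˡ (ι b * ι b′) (upTo p) (λ c → g (+ c - t b) * g (+ c - t b′)) ⟩
              ι b * ι b′ * ∑ₚ (λ c → g (c - t b) * g (c - t b′))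
                ≡⟨ cong (ι b * ι b′ *_) (trans (∑ₚ-shifted-* (- t b) (- t b′)) (cong (ρ g) (lem₃ (t b) (t b′)))) ⟩
              ι b * ι b′ * ρ g (t b′ - t b)
                ≡⟨ ∑-*ˡ (ι b * ι b′) (upTo p) (λ c → g (+ c + (t b′ - t b)) * g (+ c)) ⟨
              ∑ₚ (λ c → ι b * ι b′ * (g (c + (t b′ - t b)) * g c))
                ≡⟨ ∑-cong (upTo p) (λ c → lem₂ (ι b * ι b′) (g (+ c + (t b′ - t b))) (g (+ c))) ⟩
              ∑ₚ (λ c → g c * (ι b * ι b′ * g (c + (t b′ - t b)))) ∎

          norm-Z : norm Z ≡ ∑[ q ∈ bb ] ∑[ q′ ∈ bb ] ι₂ q * ι₂ q′ * ρ g (t₂ q - t₂ q′)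
          norm-Z = begin
            ∑ₚ (λ c → Z c * Z c)
              ≡⟨ ∑-cong (upTo p) (λ c → ∑-* bb bb (λ q → ι₂ q * g (+ c + t₂ q)) (λ q → ι₂ q * g (+ c + t₂ q))) ⟩
            ∑ₚ (λ c → ∑[ q ∈ bb ] ∑[ q′ ∈ bb ] term q q′ c)
              ≡⟨ ∑-swap (upTo p) bb (λ c q → ∑[ q′ ∈ bb ] term q q′ (+ c)) ⟩
            ∑[ q ∈ bb ] ∑ₚ (λ c → ∑[ q′ ∈ bb ] term q q′ c)
              ≡⟨ ∑-cong bb (λ q → trans (∑-swap (upTo p) bb (λ c q′ → term q q′ (+ c))) (∑-cong bb (inner q))) ⟩
            ∑[ q ∈ bb ] ∑[ q′ ∈ bb ] ι₂ q * ι₂ q′ * ρ g (t₂ q - t₂ q′) ∎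
            where
            open ≡-Reasoning
            term : B × B → B × B → ℤ → ℤ
            term q q′ c = ι₂ q * g (c + t₂ q) * (ι₂ q′ * g (c + t₂ q′))
            lem₁ : ∀ a x b y → a * x * (b * y) ≡ a * b * (x * y)
            lem₁ = solve-∀
            inner : ∀ q q′ → ∑ₚ (term q q′) ≡ ι₂ q * ι₂ q′ * ρ g (t₂ q - t₂ q′)
            inner q q′ = begin
              ∑ₚ (term q q′)
                ≡⟨ ∑-cong (upTo p) (λ c → lem₁ (ι₂ q) (g (+ c + t₂ q)) (ι₂ q′) (g (+ c + t₂ q′))) ⟩
              ∑ₚ (λ c → ι₂ q * ι₂ q′ * (g (c + t₂ q) * g (c + t₂ q′)))
                ≡⟨ ∑-*ˡ (ι₂ q * ι₂ q′) (upTo p) (λ c → g (+ c + t₂ q) * g (+ c + t₂ q′)) ⟩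
              ι₂ q * ι₂ q′ * ∑ₚ (λ c → g (c + t₂ q) * g (c + t₂ q′))
                ≡⟨ cong (ι₂ q * ι₂ q′ *_) (∑ₚ-shifted-* (t₂ q) (t₂ q′)) ⟩
              ι₂ q * ι₂ q′ * ρ g (t₂ q - t₂ q′) ∎

        fourthMoment : ℤ
        fourthMoment = ∑[ q ∈ bb ] ∑[ q′ ∈ bb ] ι₂ q * ι₂ q′ * ρ g (t₂ q - t₂ q′)

        -- It is the norm of `Z`, though single summands may be negative. The sign is what later
        -- permits enlarging the set of cells.
        0≤fourthMoment : 0ℤ ≤ fourthMoment
        0≤fourthMoment = subst (0ℤ ≤_) norm-Z (0≤norm Z)

        -- Cauchy-Schwarz for the inner product of g and `Z`. It trades a correlation of two shifts
        -- for one of four, which has few stationary cases on average.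
        norm-combination² : norm combination * norm combination ≤ norm g * fourthMoment
        norm-combination² = begin
          norm combination * norm combination               ≡⟨ cong₂ _*_ norm-combination norm-combination ⟩
          ∑ₚ (λ c → g c * Z c) * ∑ₚ (λ c → g c * Z c)       ≤⟨ cauchy-schwarz (upTo p) (λ c → g (+ c)) (λ c → Z (+ c)) ⟩
          norm g * norm Z                                   ≡⟨ cong (norm g *_) norm-Z ⟩
          norm g * fourthMoment                             ∎
          where open ≤-Reasoning

-- Fermat quotients modulo p² and their relation to polynomial quotients.

module FermatQuotient where
  open import Defs using (q)
  open Congruence
  open PrimeField using (fermat)
  open import Data.Integer hiding (suc)
  open import Data.Integer.Properties hiding (_≟_)
  open import Data.Integer.DivMod using (_/ℕ_; a≡a%ℕn+[a/ℕn]*n)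
  open import Data.Integer.Divisibility.Signed using (divides; *-cancelʳ-∣)
  open import Data.Integer.Tactic.RingSolver using (solve-∀)

  module Quotient {p : ℕ} (pr : Prime p) where
    open Mod p
    open PrimeMod pr
    open Mod (p ℕ.* p) public using () renaming
      ( _≈_ to _≈₂_; mk to mk₂; ≡⇒≈ to ≡⇒≈₂; ≈-refl to ≈₂-refl; ≈-sym to ≈₂-sym; ≈-trans to ≈₂-trans
      ; +-cong to +-cong₂; *-cong to *-cong₂; sub-cong to sub-cong₂; ^-cong to ^-cong₂; ≈-setoid to ≈₂-setoid
      ; add-multiple to add-multiple₂)
    private instance
      p≢0 : ℕ.NonZero p
      p≢0 = prime⇒nonZero pr

    private
      P = + p
      PP : + (p ℕ.* p) ≡ P * P
      PP = pos-* p p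

    suc[p∸2] : suc (p ℕ.∸ 2) ≡ ℕ.pred p
    suc[p∸2] = sym (ℕ.+-∸-assoc 1 (ℕ.nonTrivial⇒n>1 p {{prime⇒nonTrivial pr}}))

    ≈₂⇒≈ : ∀ {x y} → x ≈₂ y → x ≈ y
    ≈₂⇒≈ {x} {y} (mk₂ (divides k e)) = mk (divides (k * P) (trans e (trans (cong (k *_) PP) (sym (*-assoc k P P)))))

    scale : ∀ {x y} → x ≈ y → P * x ≈₂ P * y
    scale {x} {y} (mk (divides k e)) = mk₂ (divides k (trans (lem₁ P x y) (trans (cong (P *_) e)
      (trans (lem₂ P k) (cong (k *_) (sym PP))))))
      where
      lem₁ : ∀ P x y → P * x - P * y ≡ P * (x - y)
      lem₁ = solve-∀
      lem₂ : ∀ P k → P * (k * P) ≡ k * (P * P)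
      lem₂ = solve-∀

    unscale : ∀ {x y} → P * x ≈₂ P * y → x ≈ y
    unscale {x} {y} (mk₂ (divides k e)) = mk (*-cancelʳ-∣ P (divides k (trans (lem P x y) (trans e (cong (k *_) PP)))))
      where
      lem : ∀ P x y → (x - y) * P ≡ P * x - P * y
      lem = solve-∀

    -- In the binomial expansion every term after the linear one carries the factor p².
    power-shift : ∀ n x z → (x + P * z) ^ suc n ≈₂ x ^ suc n + P * (+ suc n * x ^ n * z)
    power-shift zero x z = ≡⇒≈₂ (lem x z P)
      where
      lem : ∀ x z P → (x + P * z) * 1ℤ ≡ x * 1ℤ + P * (1ℤ * 1ℤ * z)
      lem = solve-∀
    power-shift (suc n) x z = begin
      (x + P * z) * (x + P * z) ^ suc n
        ≈⟨ *-cong₂ (≈₂-refl {x + P * z}) (power-shift n x z) ⟩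
      (x + P * z) * (x ^ suc n + P * (+ suc n * x ^ n * z))
        ≡⟨ lem x P z (x ^ n) (+ suc n) ⟩
      x * x ^ suc n + P * ((1ℤ + + suc n) * x ^ suc n * z) + (P * P) * (+ suc n * x ^ n * z * z)
        ≡⟨ cong (λ t → x * x ^ suc n + P * ((1ℤ + + suc n) * x ^ suc n * z) + t * (+ suc n * x ^ n * z * z)) (sym PP) ⟩
      x * x ^ suc n + P * ((1ℤ + + suc n) * x ^ suc n * z) + + (p ℕ.* p) * (+ suc n * x ^ n * z * z)
        ≈⟨ add-multiple₂ (x * x ^ suc n + P * ((1ℤ + + suc n) * x ^ suc n * z)) (+ suc n * x ^ n * z * z) ⟩
      x * x ^ suc n + P * (+ suc (suc n) * x ^ suc n * z) ∎
      where
      open SetoidReasoning ≈₂-setoid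
      lem : ∀ x P z y k → (x + P * z) * (x * y + P * (k * y * z))
                        ≡ x * (x * y) + P * ((1ℤ + k) * (x * y) * z) + P * P * (k * y * z * z)
      lem = solve-∀

    -- The Fermat quotient (x^(p-1) - 1)/p of a unit x: the floor division drops the remainder 1.
    fq : ℤ → ℤ
    fq x = (x ^ ℕ.pred p) /ℕ p

    exact : ∀ {r} x → r ℕ.< p → x ≈ + r → x ≡ + r + P * (x /ℕ p)
    exact {r} x r<p d = trans (a≡a%ℕn+[a/ℕn]*n x p)
      (cong₂ _+_ (cong +_ (%ℕ-small x r<p d)) (*-comm (x /ℕ p) P))

    fq-spec : ∀ x → ¬ x ≈ 0ℤ → x ^ ℕ.pred p ≡ 1ℤ + P * fq x
    fq-spec x x≉0 = exact (x ^ ℕ.pred p) (ℕ.nonTrivial⇒n>1 p {{prime⇒nonTrivial pr}}) (fermat pr x x≉0)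

    private
      drop-1 : ∀ {x y} → 1ℤ + P * x ≈₂ 1ℤ + P * y → x ≈ y
      drop-1 {x} {y} d = unscale (≈₂-trans (≡⇒≈₂ (lem (P * x))) (≈₂-trans (sub-cong₂ d (≈₂-refl {1ℤ})) (≡⇒≈₂ (sym (lem (P * y))))))
        where
        lem : ∀ a → a ≡ 1ℤ + a - 1ℤ
        lem = solve-∀

    -- The device behind all identities for `fq`: expand the (p-1)-st power modulo p² and read off
    -- the coefficient of p.
    fq-unique : ∀ x k → ¬ x ≈ 0ℤ → x ^ ℕ.pred p ≈₂ 1ℤ + P * k → fq x ≈ k
    fq-unique x k x≉0 d = drop-1 (≈₂-trans (≡⇒≈₂ (sym (fq-spec x x≉0))) d)

    fq-cong : ∀ {x y} → ¬ x ≈ 0ℤ → ¬ y ≈ 0ℤ → x ≈₂ y → fq x ≈ fq y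
    fq-cong {x} {y} x≉0 y≉0 d = fq-unique x (fq y) x≉0 (≈₂-trans (^-cong₂ (ℕ.pred p) d) (≡⇒≈₂ (fq-spec y y≉0)))

    *-^ : ∀ x y n → (x * y) ^ n ≡ x ^ n * y ^ n
    *-^ x y zero    = refl
    *-^ x y (suc n) = trans (cong (x * y *_) (*-^ x y n)) (lem x y (x ^ n) (y ^ n))
      where
      lem : ∀ x y a b → x * y * (a * b) ≡ x * a * (y * b)
      lem = solve-∀

    fq-* : ∀ {x y} → ¬ x ≈ 0ℤ → ¬ y ≈ 0ℤ → fq (x * y) ≈ fq x + fq y
    fq-* {x} {y} x≉0 y≉0 = fq-unique (x * y) (fq x + fq y) (*-≉0 x≉0 y≉0) (begin
      (x * y) ^ ℕ.pred p                                  ≡⟨ *-^ x y (ℕ.pred p) ⟩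
      x ^ ℕ.pred p * y ^ ℕ.pred p                         ≡⟨ cong₂ _*_ (fq-spec x x≉0) (fq-spec y y≉0) ⟩
      (1ℤ + P * fq x) * (1ℤ + P * fq y)                   ≡⟨ lem P (fq x) (fq y) ⟩
      1ℤ + P * (fq x + fq y) + P * P * (fq x * fq y)      ≡⟨ cong (λ t → 1ℤ + P * (fq x + fq y) + t * (fq x * fq y)) (sym PP) ⟩
      1ℤ + P * (fq x + fq y) + + (p ℕ.* p) * (fq x * fq y) ≈⟨ add-multiple₂ (1ℤ + P * (fq x + fq y)) (fq x * fq y) ⟩
      1ℤ + P * (fq x + fq y)                              ∎)
      where
      open SetoidReasoning ≈₂-setoid
      lem : ∀ P a b → (1ℤ + P * a) * (1ℤ + P * b) ≡ 1ℤ + P * (a + b) + P * P * (a * b)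
      lem = solve-∀

    inv : ℤ → ℤ
    inv x = x ^ (p ℕ.∸ 2)

    inv-spec : ∀ {x} → ¬ x ≈ 0ℤ → x * inv x ≈ 1ℤ
    inv-spec {x} x≉0 = ≈-trans (≡⇒≈ (cong (x ^_) suc[p∸2])) (fermat pr x x≉0)

    inv-≉0 : ∀ {x} → ¬ x ≈ 0ℤ → ¬ inv x ≈ 0ℤ
    inv-≉0 {x} x≉0 d = x≉0 (^-≈0 x (p ℕ.∸ 2) d)

    shift-≉0 : ∀ {x} z → ¬ x ≈ 0ℤ → ¬ x + P * z ≈ 0ℤ
    shift-≉0 {x} z x≉0 d = x≉0 (≈-trans (≈-sym (add-multiple x z)) d)

    -- The linear term of `power-shift` for the exponent p-1 has the coefficient p-1 ≡ -1, and
    -- x^(p-2) is the inverse of x.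
    fq-shift : ∀ {x} z → ¬ x ≈ 0ℤ → fq (x + P * z) ≈ fq x - z * inv x
    fq-shift {x} z x≉0 = fq-unique (x + P * z) (fq x - z * inv x) (shift-≉0 z x≉0) (begin
      (x + P * z) ^ ℕ.pred p
        ≡⟨ cong ((x + P * z) ^_) (sym suc[p∸2]) ⟩
      (x + P * z) ^ suc (p ℕ.∸ 2)
        ≈⟨ power-shift (p ℕ.∸ 2) x z ⟩
      x ^ suc (p ℕ.∸ 2) + P * (+ suc (p ℕ.∸ 2) * inv x * z)
        ≡⟨ cong₂ (λ t k → t + P * (k * inv x * z)) (trans (cong (x ^_) suc[p∸2]) (fq-spec x x≉0)) coefficient ⟩
      1ℤ + P * fq x + P * ((P - 1ℤ) * inv x * z)
        ≡⟨ lem P (fq x) (inv x) z ⟩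
      1ℤ + P * (fq x - z * inv x) + P * P * (inv x * z)
        ≡⟨ cong (λ t → 1ℤ + P * (fq x - z * inv x) + t * (inv x * z)) (sym PP) ⟩
      1ℤ + P * (fq x - z * inv x) + + (p ℕ.* p) * (inv x * z)
        ≈⟨ add-multiple₂ (1ℤ + P * (fq x - z * inv x)) (inv x * z) ⟩
      1ℤ + P * (fq x - z * inv x) ∎)
      where
      open SetoidReasoning ≈₂-setoid
      lem : ∀ P f i z → 1ℤ + P * f + P * ((P - 1ℤ) * i * z) ≡ 1ℤ + P * (f - z * i) + P * P * (i * z)
      lem = solve-∀
      cancel : ∀ a → a ≡ 1ℤ + a - 1ℤ
      cancel = solve-∀
      coefficient : + suc (p ℕ.∸ 2) ≡ P - 1ℤ
      coefficient = trans (cong +_ suc[p∸2]) (trans (cancel (+ ℕ.pred p)) (cong (λ t → + t - 1ℤ) (ℕ.suc-pred p)))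

    -- Write x = y + pz. By the shift formula, equal Fermat quotients force z/y ≡ 0, so p divides z:
    -- residue and Fermat quotient together determine a unit modulo p².
    ≈-lift : ∀ {x y} → ¬ y ≈ 0ℤ → x ≈ y → fq x ≈ fq y → x ≈₂ y
    ≈-lift {x} {y} y≉0 (mk (divides z e)) f = ≈₂-trans (≡⇒≈₂ x≡) (≈₂-trans (+-cong₂ (≈₂-refl {y}) (≈₂-trans (scale z≈0) (≡⇒≈₂ (*-zeroʳ P))))
                                                  (≡⇒≈₂ (+-identityʳ y)))
      where
      lem : ∀ x y → x ≡ y + (x - y)
      lem = solve-∀
      x≡ : x ≡ y + P * z
      x≡ = trans (lem x y) (cong (_+_ (y)) (trans e (*-comm z P)))
      lem₂ : ∀ a b → b ≡ a - (a - b)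
      lem₂ = solve-∀
      zi≈0 : inv y * z ≈ inv y * 0ℤ
      zi≈0 = begin
        inv y * z                      ≡⟨ *-comm (inv y) z ⟩
        z * inv y                      ≡⟨ lem₂ (fq y) (z * inv y) ⟩
        fq y - (fq y - z * inv y)      ≈⟨ sub-cong (≈-refl {fq y}) (fq-shift z y≉0) ⟨
        fq y - fq (y + P * z)          ≡⟨ cong (λ t → fq y - fq t) (sym x≡) ⟩
        fq y - fq x                    ≈⟨ sub-cong (≈-refl {fq y}) f ⟩
        fq y - fq y                    ≡⟨ +-inverseʳ (fq y) ⟩
        0ℤ                             ≡⟨ *-zeroʳ (inv y) ⟨
        inv y * 0ℤ                     ∎
        where open SetoidReasoning ≈-setoid
      z≈0 : z ≈ 0ℤ
      z≈0 = *-cancelˡ-≈ (inv y) (inv-≉0 y≉0) zi≈0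

    -- One Newton step lifts the inverse modulo p to an inverse modulo p².
    inv₂ : ℤ → ℤ
    inv₂ x = inv x * (+ 2 - x * inv x)

    inv₂-spec : ∀ {x} → ¬ x ≈ 0ℤ → x * inv₂ x ≈₂ 1ℤ
    inv₂-spec {x} x≉0 = newton (inv-spec x≉0)
      where
      open SetoidReasoning ≈₂-setoid
      lem₁ : ∀ x i → x * (i * (+ 2 - x * i)) ≡ 1ℤ - (x * i - 1ℤ) * (x * i - 1ℤ)
      lem₁ = solve-∀
      lem₂ : ∀ k P → 1ℤ - k * P * (k * P) ≡ 1ℤ + P * P * (- (k * k))
      lem₂ = solve-∀
      newton : x * inv x ≈ 1ℤ → x * inv₂ x ≈₂ 1ℤ
      newton (mk (divides k e)) = begin
        x * inv₂ x                                  ≡⟨ lem₁ x (inv x) ⟩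
        1ℤ - (x * inv x - 1ℤ) * (x * inv x - 1ℤ)    ≡⟨ cong (λ t → 1ℤ - t * t) e ⟩
        1ℤ - k * P * (k * P)                        ≡⟨ lem₂ k P ⟩
        1ℤ + P * P * (- (k * k))                    ≡⟨ cong (λ t → 1ℤ + t * (- (k * k))) (sym PP) ⟩
        1ℤ + + (p ℕ.* p) * (- (k * k))              ≈⟨ add-multiple₂ 1ℤ (- (k * k)) ⟩
        1ℤ                                          ∎

    private
      one-plus-power : ∀ w f → (1ℤ + P * f) ^ w ≈₂ 1ℤ + P * (+ w * f)
      one-plus-power zero    f = ≡⇒≈₂ (lem P f)
        where
        lem : ∀ P f → 1ℤ ≡ 1ℤ + P * (0ℤ * f)
        lem = solve-∀
      one-plus-power (suc w) f = ≈₂-trans (power-shift w 1ℤ f)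
        (≡⇒≈₂ (cong₂ (λ a b → a + P * b) (^-zeroˡ (suc w)) (cong (_* f) (trans (cong (+ suc w *_) (^-zeroˡ w)) (*-identityʳ (+ suc w))))))

    -- u^(wp) = u^w (u^(p-1))^w = u^w (1 + p f)^w ≡ u^w (1 + p w f) modulo p²; subtract this from
    -- u^w and divide by p.
    q-fq : ∀ w u → ¬ + u ≈ 0ℤ → + q p w u ≈ - (+ w * (+ u) ^ w) * fq (+ u)
    q-fq w u u≉0 = ≈-trans (≈-sym (≈-residue (D /ℕ p))) (unscale (begin
        P * (D /ℕ p)              ≡⟨ +-identityˡ (P * (D /ℕ p)) ⟨
        0ℤ + P * (D /ℕ p)         ≡⟨ exact D (ℕ.>-nonZero⁻¹ p) D≈0 ⟨
        D                         ≈⟨ D≈₂ ⟩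
        P * (- (+ w * U ^ w) * fq U) ∎))
      where
      open SetoidReasoning ≈₂-setoid
      U = + u
      D = + (u ℕ.^ w) - + (u ℕ.^ (w ℕ.* p))
      lem : ∀ P a w f → a - a * (1ℤ + P * (w * f)) ≡ P * (- (w * a) * f)
      lem = solve-∀
      exponent : u ℕ.^ (w ℕ.* p) ≡ u ℕ.^ w ℕ.* (u ℕ.^ ℕ.pred p) ℕ.^ w
      exponent = trans (cong (u ℕ.^_) (trans (cong (w ℕ.*_) (sym (ℕ.suc-pred p))) (ℕ.*-suc w (ℕ.pred p))))
        (trans (ℕ.^-distribˡ-+-* u w (w ℕ.* ℕ.pred p)) (cong (u ℕ.^ w ℕ.*_)
          (trans (cong (u ℕ.^_) (ℕ.*-comm w (ℕ.pred p))) (sym (ℕ.^-*-assoc u (ℕ.pred p) w)))))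
      power : + (u ℕ.^ (w ℕ.* p)) ≡ U ^ w * (1ℤ + P * fq U) ^ w
      power = trans (cong +_ exponent) (trans (pos-* (u ℕ.^ w) _) (cong₂ _*_ (pos-^ u w)
        (trans (pos-^ (u ℕ.^ ℕ.pred p) w) (cong (_^ w) (trans (pos-^ u (ℕ.pred p)) (fq-spec U u≉0))))))
      D≈₂ : D ≈₂ P * (- (+ w * U ^ w) * fq U)
      D≈₂ = begin
        D                                                  ≡⟨ cong₂ _-_ (pos-^ u w) power ⟩
        U ^ w - U ^ w * (1ℤ + P * fq U) ^ w                ≈⟨ sub-cong₂ (≈₂-refl {U ^ w}) (*-cong₂ (≈₂-refl {U ^ w}) (one-plus-power w (fq U))) ⟩
        U ^ w - U ^ w * (1ℤ + P * (+ w * fq U))            ≡⟨ lem P (U ^ w) (+ w) (fq U) ⟩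
        P * (- (+ w * U ^ w) * fq U)                       ∎
      D≈0 : D ≈ 0ℤ
      D≈0 = ≈-trans (≈₂⇒≈ D≈₂) (multiple≈0 (- (+ w * U ^ w) * fq U))

-- The fourth moment of short sums over b, summed over all residues modulo p² and all classes.

module Moment where
  open ListSum
  open Congruence
  open PrimeField
  open Periodic
  open FermatQuotient
  open import Data.Integer hiding (suc)
  open import Data.Integer.Properties hiding (_≟_)
  open import Data.Integer.Tactic.RingSolver using (solve-∀)

  private
    ⟦⟧₄-mono : ∀ {P Q R S : Set} (d₁ : Dec P) (d₂ : Dec Q) (d₃ : Dec R) (d₄ : Dec S) {X Y} → (P → Q → R → S → X ≤ Y) →
               ⟦ d₁ ⟧ * ⟦ d₂ ⟧ * (⟦ d₃ ⟧ * ⟦ d₄ ⟧) * X ≤ ⟦ d₁ ⟧ * ⟦ d₂ ⟧ * (⟦ d₃ ⟧ * ⟦ d₄ ⟧) * Y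
    ⟦⟧₄-mono (yes a) (yes b) (yes c) (yes d) h = subst₂ _≤_ (sym (*-identityˡ _)) (sym (*-identityˡ _)) (h a b c d)
    ⟦⟧₄-mono (yes _) (yes _) (yes _) (no _)  h = ≤-refl
    ⟦⟧₄-mono (yes _) (yes _) (no _)  _       h = ≤-refl
    ⟦⟧₄-mono (yes _) (no _)  _       _       h = ≤-refl
    ⟦⟧₄-mono (no _)  _       _       _       h = ≤-refl

    ⟦⟧₄≤⟦⟧ : ∀ {P Q R S : Set} (d₁ : Dec P) (d₂ : Dec Q) (d₃ : Dec R) (d₄ : Dec S) →
              ⟦ d₁ ⟧ * ⟦ d₂ ⟧ * (⟦ d₃ ⟧ * ⟦ d₄ ⟧) ≤ ⟦ d₁ ⟧
    ⟦⟧₄≤⟦⟧ (yes _) (yes _) (yes _) d₄      = ≤-trans (≤-reflexive (trans (*-identityˡ _) (*-identityˡ _))) (⟦⟧≤1 d₄)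
    ⟦⟧₄≤⟦⟧ (yes _) (yes _) (no _)  _       = +≤+ ℕ.z≤n
    ⟦⟧₄≤⟦⟧ (yes _) (no _)  _       _       = +≤+ ℕ.z≤n
    ⟦⟧₄≤⟦⟧ (no _)  _       _       _       = ≤-refl

  module Burgess {p : ℕ} (pr : Prime p) (p≢2 : p ≢ 2) (w : ℕ) {α : ℤ} (α≉0 : ¬ Mod._≈_ p α 0ℤ)
                 {B : ℕ} (B≤p : B ℕ.≤ p) where
    open Mod p
    open PrimeMod pr
    open Period pr
    open Quotient pr
    private
      P = + p

    bs : List ℕ
    bs = upTo B

    ι : ℤ → ℤ → ℕ → ℤ
    ι x h b = ⟦ (x + + b) ^ w ≈? h ⟧

    t : ℤ → ℕ → ℤ
    t x b = α * fq (x + + b)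

    private
      Pair = ℕ × ℕ
      bb : List Pair
      bb = cartesianProduct bs bs

      weight : ℤ → ℤ → Pair → Pair → ℤ
      weight x h (b₁ , b₂) (b₃ , b₄) = ι x h b₁ * ι x h b₂ * (ι x h b₃ * ι x h b₄)

      phase : ℤ → Pair → Pair → ℤ
      phase x (b₁ , b₂) (b₃ , b₄) = t x b₂ - t x b₁ - (t x b₄ - t x b₃)

      S S′ Q Q′ : Pair → Pair → ℤ
      S  (b₁ , b₂) (b₃ , b₄) = + b₂ + + b₃
      S′ (b₁ , b₂) (b₃ , b₄) = + b₁ + + b₄
      Q  (b₁ , b₂) (b₃ , b₄) = + b₂ * + b₃
      Q′ (b₁ , b₂) (b₃ , b₄) = + b₁ * + b₄

      -- The numerator of 1/(y+b₂) + 1/(y+b₃) − 1/(y+b₁) − 1/(y+b₄), as a polynomial in y.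
      numerator : Pair → Pair → Poly 2
      numerator q q′ = (S q q′ * Q′ q q′ - S′ q q′ * Q q q′) ∷ ((+ 2 * (Q′ q q′ - Q q q′)) ∷ const (S′ q q′ - S q q′))

      κ : ℤ → Pair → Pair → ℤ
      κ y q q′ = ⟦ eval (numerator q q′) y ≈? 0ℤ ⟧

      -- Counts the matchings of b₁, b₄ with b₂, b₃; it takes the value 2 when all four agree, which
      -- is harmless in an upper bound.
      degenerate : Pair → Pair → ℤ
      degenerate (b₁ , b₂) (b₃ , b₄) = ⟦ b₁ ℕ.≟ b₂ ⟧ * ⟦ b₃ ℕ.≟ b₄ ⟧ + ⟦ b₁ ℕ.≟ b₃ ⟧ * ⟦ b₂ ℕ.≟ b₄ ⟧

      2≉0 : ¬ + 2 ≈ 0ℤ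
      2≉0 d = p≢2 (ℕ.≤-antisym (ℕ.∣⇒≤ (≈0⇒∣ d)) (ℕ.nonTrivial⇒n>1 p {{prime⇒nonTrivial pr}}))

      bb-bounds : ∀ {b b′} → (b , b′) ∈ bb → b ℕ.< p × b′ ℕ.< p
      bb-bounds q∈ = let (b∈ , b′∈) = ∈-cartesianProduct⁻ bs bs q∈ in
        ℕ.<-≤-trans (∈-upTo⁻ b∈) B≤p , ℕ.<-≤-trans (∈-upTo⁻ b′∈) B≤p

      -- Equal sums and products mean that the monic quadratics with roots b₁, b₄ and b₂, b₃
      -- coincide modulo p, so b₁ is a root of the second one.
      nondegenerate : ∀ {b₁ b₂ b₃ b₄} → b₁ ℕ.< p → b₂ ℕ.< p → b₃ ℕ.< p → b₄ ℕ.< p →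
        + b₁ + + b₄ ≈ + b₂ + + b₃ → + b₁ * + b₄ ≈ + b₂ * + b₃ → (b₁ ≡ b₂ × b₃ ≡ b₄) ⊎ (b₁ ≡ b₃ × b₂ ≡ b₄)
      nondegenerate {b₁} {b₂} {b₃} {b₄} l₁ l₂ l₃ l₄ s m = [ first , second ]′
        (zero-product (+ b₁ - + b₂) (+ b₁ - + b₃) (begin
          (+ b₁ - + b₂) * (+ b₁ - + b₃)                                   ≡⟨ lem₁ (+ b₁) (+ b₂) (+ b₃) ⟩
          + b₁ * + b₁ - (+ b₂ + + b₃) * + b₁ + + b₂ * + b₃                ≈⟨ +-cong (sub-cong (≈-refl {+ b₁ * + b₁}) (*-cong s (≈-refl {+ b₁}))) m ⟨
          + b₁ * + b₁ - (+ b₁ + + b₄) * + b₁ + + b₁ * + b₄                ≡⟨ lem₂ (+ b₁) (+ b₄) ⟩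
          0ℤ                                                              ∎))
        where
        open SetoidReasoning ≈-setoid
        lem₁ : ∀ a b c → (a - b) * (a - c) ≡ a * a - (b + c) * a + b * c
        lem₁ = solve-∀
        lem₂ : ∀ a d → a * a - (a + d) * a + a * d ≡ 0ℤ
        lem₂ = solve-∀
        lem₃ : ∀ a d b c → c - d ≡ b + c - (a + d) + (a - b)
        lem₃ = solve-∀
        lem₄ : ∀ a d b c → b - d ≡ b + c - (a + d) + (a - c)
        lem₄ = solve-∀
        diff≈0 : + b₂ + + b₃ - (+ b₁ + + b₄) ≈ 0ℤ
        diff≈0 = x-y≈0 (≈-sym s)
        first : + b₁ - + b₂ ≈ 0ℤ → (b₁ ≡ b₂ × b₃ ≡ b₄) ⊎ (b₁ ≡ b₃ × b₂ ≡ b₄)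
        first d = inj₁ (residue-unique l₁ l₂ (x-y≈0⇒ d) , residue-unique l₃ l₄ (x-y≈0⇒
          (≈-trans (≡⇒≈ (lem₃ (+ b₁) (+ b₄) (+ b₂) (+ b₃))) (+-cong diff≈0 d))))
        second : + b₁ - + b₃ ≈ 0ℤ → (b₁ ≡ b₂ × b₃ ≡ b₄) ⊎ (b₁ ≡ b₃ × b₂ ≡ b₄)
        second d = inj₂ (residue-unique l₁ l₃ (x-y≈0⇒ d) , residue-unique l₂ l₄ (x-y≈0⇒
          (≈-trans (≡⇒≈ (lem₄ (+ b₁) (+ b₄) (+ b₂) (+ b₃))) (+-cong diff≈0 d))))

      degenerate≥1 : ∀ {b₁ b₂ b₃ b₄} → (b₁ ≡ b₂ × b₃ ≡ b₄) ⊎ (b₁ ≡ b₃ × b₂ ≡ b₄) → 1ℤ ≤ degenerate (b₁ , b₂) (b₃ , b₄)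
      degenerate≥1 {b₁} {b₂} {b₃} {b₄} (inj₁ (e , f)) = subst (1ℤ ≤_)
        (cong (_+ ⟦ b₁ ℕ.≟ b₃ ⟧ * ⟦ b₂ ℕ.≟ b₄ ⟧) (sym (cong₂ _*_ (⟦⟧-yes (b₁ ℕ.≟ b₂) e) (⟦⟧-yes (b₃ ℕ.≟ b₄) f))))
        (≤-trans (≤-reflexive (sym (+-identityʳ 1ℤ))) (+-monoʳ-≤ 1ℤ (0≤⟦⟧*⟦⟧ (b₁ ℕ.≟ b₃) (b₂ ℕ.≟ b₄))))
      degenerate≥1 {b₁} {b₂} {b₃} {b₄} (inj₂ (e , f)) = subst (1ℤ ≤_)
        (cong (_+_ (⟦ b₁ ℕ.≟ b₂ ⟧ * ⟦ b₃ ℕ.≟ b₄ ⟧)) (sym (cong₂ _*_ (⟦⟧-yes (b₁ ℕ.≟ b₃) e) (⟦⟧-yes (b₂ ℕ.≟ b₄) f))))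
        (+-monoˡ-≤ 1ℤ (0≤⟦⟧*⟦⟧ (b₁ ℕ.≟ b₂) (b₃ ℕ.≟ b₄)))

      0≤degenerate : ∀ q q′ → 0ℤ ≤ degenerate q q′
      0≤degenerate (b₁ , b₂) (b₃ , b₄) = +-mono-≤ (0≤⟦⟧*⟦⟧ (b₁ ℕ.≟ b₂) (b₃ ℕ.≟ b₄)) (0≤⟦⟧*⟦⟧ (b₁ ℕ.≟ b₃) (b₂ ℕ.≟ b₄))

      roots : Pair → Pair → List ℕ
      roots q q′ = filter (λ y → eval (numerator q q′) (+ y) ≈? 0ℤ) (upTo p)

      roots-bounded : ∀ q q′ → All (ℕ._< p) (roots q q′)
      roots-bounded q q′ = All.tabulate λ y∈ →
        ∈-upTo⁻ (proj₁ (∈-filter⁻ (λ y → eval (numerator q q′) (+ y) ≈? 0ℤ) {xs = upTo p} y∈))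

      roots-root : ∀ q q′ → All (λ y → eval (numerator q q′) (+ y) ≈ 0ℤ) (roots q q′)
      roots-root q q′ = All.tabulate λ y∈ →
        proj₂ (∈-filter⁻ (λ y → eval (numerator q q′) (+ y) ≈? 0ℤ) {xs = upTo p} y∈)

      roots-unique = λ q q′ → Unique.filter⁺ (λ y → eval (numerator q q′) (+ y) ≈? 0ℤ) (Unique.upTo⁺ p)

      -- Different sums make the numerator quadratic. Equal sums but different products make it
      -- linear with leading coefficient 2(Q′ - Q), nonzero since p is odd. If both agree, the
      -- quadruple is degenerate and all p residues are paid for.
      count-κ : ∀ q q′ → q ∈ bb → q′ ∈ bb → ∑[ y ∈ upTo p ] κ (+ y) q q′ ≤ + 2 + P * degenerate q q′
      count-κ q@(b₁ , b₂) q′@(b₃ , b₄) q∈ q′∈ =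
        ≤-trans (≤-reflexive (∑-⟦⟧ (λ y → eval (numerator q q′) (+ y) ≈? 0ℤ) (upTo p)))
          (quadratic (S′ q q′ - S q q′ ≈? 0ℤ))
        where
        open ≤-Reasoning
        0≤Pd : 0ℤ ≤ P * degenerate q q′
        0≤Pd = 0≤* {P} (+≤+ ℕ.z≤n) (0≤degenerate q q′)
        few : length (roots q q′) ℕ.≤ 2 → + length (roots q q′) ≤ + 2 + P * degenerate q q′
        few le = begin
          + length (roots q q′)        ≤⟨ +≤+ le ⟩
          + 2                          ≡⟨ +-identityʳ (+ 2) ⟨
          + 2 + 0ℤ                     ≤⟨ +-monoʳ-≤ (+ 2) 0≤Pd ⟩
          + 2 + P * degenerate q q′    ∎
        many : 1ℤ ≤ degenerate q q′ → + length (roots q q′) ≤ + 2 + P * degenerate q q′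
        many 1≤d = begin
          + length (roots q q′)        ≤⟨ +≤+ (ℕ.≤-trans (length-filter (λ y → eval (numerator q q′) (+ y) ≈? 0ℤ) (upTo p)) (ℕ.≤-reflexive (length-upTo p))) ⟩
          P                            ≡⟨ *-identityʳ P ⟨
          P * 1ℤ                       ≤⟨ *-monoˡ-≤-nonNeg P 1≤d ⟩
          P * degenerate q q′          ≤⟨ i≤j+i (P * degenerate q q′) (+ 2) ⟩
          + 2 + P * degenerate q q′    ∎
        linear : S′ q q′ - S q q′ ≈ 0ℤ → Dec (Q′ q q′ - Q q q′ ≈ 0ℤ) → + length (roots q q′) ≤ + 2 + P * degenerate q q′
        linear s (yes m) = let (l₁ , l₂) = bb-bounds q∈ ; (l₃ , l₄) = bb-bounds q′∈ in
          many (degenerate≥1 {b₁} {b₂} {b₃} {b₄} (nondegenerate l₁ l₂ l₃ l₄ (x-y≈0⇒ s) (x-y≈0⇒ m)))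
        linear s (no m)  = few (ℕ.≤-trans (roots-bound pr line (*-≉0 2≉0 m) (roots-unique q q′) (roots-bounded q q′)
                              (All.map (λ {y} e → ≈-trans (on-line y) e) (roots-root q q′))) (ℕ.n≤1+n 1))
          where
          c₀ = S q q′ * Q′ q q′ - S′ q q′ * Q q q′
          c₁ = + 2 * (Q′ q q′ - Q q q′)
          line : Poly 1
          line = c₀ ∷ const c₁
          lem : ∀ c₀ c₁ y → c₀ + y * c₁ ≡ c₀ + y * (c₁ + y * 0ℤ)
          lem = solve-∀
          on-line : ∀ y → eval line (+ y) ≈ eval (numerator q q′) (+ y)
          on-line y = ≈-trans (≡⇒≈ (lem c₀ c₁ (+ y)))
            (+-cong (≈-refl {c₀}) (*-cong (≈-refl {+ y}) (+-cong (≈-refl {c₁}) (*-cong (≈-refl {+ y}) (≈-sym s)))))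
        quadratic : Dec (S′ q q′ - S q q′ ≈ 0ℤ) → + length (roots q q′) ≤ + 2 + P * degenerate q q′
        quadratic (yes s) = linear s (Q′ q q′ - Q q q′ ≈? 0ℤ)
        quadratic (no s)  = few (roots-bound pr (numerator q q′) s (roots-unique q q′) (roots-bounded q q′) (roots-root q q′))

      ∑-≟ : ∀ {b} → b ∈ bs → ∑[ b′ ∈ bs ] ⟦ b ℕ.≟ b′ ⟧ ≡ 1ℤ
      ∑-≟ {b} b∈ = trans (∑-single (λ b′ → ⟦ b ℕ.≟ b′ ⟧) (Unique.upTo⁺ B) b∈ (λ b′ _ b′≢b → ⟦⟧-no (b ℕ.≟ b′) λ e → b′≢b (sym e)))
                         (⟦⟧-yes (b ℕ.≟ b) refl)

      bB : + length bs ≡ + B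
      bB = cong +_ (length-upTo B)

      ∑-1 : ∑[ b ∈ bs ] 1ℤ ≡ + B
      ∑-1 = trans (∑-const bs 1ℤ) (trans (*-identityʳ (+ length bs)) bB)

      ∑∑-diagonal : ∑[ b ∈ bs ] ∑[ b′ ∈ bs ] ⟦ b ℕ.≟ b′ ⟧ ≡ + B
      ∑∑-diagonal = trans (∑-cong-∈ bs λ b b∈ → ∑-≟ b∈) ∑-1

      count-degenerate : ∑[ q ∈ bb ] ∑[ q′ ∈ bb ] degenerate q q′ ≡ + 2 * (+ B * + B)
      count-degenerate = begin
        ∑[ q ∈ bb ] ∑[ q′ ∈ bb ] degenerate q q′
          ≡⟨ ∑-cong bb (λ q → ∑-distrib-+ bb (λ q′ → D₁ q * D₁ q′) (λ q′ → D₂ q q′)) ⟩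
        ∑[ q ∈ bb ] ((∑[ q′ ∈ bb ] D₁ q * D₁ q′) + (∑[ q′ ∈ bb ] D₂ q q′))
          ≡⟨ ∑-distrib-+ bb (λ q → ∑[ q′ ∈ bb ] D₁ q * D₁ q′) (λ q → ∑[ q′ ∈ bb ] D₂ q q′) ⟩
        (∑[ q ∈ bb ] ∑[ q′ ∈ bb ] D₁ q * D₁ q′) + (∑[ q ∈ bb ] ∑[ q′ ∈ bb ] D₂ q q′)
          ≡⟨ cong₂ _+_ part₁ part₂ ⟩
        + B * + B + + B * + B
          ≡⟨ double (+ B * + B) ⟩
        + 2 * (+ B * + B) ∎
        where
        open ≡-Reasoning
        D₁ : Pair → ℤ
        D₁ (b , b′) = ⟦ b ℕ.≟ b′ ⟧
        D₂ : Pair → Pair → ℤ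
        D₂ (b₁ , b₂) (b₃ , b₄) = ⟦ b₁ ℕ.≟ b₃ ⟧ * ⟦ b₂ ℕ.≟ b₄ ⟧
        part₁ : ∑[ q ∈ bb ] ∑[ q′ ∈ bb ] D₁ q * D₁ q′ ≡ + B * + B
        part₁ = trans (sym (∑-* bb bb D₁ D₁)) (cong₂ _*_ diag diag)
          where
          diag : ∑ bb D₁ ≡ + B
          diag = trans (∑-cartesianProduct bs bs D₁) ∑∑-diagonal
        inner : ∀ q → q ∈ bb → ∑[ q′ ∈ bb ] D₂ q q′ ≡ 1ℤ
        inner (b₁ , b₂) q∈ = let (b₁∈ , b₂∈) = ∈-cartesianProduct⁻ bs bs q∈ in
          trans (∑-cartesianProduct bs bs (D₂ (b₁ , b₂)))
            (trans (sym (∑-* bs bs (λ b → ⟦ b₁ ℕ.≟ b ⟧) (λ b → ⟦ b₂ ℕ.≟ b ⟧))) (cong₂ _*_ (∑-≟ b₁∈) (∑-≟ b₂∈)))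
        part₂ : ∑[ q ∈ bb ] ∑[ q′ ∈ bb ] D₂ q q′ ≡ + B * + B
        part₂ = trans (∑-cong-∈ bb inner) (trans (∑-cartesianProduct bs bs (λ _ → 1ℤ))
          (trans (∑-cong bs λ _ → ∑-1) (trans (∑-const bs (+ B)) (cong (_* + B) bB))))

      count-all : ∑[ q ∈ bb ] ∑[ q′ ∈ bb ] + 2 ≡ + 2 * (+ B * + B * (+ B * + B))
      count-all = trans (∑-cong bb λ _ → ∑-const bb (+ 2)) (trans (∑-const bb (+ length bb * + 2))
        (trans (lem (+ length bb)) (cong (λ l → + 2 * (l * l)) len)))
        where
        lem : ∀ l → l * (l * + 2) ≡ + 2 * (l * l)
        lem = solve-∀
        len : + length bb ≡ + B * + B
        len = trans (sym (trans (∑-const bb 1ℤ) (*-identityʳ (+ length bb)))) (trans (∑-cartesianProduct bs bs (λ _ → 1ℤ))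
          (trans (∑-cong bs λ _ → ∑-1) (trans (∑-const bs (+ B)) (cong (_* + B) bB))))

    -- Two roots y of the numerator for each of the B⁴ quadruples, all p residues y for each of the 2B² degenerate ones.
    stationary : ℤ
    stationary = + 2 * (+ B * + B * (+ B * + B)) + P * (+ 2 * (+ B * + B))

    private
      count-stationary : ∑[ q ∈ bb ] ∑[ q′ ∈ bb ] ∑[ y ∈ upTo p ] κ (+ y) q q′ ≤ stationary
      count-stationary = begin
        ∑[ q ∈ bb ] ∑[ q′ ∈ bb ] ∑[ y ∈ upTo p ] κ (+ y) q q′
          ≤⟨ ∑-mono bb (λ q q∈ → ∑-mono bb λ q′ q′∈ → count-κ q q′ q∈ q′∈) ⟩
        ∑[ q ∈ bb ] ∑[ q′ ∈ bb ] (+ 2 + P * degenerate q q′)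
          ≡⟨ ∑-cong bb (λ q → ∑-distrib-+ bb (λ _ → + 2) (λ q′ → P * degenerate q q′)) ⟩
        ∑[ q ∈ bb ] ((∑[ q′ ∈ bb ] + 2) + (∑[ q′ ∈ bb ] P * degenerate q q′))
          ≡⟨ ∑-distrib-+ bb (λ _ → ∑[ q′ ∈ bb ] + 2) (λ q → ∑[ q′ ∈ bb ] P * degenerate q q′) ⟩
        (∑[ q ∈ bb ] ∑[ q′ ∈ bb ] + 2) + (∑[ q ∈ bb ] ∑[ q′ ∈ bb ] P * degenerate q q′)
          ≡⟨ cong₂ _+_ count-all (trans (∑-cong bb λ q → ∑-*ˡ P bb (degenerate q)) (trans (∑-*ˡ P bb (λ q → ∑ bb (degenerate q))) (cong (P *_) count-degenerate))) ⟩
        stationary ∎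
        where open ≤-Reasoning

    module _ {g : ℤ → ℤ} (per : Periodic g) (mean0 : ∑ₚ g ≡ 0ℤ) where
      open Correlation per

      Φ : ℤ → ℤ → ℤ
      Φ x h = fourthMoment bs (ι x h) (t x)

      private
        0≤PN : 0ℤ ≤ P * norm g
        0≤PN = 0≤* {P} (+≤+ ℕ.z≤n) (0≤norm g)

        -- Up to the factor α, the rate at which the phase grows along the fibre y + pz, each f(y +
        -- b) changing by -z/(y + b).
        slope : ℤ → Pair → Pair → ℤ
        slope y (b₁ , b₂) (b₃ , b₄) = inv (y + + b₁) + inv (y + + b₄) - (inv (y + + b₂) + inv (y + + b₃))

        phase-shift : ∀ (y z : ℤ) (q q′ : Pair) → let (b₁ , b₂) = q ; (b₃ , b₄) = q′ in
          ¬ y + + b₁ ≈ 0ℤ → ¬ y + + b₂ ≈ 0ℤ → ¬ y + + b₃ ≈ 0ℤ → ¬ y + + b₄ ≈ 0ℤ →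
          phase (y + P * z) q q′ ≈ phase y q q′ + z * (α * slope y q q′)
        phase-shift y z (b₁ , b₂) (b₃ , b₄) u₁ u₂ u₃ u₄ = ≈-trans
          (sub-cong (sub-cong (move b₂ u₂) (move b₁ u₁)) (sub-cong (move b₄ u₄) (move b₃ u₃)))
          (≡⇒≈ (lem α z (fq (y + + b₁)) (fq (y + + b₂)) (fq (y + + b₃)) (fq (y + + b₄))
                        (inv (y + + b₁)) (inv (y + + b₂)) (inv (y + + b₃)) (inv (y + + b₄))))
          where
          comm : ∀ y z b P → y + P * z + b ≡ y + b + P * z
          comm = solve-∀
          move : ∀ b → ¬ y + + b ≈ 0ℤ → t (y + P * z) b ≈ α * (fq (y + + b) - z * inv (y + + b))
          move b u = *-cong (≈-refl {α}) (≈-trans (≡⇒≈ (cong fq (comm y z (+ b) P))) (fq-shift z u))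
          lem : ∀ α z f₁ f₂ f₃ f₄ i₁ i₂ i₃ i₄ →
            α * (f₂ - z * i₂) - α * (f₁ - z * i₁) - (α * (f₄ - z * i₄) - α * (f₃ - z * i₃))
            ≡ α * f₂ - α * f₁ - (α * f₄ - α * f₃) + z * (α * (i₁ + i₄ - (i₂ + i₃)))
          lem = solve-∀

        -- Multiplication by -(y+b₁)(y+b₂)(y+b₃)(y+b₄) clears the inverses.
        slope-root : ∀ (y : ℤ) (q q′ : Pair) → let (b₁ , b₂) = q ; (b₃ , b₄) = q′ in
          ¬ y + + b₁ ≈ 0ℤ → ¬ y + + b₂ ≈ 0ℤ → ¬ y + + b₃ ≈ 0ℤ → ¬ y + + b₄ ≈ 0ℤ →
          slope y q q′ ≈ 0ℤ → eval (numerator q q′) y ≈ 0ℤ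
        slope-root y q@(b₁ , b₂) q′@(b₃ , b₄) u₁ u₂ u₃ u₄ s = begin
          eval (numerator q q′) y
            ≡⟨ lem₁ y (+ b₁) (+ b₂) (+ b₃) (+ b₄) ⟩
          1ℤ * (m₂ * m₃ * m₄) * -1ℤ + 1ℤ * (m₁ * m₂ * m₃) * -1ℤ + (1ℤ * (m₁ * m₃ * m₄) + 1ℤ * (m₁ * m₂ * m₄))
            ≈⟨ +-cong (+-cong (negate (factor u₁ (m₂ * m₃ * m₄))) (negate (factor u₄ (m₁ * m₂ * m₃))))
                      (+-cong (factor u₂ (m₁ * m₃ * m₄)) (factor u₃ (m₁ * m₂ * m₄))) ⟨
          m₁ * inv m₁ * (m₂ * m₃ * m₄) * -1ℤ + m₄ * inv m₄ * (m₁ * m₂ * m₃) * -1ℤ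
            + (m₂ * inv m₂ * (m₁ * m₃ * m₄) + m₃ * inv m₃ * (m₁ * m₂ * m₄))
            ≡⟨ lem₂ m₁ m₂ m₃ m₄ (inv m₁) (inv m₂) (inv m₃) (inv m₄) ⟩
          - (m₁ * m₂ * m₃ * m₄) * slope y q q′
            ≈⟨ *-cong (≈-refl { - (m₁ * m₂ * m₃ * m₄)}) s ⟩
          - (m₁ * m₂ * m₃ * m₄) * 0ℤ
            ≡⟨ *-zeroʳ (- (m₁ * m₂ * m₃ * m₄)) ⟩
          0ℤ ∎
          where
          open SetoidReasoning ≈-setoid
          m₁ = y + + b₁
          m₂ = y + + b₂
          m₃ = y + + b₃
          m₄ = y + + b₄
          factor : ∀ {m} → ¬ m ≈ 0ℤ → ∀ k → m * inv m * k ≈ 1ℤ * k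
          factor u k = *-cong (inv-spec u) (≈-refl {k})
          negate : ∀ {a b} → a ≈ b → a * -1ℤ ≈ b * -1ℤ
          negate e = *-cong e (≈-refl { -1ℤ})
          lem₁ : ∀ y b₁ b₂ b₃ b₄ →
            (b₂ + b₃) * (b₁ * b₄) - (b₁ + b₄) * (b₂ * b₃) + y * (+ 2 * (b₁ * b₄ - b₂ * b₃) + y * (b₁ + b₄ - (b₂ + b₃)))
            ≡ 1ℤ * ((y + b₂) * (y + b₃) * (y + b₄)) * -1ℤ + 1ℤ * ((y + b₁) * (y + b₂) * (y + b₃)) * -1ℤ
              + (1ℤ * ((y + b₁) * (y + b₃) * (y + b₄)) + 1ℤ * ((y + b₁) * (y + b₂) * (y + b₄)))
          lem₁ = solve-∀
          lem₂ : ∀ m₁ m₂ m₃ m₄ i₁ i₂ i₃ i₄ →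
            m₁ * i₁ * (m₂ * m₃ * m₄) * -1ℤ + m₄ * i₄ * (m₁ * m₂ * m₃) * -1ℤ
              + (m₂ * i₂ * (m₁ * m₃ * m₄) + m₃ * i₃ * (m₁ * m₂ * m₄))
            ≡ - (m₁ * m₂ * m₃ * m₄) * (i₁ + i₄ - (i₂ + i₃))
          lem₂ = solve-∀

        -- If the slope is invertible, the phase runs through all residues with z, and ρ has mean
        -- zero. Otherwise each of the p terms is at most the norm of g, and y is a root of the
        -- numerator.
        ∑-phase : ∀ (y : ℤ) (q q′ : Pair) → let (b₁ , b₂) = q ; (b₃ , b₄) = q′ in
          ¬ y + + b₁ ≈ 0ℤ → ¬ y + + b₂ ≈ 0ℤ → ¬ y + + b₃ ≈ 0ℤ → ¬ y + + b₄ ≈ 0ℤ →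
          ∑ₚ (λ z → ρ g (phase (y + P * z) q q′)) ≤ κ y q q′ * (P * norm g)
        ∑-phase y q q′ u₁ u₂ u₃ u₄ = ≤-trans
          (≤-reflexive (∑-cong (upTo p) λ z → ρ-periodic (phase-shift y (+ z) q q′ u₁ u₂ u₃ u₄)))
          (split (slope y q q′ ≈? 0ℤ))
          where
          open ≤-Reasoning
          c = α * slope y q q′
          split : Dec (slope y q q′ ≈ 0ℤ) → ∑ₚ (λ z → ρ g (phase y q q′ + z * c)) ≤ κ y q q′ * (P * norm g)
          split (yes s) = begin
            ∑ₚ (λ z → ρ g (phase y q q′ + z * c))    ≤⟨ ∑-mono (upTo p) (λ z _ → ρ≤norm (phase y q q′ + + z * c)) ⟩
            ∑[ z ∈ upTo p ] norm g                   ≡⟨ ∑-const (upTo p) (norm g) ⟩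
            + length (upTo p) * norm g               ≡⟨ cong (λ l → + l * norm g) (length-upTo p) ⟩
            P * norm g                               ≡⟨ *-identityˡ (P * norm g) ⟨
            1ℤ * (P * norm g)                        ≡⟨ cong (_* (P * norm g)) (⟦⟧-yes (eval (numerator q q′) y ≈? 0ℤ) (slope-root y q q′ u₁ u₂ u₃ u₄ s)) ⟨
            κ y q q′ * (P * norm g)                  ∎
          split (no s) = begin
            ∑ₚ (λ z → ρ g (phase y q q′ + z * c))    ≡⟨ ∑ρ-affine≡0 mean0 (phase y q q′) c (*-≉0 α≉0 s) ⟩
            0ℤ                                       ≤⟨ 0≤* (0≤⟦⟧ (eval (numerator q q′) y ≈? 0ℤ)) 0≤PN ⟩
            κ y q q′ * (P * norm g)                  ∎

        -- The class condition sees only residues modulo p, so the weights stay constant on the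
        -- fibre along which the phase varies.
        ι-shift : ∀ y z h b → ι (y + P * z) h b ≡ ι y h b
        ι-shift y z h b = ⟦⟧-cong ((y + P * z + + b) ^ w ≈? h) ((y + + b) ^ w ≈? h)
          (λ d → ≈-trans (^-cong w (≈-sym same)) d) (λ d → ≈-trans (^-cong w same) d)
          where
          same : y + P * z + + b ≈ y + + b
          same = +-cong (add-multiple y z) (≈-refl {+ b})

      -- y + pz runs through the residues modulo p², and suc i through the nonzero classes. The
      -- classes are included because the one relevant to a pair (a, v), namely h/a^w, changes with
      -- a.
      cells : List (ℕ × (ℕ × ℕ))
      cells = cartesianProduct (upTo p) (cartesianProduct (upTo (ℕ.pred p)) (upTo p))

      cell-Φ : ℕ × (ℕ × ℕ) → ℤ
      cell-Φ (y , (i , z)) = Φ (+ y + P * + z) (+ suc i)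

      private
        p≢0 = prime⇒nonZero pr

        suc<p : ∀ {i} → i ∈ upTo (ℕ.pred p) → suc i ℕ.< p
        suc<p i∈ = ℕ.≤-trans (ℕ.s≤s (∈-upTo⁻ i∈)) (ℕ.≤-reflexive (ℕ.suc-pred p {{p≢0}}))

        term : Pair → Pair → ℕ × (ℕ × ℕ) → ℤ
        term q q′ (y , (i , z)) = weight (+ y) (+ suc i) q q′ * ρ g (phase (+ y + P * + z) q q′)

        -- The first indicator alone determines the class, so summing over all classes is free of
        -- charge.
        ∑-weight≤1 : ∀ y q q′ → ∑[ i ∈ upTo (ℕ.pred p) ] weight y (+ suc i) q q′ ≤ 1ℤ
        ∑-weight≤1 y q@(b₁ , b₂) q′@(b₃ , b₄) = begin
          ∑[ i ∈ upTo (ℕ.pred p) ] weight y (+ suc i) q q′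
            ≤⟨ ∑-mono (upTo (ℕ.pred p)) (λ i _ → ⟦⟧₄≤⟦⟧ ((y + + b₁) ^ w ≈? + suc i) ((y + + b₂) ^ w ≈? + suc i)
                 ((y + + b₃) ^ w ≈? + suc i) ((y + + b₄) ^ w ≈? + suc i)) ⟩
          ∑[ i ∈ upTo (ℕ.pred p) ] ⟦ X ≈? + suc i ⟧
            ≤⟨ ∑-injection suc (Unique.upTo⁺ (ℕ.pred p)) (λ _ _ → ℕ.suc-injective) (λ i∈ → ∈-upTo⁺ (suc<p i∈))
                 (λ i → ⟦ X ≈? + i ⟧) (λ i → 0≤⟦⟧ (X ≈? + i)) ⟩
          ∑[ i ∈ upTo p ] ⟦ X ≈? + i ⟧
            ≡⟨ ∑-cong (upTo p) (λ i → trans (⟦⟧-cong (X ≈? + i) (+ i ≈? X) ≈-sym ≈-sym) (sym (*-identityʳ _))) ⟩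
          ∑[ i ∈ upTo p ] ⟦ + i ≈? X ⟧ * 1ℤ
            ≡⟨ ∑ₚ-pick {λ _ → 1ℤ} (λ _ → refl) X ⟩
          1ℤ ∎
          where
          open ≤-Reasoning
          X = (y + + b₁) ^ w

        module _ (0<w : 0 ℕ.< w) where

          -- A nonzero weight puts all four y + b into a nonzero class; they are then invertible, as
          -- `∑-phase` demands.
          ∑-term : ∀ q q′ → ∑[ τ ∈ cells ] term q q′ τ ≤ ∑[ y ∈ upTo p ] κ (+ y) q q′ * (P * norm g)
          ∑-term q@(b₁ , b₂) q′@(b₃ , b₄) = begin
            ∑[ τ ∈ cells ] term q q′ τ
              ≡⟨ ∑-cartesianProduct (upTo p) (cartesianProduct (upTo (ℕ.pred p)) (upTo p)) (term q q′) ⟩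
            ∑[ y ∈ upTo p ] ∑[ r ∈ cartesianProduct (upTo (ℕ.pred p)) (upTo p) ] term q q′ (y , r)
              ≡⟨ ∑-cong (upTo p) (λ y → ∑-cartesianProduct (upTo (ℕ.pred p)) (upTo p) (λ r → term q q′ (y , r))) ⟩
            ∑[ y ∈ upTo p ] ∑[ i ∈ upTo (ℕ.pred p) ] ∑[ z ∈ upTo p ] term q q′ (y , (i , z))
              ≤⟨ ∑-mono (upTo p) (λ y _ → row (+ y)) ⟩
            ∑[ y ∈ upTo p ] κ (+ y) q q′ * (P * norm g) ∎
            where
            open ≤-Reasoning
            row : ∀ y → ∑[ i ∈ upTo (ℕ.pred p) ] ∑[ z ∈ upTo p ] (weight y (+ suc i) q q′ * ρ g (phase (y + P * + z) q q′))
                       ≤ κ y q q′ * (P * norm g)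
            row y = begin
              ∑[ i ∈ upTo (ℕ.pred p) ] ∑[ z ∈ upTo p ] (weight y (+ suc i) q q′ * ρ g (phase (y + P * + z) q q′))
                ≡⟨ ∑-cong (upTo (ℕ.pred p)) (λ i → ∑-*ˡ (weight y (+ suc i) q q′) (upTo p) (λ z → ρ g (phase (y + P * + z) q q′))) ⟩
              ∑[ i ∈ upTo (ℕ.pred p) ] (weight y (+ suc i) q q′ * ∑ₚ (λ z → ρ g (phase (y + P * z) q q′)))
                ≤⟨ ∑-mono (upTo (ℕ.pred p)) (λ i i∈ → let h≉0 = small≉0 (ℕ.s≤s ℕ.z≤n) (suc<p i∈) in
                     ⟦⟧₄-mono ((y + + b₁) ^ w ≈? + suc i) ((y + + b₂) ^ w ≈? + suc i) ((y + + b₃) ^ w ≈? + suc i) ((y + + b₄) ^ w ≈? + suc i)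
                       λ d₁ d₂ d₃ d₄ → ∑-phase y q q′ (unit-of h≉0 0<w d₁) (unit-of h≉0 0<w d₂) (unit-of h≉0 0<w d₃) (unit-of h≉0 0<w d₄)) ⟩
              ∑[ i ∈ upTo (ℕ.pred p) ] (weight y (+ suc i) q q′ * (κ y q q′ * (P * norm g)))
                ≡⟨ ∑-*ʳ (κ y q q′ * (P * norm g)) (upTo (ℕ.pred p)) (λ i → weight y (+ suc i) q q′) ⟩
              (∑[ i ∈ upTo (ℕ.pred p) ] weight y (+ suc i) q q′) * (κ y q q′ * (P * norm g))
                ≤⟨ *-monoʳ-≤-nonNeg (κ y q q′ * (P * norm g)) {{nonNegative 0≤κPN}} (∑-weight≤1 y q q′) ⟩
              1ℤ * (κ y q q′ * (P * norm g))
                ≡⟨ *-identityˡ (κ y q q′ * (P * norm g)) ⟩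
              κ y q q′ * (P * norm g) ∎
              where
              0≤κPN : 0ℤ ≤ κ y q q′ * (P * norm g)
              0≤κPN = 0≤* (0≤⟦⟧ (eval (numerator q q′) y ≈? 0ℤ)) 0≤PN

      moment-bound : 0 ℕ.< w → ∑ cells cell-Φ ≤ stationary * (P * norm g)
      moment-bound 0<w = begin
        ∑ cells cell-Φ
          ≡⟨ ∑-cong cells (λ τ → ∑-cong bb λ q → ∑-cong bb λ q′ → unshift τ q q′) ⟩
        ∑[ τ ∈ cells ] ∑[ q ∈ bb ] ∑[ q′ ∈ bb ] term q q′ τ
          ≡⟨ ∑-swap cells bb (λ τ q → ∑[ q′ ∈ bb ] term q q′ τ) ⟩
        ∑[ q ∈ bb ] ∑[ τ ∈ cells ] ∑[ q′ ∈ bb ] term q q′ τ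
          ≡⟨ ∑-cong bb (λ q → ∑-swap cells bb (λ τ q′ → term q q′ τ)) ⟩
        ∑[ q ∈ bb ] ∑[ q′ ∈ bb ] ∑[ τ ∈ cells ] term q q′ τ
          ≤⟨ ∑-mono bb (λ q _ → ∑-mono bb λ q′ _ → ∑-term 0<w q q′) ⟩
        ∑[ q ∈ bb ] ∑[ q′ ∈ bb ] ∑[ y ∈ upTo p ] κ (+ y) q q′ * (P * norm g)
          ≡⟨ ∑-cong bb (λ q → trans (∑-cong bb λ q′ → ∑-*ʳ (P * norm g) (upTo p) (λ y → κ (+ y) q q′))
                                (∑-*ʳ (P * norm g) bb (λ q′ → ∑[ y ∈ upTo p ] κ (+ y) q q′))) ⟩
        ∑[ q ∈ bb ] (∑[ q′ ∈ bb ] ∑[ y ∈ upTo p ] κ (+ y) q q′) * (P * norm g)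
          ≡⟨ ∑-*ʳ (P * norm g) bb (λ q → ∑[ q′ ∈ bb ] ∑[ y ∈ upTo p ] κ (+ y) q q′) ⟩
        (∑[ q ∈ bb ] ∑[ q′ ∈ bb ] ∑[ y ∈ upTo p ] κ (+ y) q q′) * (P * norm g)
          ≤⟨ *-monoʳ-≤-nonNeg (P * norm g) {{nonNegative 0≤PN}} count-stationary ⟩
        stationary * (P * norm g) ∎
        where
        open ≤-Reasoning
        unshift : ∀ τ q q′ → let (y , (i , z)) = τ in
          weight (+ y + P * + z) (+ suc i) q q′ * ρ g (phase (+ y + P * + z) q q′) ≡ term q q′ τ
        unshift (y , (i , z)) (b₁ , b₂) (b₃ , b₄) = cong (_* ρ g (phase (+ y + P * + z) (b₁ , b₂) (b₃ , b₄)))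
          (cong₂ _*_ (cong₂ _*_ (sh b₁) (sh b₂)) (cong₂ _*_ (sh b₃) (sh b₄)))
          where
          sh : ∀ b → ι (+ y + P * + z) (+ suc i) b ≡ ι (+ y) (+ suc i) b
          sh = ι-shift (+ y) (+ z) (+ suc i)

-- The averaging operator over members v + ab in one class, and its norm.

module Operator where
  open ListSum
  open Congruence
  open Periodic
  open FermatQuotient
  open Moment
  open import Data.Integer hiding (suc)
  open import Data.Integer.Properties hiding (_≟_)
  open import Data.Integer.DivMod using (_%ℕ_; n%ℕd<d)
  open import Data.Integer.Tactic.RingSolver using (solve-∀)

  private
    ⟦⟧*-cong : ∀ {P Q : Set} (d : Dec P) (e : Dec Q) {X Y} → (P → Q) → (Q → P) → (P → X ≡ Y) → ⟦ d ⟧ * X ≡ ⟦ e ⟧ * Y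
    ⟦⟧*-cong (yes a) e f g h = cong₂ _*_ (sym (⟦⟧-yes e (f a))) (h a)
    ⟦⟧*-cong (no a)  e {X} {Y} f g h = trans (*-zeroˡ X) (sym (trans (cong (_* Y) (⟦⟧-no e λ b → a (g b))) (*-zeroˡ Y)))

  -- Hölder's inequality with exponents 4 and 4/3, obtained from two applications of Cauchy-Schwarz.
  ∑-fourth-power : ∀ {A : Set} (xs : List A) (X : A → ℤ) → let J = + length xs ; S = ∑ xs X in
    S * S * (S * S) ≤ J * J * J * (∑[ x ∈ xs ] X x * X x * (X x * X x))
  ∑-fourth-power xs X = begin
    S * S * (S * S)             ≤⟨ square-mono-≤ (0≤i*i S) (cauchy-schwarz-1 xs X) ⟩
    J * S₂ * (J * S₂)           ≡⟨ lem₁ J S₂ ⟩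
    J * J * (S₂ * S₂)           ≤⟨ *-monoˡ-≤-nonNeg (J * J) {{nonNegative (0≤i*i J)}} (cauchy-schwarz-1 xs (λ x → X x * X x)) ⟩
    J * J * (J * S₄)            ≡⟨ *-assoc (J * J) J S₄ ⟨
    J * J * J * S₄              ∎
    where
    open ≤-Reasoning
    J = + length xs
    S = ∑ xs X
    S₂ = ∑[ x ∈ xs ] X x * X x
    S₄ = ∑[ x ∈ xs ] X x * X x * (X x * X x)
    lem₁ : ∀ J S → J * S * (J * S) ≡ J * J * (S * S)
    lem₁ = solve-∀

  module Averaging {p : ℕ} (pr : Prime p) (p≢2 : p ≢ 2) {w : ℕ} (0<w : 0 ℕ.< w) {α : ℤ} (α≉0 : ¬ Mod._≈_ p α 0ℤ)
    {B : ℕ} (B≤p : B ℕ.≤ p) {h : ℤ} (h≉0 : ¬ Mod._≈_ p h 0ℤ)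
    (F : ℕ → ℤ) (F-spec : ∀ u → Mod._≈_ p ((+ u) ^ w) h → Mod._≈_ p (F u) (α * Quotient.fq pr (+ u)))
    (pairs : List (ℕ × ℕ)) (pairs-unique : Unique pairs)
    (pairs-ok : ∀ {a v} → (a , v) ∈ pairs → 0 ℕ.< a × a ℕ.< p × v ℕ.< p × Coprime a v) where

    open Mod p
    open PrimeMod pr
    open Period pr
    open Quotient pr
    open Burgess pr p≢2 w α≉0 B≤p
    private
      P = + p
      J = + length pairs
      instance
        p≢0 : ℕ.NonZero p
        p≢0 = prime⇒nonZero pr
        p²≢0 : ℕ.NonZero (p ℕ.* p)
        p²≢0 = ℕ.m*n≢0 p p

    member : ℕ × ℕ → ℕ → ℕ
    member (a , v) b = v ℕ.+ a ℕ.* b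

    inClass : ℕ → ℤ
    inClass u = ⟦ (+ u) ^ w ≈? h ⟧

    -- Convolution with the distribution of `F` over the members in the class h. Its k-th iterate
    -- therefore runs over sums of k such values.
    T : (ℤ → ℤ) → ℤ → ℤ
    T g c = ∑[ r ∈ pairs ] ∑[ b ∈ bs ] inClass (member r b) * g (c - F (member r b))

    T-periodic : ∀ {g} → Periodic g → Periodic (T g)
    T-periodic per d = ∑-cong pairs λ r → ∑-cong bs λ b →
      cong (inClass (member r b) *_) (per (sub-cong d (≈-refl {F (member r b)})))

    T-mean : ∀ {g} → Periodic g → ∑ₚ g ≡ 0ℤ → ∑ₚ (T g) ≡ 0ℤ
    T-mean {g} per mean0 = begin
      ∑ₚ (T g)
        ≡⟨ ∑-swap (upTo p) pairs (λ c r → ∑[ b ∈ bs ] inClass (member r b) * g (+ c - F (member r b))) ⟩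
      ∑[ r ∈ pairs ] ∑[ c ∈ upTo p ] ∑[ b ∈ bs ] inClass (member r b) * g (+ c - F (member r b))
        ≡⟨ ∑-cong pairs (λ r → trans (∑-swap (upTo p) bs (λ c b → inClass (member r b) * g (+ c - F (member r b))))
             (trans (∑-cong bs (inner r)) (∑-zero bs))) ⟩
      ∑[ r ∈ pairs ] 0ℤ
        ≡⟨ ∑-zero pairs ⟩
      0ℤ ∎
      where
      open ≡-Reasoning
      inner : ∀ r b → ∑ₚ (λ c → inClass (member r b) * g (c - F (member r b))) ≡ 0ℤ
      inner r b = trans (∑-*ˡ (inClass (member r b)) (upTo p) (λ c → g (+ c - F (member r b))))
        (trans (cong (inClass (member r b) *_) (trans (∑ₚ-translate per (- F (member r b))) mean0)) (*-zeroʳ (inClass (member r b))))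

    -- X ≡ v / a (mod p²), so that v + a b ≡ a (X + b); as a and v are coprime and small, X determines (a , v).
    private
      X : ℕ × ℕ → ℕ
      X (a , v) = (+ v * inv₂ (+ a)) %ℕ (p ℕ.* p)

      -- The class of X + b when a(X + b) has the class h.
      h′ : ℕ × ℕ → ℕ
      h′ (a , v) = (h * inv (+ a) ^ w) %ℕ p

      -- The two digits of X in base p, with the class index lowered by one as in `cells`.
      cell : ℕ × ℕ → ℕ × (ℕ × ℕ)
      cell r = X r ℕ.% p , (ℕ.pred (h′ r) , X r ℕ./ p)

      point : ℕ × ℕ → ℤ
      point r = + (X r ℕ.% p) + P * + (X r ℕ./ p)

      point≡ : ∀ r → point r ≡ + X r
      point≡ r = trans (cong (_+_ (+ (X r ℕ.% p))) (sym (pos-* p (X r ℕ./ p)))) (trans (sym (pos-+ (X r ℕ.% p) _))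
        (cong +_ (trans (cong (X r ℕ.% p ℕ.+_) (ℕ.*-comm p (X r ℕ./ p))) (sym (ℕ.m≡m%n+[m/n]*n (X r) p)))))

      module _ {a v : ℕ} (r∈ : (a , v) ∈ pairs) where
        private
          r = a , v

        a≉0 : ¬ + a ≈ 0ℤ
        a≉0 = let (0<a , a<p , _) = pairs-ok r∈ in small≉0 0<a a<p

        aX≈v : + a * + X r ≈₂ + v
        aX≈v = begin
          + a * + X r                  ≈⟨ *-cong₂ (≈₂-refl {+ a}) (≈₂-sym (Mod.≈-residue (p ℕ.* p) (+ v * inv₂ (+ a)))) ⟩
          + a * (+ v * inv₂ (+ a))     ≡⟨ lem (+ a) (+ v) (inv₂ (+ a)) ⟩
          + v * (+ a * inv₂ (+ a))     ≈⟨ *-cong₂ (≈₂-refl {+ v}) (inv₂-spec a≉0) ⟩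
          + v * 1ℤ                     ≡⟨ *-identityʳ (+ v) ⟩
          + v                          ∎
          where
          open SetoidReasoning ≈₂-setoid
          lem : ∀ a v i → a * (v * i) ≡ v * (a * i)
          lem = solve-∀

        member≈ : ∀ b → + member r b ≈₂ + a * (point r + + b)
        member≈ b = begin
          + (v ℕ.+ a ℕ.* b)                ≡⟨ trans (pos-+ v (a ℕ.* b)) (cong (_+_ (+ v)) (pos-* a b)) ⟩
          + v + + a * + b                  ≈⟨ +-cong₂ (≈₂-sym aX≈v) (≈₂-refl {+ a * + b}) ⟩
          + a * + X r + + a * + b          ≡⟨ *-distribˡ-+ (+ a) (+ X r) (+ b) ⟨
          + a * (+ X r + + b)              ≡⟨ cong (λ x → + a * (x + + b)) (sym (point≡ r)) ⟩
          + a * (point r + + b)            ∎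
          where open SetoidReasoning ≈₂-setoid

        h-unit : ¬ h * inv (+ a) ^ w ≈ 0ℤ
        h-unit = *-≉0 h≉0 (λ d → inv-≉0 a≉0 (^-≈0 (inv (+ a)) w d))

        h′-suc : + suc (ℕ.pred (h′ r)) ≈ h * inv (+ a) ^ w
        h′-suc = ≈-trans (≡⇒≈ (cong +_ (ℕ.suc-pred (h′ r) {{ℕ.≢-nonZero λ e →
          h-unit (≈-trans (≈-residue (h * inv (+ a) ^ w)) (≡⇒≈ (cong +_ e)))}}))) (≈-sym (≈-residue (h * inv (+ a) ^ w)))

        a^w : (+ a) ^ w * inv (+ a) ^ w ≈ 1ℤ
        a^w = ≈-trans (≡⇒≈ (sym (*-^ (+ a) (inv (+ a)) w))) (≈-trans (^-cong w (inv-spec a≉0)) (≡⇒≈ (^-zeroˡ w)))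

        member^w : ∀ b → (+ member r b) ^ w ≈ (+ a) ^ w * (point r + + b) ^ w
        member^w b = ≈-trans (^-cong w (≈₂⇒≈ (member≈ b))) (≡⇒≈ (*-^ (+ a) (point r + + b) w))

        class⇒ : ∀ b → (+ member r b) ^ w ≈ h → (point r + + b) ^ w ≈ + suc (ℕ.pred (h′ r))
        class⇒ b d = begin
          (point r + + b) ^ w                                        ≡⟨ *-identityˡ ((point r + + b) ^ w) ⟨
          1ℤ * (point r + + b) ^ w                                   ≈⟨ *-cong a^w (≈-refl {(point r + + b) ^ w}) ⟨
          (+ a) ^ w * inv (+ a) ^ w * (point r + + b) ^ w            ≡⟨ lem ((+ a) ^ w) (inv (+ a) ^ w) ((point r + + b) ^ w) ⟩
          (+ a) ^ w * (point r + + b) ^ w * inv (+ a) ^ w            ≈⟨ *-cong (≈-trans (≈-sym (member^w b)) d) (≈-refl {inv (+ a) ^ w}) ⟩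
          h * inv (+ a) ^ w                                          ≈⟨ h′-suc ⟨
          + suc (ℕ.pred (h′ r))                                      ∎
          where
          open SetoidReasoning ≈-setoid
          lem : ∀ a i x → a * i * x ≡ a * x * i
          lem = solve-∀

        class⇐ : ∀ b → (point r + + b) ^ w ≈ + suc (ℕ.pred (h′ r)) → (+ member r b) ^ w ≈ h
        class⇐ b d = begin
          (+ member r b) ^ w                            ≈⟨ member^w b ⟩
          (+ a) ^ w * (point r + + b) ^ w               ≈⟨ *-cong (≈-refl {(+ a) ^ w}) (≈-trans d h′-suc) ⟩
          (+ a) ^ w * (h * inv (+ a) ^ w)               ≡⟨ lem ((+ a) ^ w) h (inv (+ a) ^ w) ⟩
          h * ((+ a) ^ w * inv (+ a) ^ w)               ≈⟨ *-cong (≈-refl {h}) a^w ⟩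
          h * 1ℤ                                        ≡⟨ *-identityʳ h ⟩
          h                                             ∎
          where
          open SetoidReasoning ≈-setoid
          lem : ∀ a h i → a * (h * i) ≡ h * (a * i)
          lem = solve-∀

        -- f is additive on a(X + b). The part belonging to a does not depend on b: it only
        -- translates the function, and norms do not notice it.
        F-member : ∀ b → (+ member r b) ^ w ≈ h → F (member r b) ≈ α * fq (+ a) + t (point r) b
        F-member b d = begin
          F (member r b)                                ≈⟨ F-spec (member r b) d ⟩
          α * fq (+ member r b)                         ≈⟨ *-cong (≈-refl {α}) (fq-cong m≉0 (*-≉0 a≉0 x≉0) (member≈ b)) ⟩
          α * fq (+ a * (point r + + b))                ≈⟨ *-cong (≈-refl {α}) (fq-* a≉0 x≉0) ⟩
          α * (fq (+ a) + fq (point r + + b))           ≡⟨ *-distribˡ-+ α (fq (+ a)) (fq (point r + + b)) ⟩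
          α * fq (+ a) + t (point r) b                  ∎
          where
          open SetoidReasoning ≈-setoid
          m≉0 : ¬ + member r b ≈ 0ℤ
          m≉0 = unit-of h≉0 0<w d
          x≉0 : ¬ point r + + b ≈ 0ℤ
          x≉0 = unit-of (λ e → h-unit (≈-trans (≈-sym h′-suc) e)) 0<w (class⇒ b d)

        cell∈ : ∀ {g} (per : Periodic g) (mean0 : ∑ₚ g ≡ 0ℤ) → cell r ∈ cells per mean0
        cell∈ per mean0 = ∈-cartesianProduct⁺ (∈-upTo⁺ (ℕ.m%n<n (X r) p)) (∈-cartesianProduct⁺
          (∈-upTo⁺ (ℕ.pred-mono-< {{ℕ.≢-nonZero λ e →
             h-unit (≈-trans (≈-residue (h * inv (+ a) ^ w)) (≡⇒≈ (cong +_ e)))}} (n%ℕd<d (h * inv (+ a) ^ w) p)))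
          (∈-upTo⁺ (ℕ.m<n*o⇒m/o<n {X r} {p} {p} (n%ℕd<d (+ v * inv₂ (+ a)) (p ℕ.* p)))))

      -- Equal X give a v′ ≡ a′ v modulo p². Both sides are below p², so they are equal, and
      -- fractions in lowest terms with the same value coincide.
      cell-injective : ∀ {r r′} → r ∈ pairs → r′ ∈ pairs → cell r ≡ cell r′ → r ≡ r′
      cell-injective {r@(a , v)} {r′@(a′ , v′)} r∈ r′∈ e = cong₂ _,_ a≡a′ v≡v′
        where
        ok = pairs-ok r∈
        ok′ = pairs-ok r′∈
        0<a = proj₁ ok
        a<p = proj₁ (proj₂ ok)
        v<p = proj₁ (proj₂ (proj₂ ok))
        cop = proj₂ (proj₂ (proj₂ ok))
        0<a′ = proj₁ ok′
        a′<p = proj₁ (proj₂ ok′)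
        v′<p = proj₁ (proj₂ (proj₂ ok′))
        cop′ = proj₂ (proj₂ (proj₂ ok′))
        XX : + X r ≡ + X r′
        XX = trans (sym (point≡ r)) (trans (cong₂ (λ y z → + y + P * + z) (cong proj₁ e) (cong (λ c → proj₂ (proj₂ c)) e)) (point≡ r′))
        lem : ∀ a a′ x → a * (a′ * x) ≡ a′ * (a * x)
        lem = solve-∀
        cross₂ : + (a ℕ.* v′) ≈₂ + (a′ ℕ.* v)
        cross₂ = begin
          + (a ℕ.* v′)              ≡⟨ pos-* a v′ ⟩
          + a * + v′                ≈⟨ *-cong₂ (≈₂-refl {+ a}) (≈₂-sym (aX≈v r′∈)) ⟩
          + a * (+ a′ * + X r′)     ≡⟨ cong (λ x → + a * (+ a′ * x)) XX ⟨
          + a * (+ a′ * + X r)      ≡⟨ lem (+ a) (+ a′) (+ X r) ⟩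
          + a′ * (+ a * + X r)      ≈⟨ *-cong₂ (≈₂-refl {+ a′}) (aX≈v r∈) ⟩
          + a′ * + v                ≡⟨ pos-* a′ v ⟨
          + (a′ ℕ.* v)              ∎
          where open SetoidReasoning ≈₂-setoid
        cross : a ℕ.* v′ ≡ a′ ℕ.* v
        cross = Mod.residue-unique (p ℕ.* p) (ℕ.*-mono-< a<p v′<p) (ℕ.*-mono-< a′<p v<p) cross₂
        a∣a′ : a ℕ.∣ a′
        a∣a′ = coprime-divisor cop (ℕ.divides v′ (trans (ℕ.*-comm v a′) (trans (sym cross) (ℕ.*-comm a v′))))
        a′∣a : a′ ℕ.∣ a
        a′∣a = coprime-divisor cop′ (ℕ.divides v (trans (ℕ.*-comm v′ a) (trans cross (ℕ.*-comm a′ v))))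
        a≡a′ : a ≡ a′
        a≡a′ = ℕ.∣-antisym a∣a′ a′∣a
        v≡v′ : v ≡ v′
        v≡v′ = ℕ.*-cancelˡ-≡ v v′ a {{ℕ.>-nonZero 0<a}} (trans (cong (ℕ._* v) a≡a′) (sym cross))

    module _ {g : ℤ → ℤ} (per : Periodic g) (mean0 : ∑ₚ g ≡ 0ℤ) where
      open Correlation per

      private
        comb : ℕ × ℕ → ℤ → ℤ
        comb r = combination bs (ι (point r) (+ suc (ℕ.pred (h′ r)))) (t (point r))

        comb-periodic : ∀ r → Periodic (comb r)
        comb-periodic r d = ∑-cong bs λ b → cong (ι (point r) (+ suc (ℕ.pred (h′ r))) b *_) (per (sub-cong d (≈-refl {t (point r) b})))

        offset : ℕ × ℕ → ℤ
        offset (a , v) = α * fq (+ a)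

        summand : ∀ r → r ∈ pairs → ∀ c → ∑[ b ∈ bs ] inClass (member r b) * g (c - F (member r b)) ≡ comb r (c - offset r)
        summand r@(a , v) r∈ c = ∑-cong bs λ b →
          ⟦⟧*-cong ((+ member r b) ^ w ≈? h) ((point r + + b) ^ w ≈? + suc (ℕ.pred (h′ r))) (class⇒ r∈ b) (class⇐ r∈ b)
            λ d → per (≈-trans (sub-cong (≈-refl {c}) (F-member r∈ b d)) (≡⇒≈ (lem c (offset r) (t (point r) b))))
          where
          lem : ∀ c s t → c - (s + t) ≡ c - s - t
          lem = solve-∀

        N = norm (T g)

        -- The share of one pair in the inner product of T g with itself, only one of the two
        -- factors being expanded.
        inner : ℕ × ℕ → ℤ
        inner r = ∑ₚ (λ c → comb r (c - offset r) * T g c)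

        N≡ : N ≡ ∑ pairs inner
        N≡ = trans (∑-cong (upTo p) λ c → trans (cong (_* T g (+ c)) (∑-cong-∈ pairs λ r r∈ → summand r r∈ (+ c)))
                (sym (∑-*ʳ (T g (+ c)) pairs (λ r → comb r (+ c - offset r)))))
              (∑-swap (upTo p) pairs (λ c r → comb r (+ c - offset r) * T g (+ c)))

        inner² : ∀ r → inner r * inner r ≤ norm (comb r) * N
        inner² r = ≤-trans (cauchy-schwarz (upTo p) (λ c → comb r (+ c - offset r)) (λ c → T g (+ c)))
          (≤-reflexive (cong (_* N) (∑ₚ-translate {λ c → comb r c * comb r c}
             (λ d → cong₂ _*_ (comb-periodic r d) (comb-periodic r d)) (- offset r))))

        Φᵣ : ℕ × ℕ → ℤ
        Φᵣ r = cell-Φ per mean0 (cell r)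

        -- The first Cauchy-Schwarz splits off the unexpanded T g, whose norm N stays as a factor to
        -- be cancelled at the end; `norm-combination²` then brings in the fourth moment.
        inner⁴ : ∀ r → inner r * inner r * (inner r * inner r) ≤ Φᵣ r * (norm g * (N * N))
        inner⁴ r = begin
          inner r * inner r * (inner r * inner r)            ≤⟨ square-mono-≤ (0≤i*i (inner r)) (inner² r) ⟩
          norm (comb r) * N * (norm (comb r) * N)            ≡⟨ lem₁ (norm (comb r)) N ⟩
          norm (comb r) * norm (comb r) * (N * N)            ≤⟨ *-monoʳ-≤-nonNeg (N * N) {{nonNegative (0≤i*i N)}}
                                                                  (norm-combination² bs (ι (point r) (+ suc (ℕ.pred (h′ r)))) (t (point r))) ⟩
          norm g * Φᵣ r * (N * N)                            ≡⟨ lem₂ (norm g) (Φᵣ r) (N * N) ⟩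
          Φᵣ r * (norm g * (N * N))                          ∎
          where
          open ≤-Reasoning
          lem₁ : ∀ a b → a * b * (a * b) ≡ a * a * (b * b)
          lem₁ = solve-∀
          lem₂ : ∀ a b c → a * b * c ≡ b * (a * c)
          lem₂ = solve-∀

        -- Distinct pairs occupy distinct cells and fourth moments are nonnegative, so the sum over
        -- pairs may be completed to all cells.
        ∑Φ : ∑ pairs Φᵣ ≤ stationary * (P * norm g)
        ∑Φ = ≤-trans (∑-injection cell pairs-unique cell-injective (λ r∈ → cell∈ r∈ per mean0) (cell-Φ per mean0)
                        (λ { (y , (i , z)) → 0≤fourthMoment bs (ι (+ y + P * + z) (+ suc i)) (t (+ y + P * + z)) }))
                     (moment-bound per mean0 0<w)

        N⁴ : N * N * (N * N) ≤ J * J * J * (stationary * P) * (norm g * norm g) * (N * N)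
        N⁴ = begin
          N * N * (N * N)
            ≡⟨ cong (λ t → t * t * (t * t)) N≡ ⟩
          ∑ pairs inner * ∑ pairs inner * (∑ pairs inner * ∑ pairs inner)
            ≤⟨ ∑-fourth-power pairs inner ⟩
          J * J * J * (∑[ r ∈ pairs ] inner r * inner r * (inner r * inner r))
            ≤⟨ *-monoˡ-≤-nonNeg (J * J * J) {{nonNegative 0≤J³}} (∑-mono pairs λ r _ → inner⁴ r) ⟩
          J * J * J * (∑[ r ∈ pairs ] Φᵣ r * (norm g * (N * N)))
            ≡⟨ cong (J * J * J *_) (∑-*ʳ (norm g * (N * N)) pairs Φᵣ) ⟩
          J * J * J * (∑ pairs Φᵣ * (norm g * (N * N)))
            ≤⟨ *-monoˡ-≤-nonNeg (J * J * J) {{nonNegative 0≤J³}} (*-monoʳ-≤-nonNeg (norm g * (N * N))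
                 {{nonNegative (0≤* (0≤norm g) (0≤i*i N))}} ∑Φ) ⟩
          J * J * J * (stationary * (P * norm g) * (norm g * (N * N)))
            ≡⟨ lem J stationary P (norm g) (N * N) ⟩
          J * J * J * (stationary * P) * (norm g * norm g) * (N * N) ∎
          where
          open ≤-Reasoning
          0≤J³ : 0ℤ ≤ J * J * J
          0≤J³ = 0≤* (0≤* {J} {J} (+≤+ ℕ.z≤n) (+≤+ ℕ.z≤n)) (+≤+ ℕ.z≤n)
          lem : ∀ J s P n m → J * J * J * (s * (P * n) * (n * m)) ≡ J * J * J * (s * P) * (n * n) * m
          lem = solve-∀

      -- N² is cancelled from the bound for N⁴; where nothing can be cancelled, N = 0 and the right
      -- side is nonnegative.
      Λ-bound : norm (T g) * norm (T g) ≤ J * J * J * (stationary * P) * (norm g * norm g)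
      Λ-bound = cancel (N * N) (J * J * J * (stationary * P) * (norm g * norm g)) (0≤i*i N) 0≤R N⁴
        where
        0≤s : 0ℤ ≤ stationary
        0≤s = +-mono-≤ (0≤* {+ 2} {+ B * + B * (+ B * + B)} (+≤+ ℕ.z≤n) (0≤i*i (+ B * + B)))
                       (0≤* {P} {+ 2 * (+ B * + B)} (+≤+ ℕ.z≤n) (0≤* {+ 2} {+ B * + B} (+≤+ ℕ.z≤n) (0≤i*i (+ B))))
        0≤R : 0ℤ ≤ J * J * J * (stationary * P) * (norm g * norm g)
        0≤R = 0≤* (0≤* (0≤* (0≤i*i J) (+≤+ ℕ.z≤n)) (0≤* 0≤s (+≤+ ℕ.z≤n))) (0≤i*i (norm g))
        cancel : ∀ a b → 0ℤ ≤ a → 0ℤ ≤ b → a * a ≤ b * a → a ≤ b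
        cancel (+ zero)  b 0≤a 0≤b le = 0≤b
        cancel +[1+ n ]  b 0≤a 0≤b le = *-cancelʳ-≤-pos +[1+ n ] b +[1+ n ] le

-- Counting solutions: main term, error term, and extraction of a solution.

module Count where
  open import Defs using (sumFin)
  open ListSum
  open Congruence
  open Periodic
  open FermatQuotient
  open Moment
  open Operator
  open import Data.Integer hiding (suc)
  open import Data.Integer.Properties hiding (_≟_)
  open import Data.Integer.Tactic.RingSolver using (solve-∀)
  open import Data.Fin using (Fin; zero; suc)

  fourth : ℤ → ℤ
  fourth x = x * x * (x * x)

  module Counting {p : ℕ} (pr : Prime p) (p≢2 : p ≢ 2) {w : ℕ} (0<w : 0 ℕ.< w) {α : ℤ} (α≉0 : ¬ Mod._≈_ p α 0ℤ)
    {B : ℕ} (B≤p : B ℕ.≤ p) {h : ℤ} (h≉0 : ¬ Mod._≈_ p h 0ℤ)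
    (f : ℕ → ℕ) (f-spec : ∀ u → Mod._≈_ p ((+ u) ^ w) h → Mod._≈_ p (+ f u) (α * Quotient.fq pr (+ u)))
    (pairs : List (ℕ × ℕ)) (pairs-unique : Unique pairs)
    (pairs-ok : ∀ {a v} → (a , v) ∈ pairs → 0 ℕ.< a × a ℕ.< p × v ℕ.< p × Coprime a v)
    (U : List ℕ) where

    open Mod p
    open PrimeMod pr
    open Period pr
    open Burgess pr p≢2 w α≉0 B≤p using (bs; stationary)
    open Averaging pr p≢2 0<w α≉0 B≤p h≉0 (λ u → + f u) f-spec pairs pairs-unique pairs-ok
    private
      P = + p
      n = + length U
      J = + length pairs

    representations : ℤ → ℤ
    representations c = ∑[ l ∈ U ] ⟦ c ≈? + f l ⟧

    T^ : ℕ → (ℤ → ℤ) → ℤ → ℤ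
    T^ zero    g = g
    T^ (suc k) g = T (T^ k g)

    W : ℤ
    W = ∑[ r ∈ pairs ] ∑[ b ∈ bs ] inClass (member r b)

    Λ : ℤ
    Λ = J * J * J * (stationary * P)

    E : ℤ
    E = norm representations

    0≤E : 0ℤ ≤ E
    0≤E = 0≤norm representations

    solutions : ℕ → ℤ → ℤ
    solutions k c = ∑[ l ∈ U ] T^ k representations (c - + f l)

    private
      r₀ = representations

      r₀-periodic : Periodic r₀
      r₀-periodic {x} {y} d = ∑-cong U λ l → ⟦⟧-cong (x ≈? + f l) (y ≈? + f l) (λ e → ≈-trans (≈-sym d) e) (≈-trans d)

      -- p times the deviation of r₀ from its mean n/p, so that everything stays integral.
      g : ℤ → ℤ
      g c = P * r₀ c - n

      g-periodic : Periodic g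
      g-periodic d = cong (λ t → P * t - n) (r₀-periodic d)

      pick-sum : ∀ {G} → Periodic G → ∑ₚ (λ x → r₀ x * G x) ≡ ∑[ l ∈ U ] G (+ f l)
      pick-sum {G} per = begin
        ∑ₚ (λ x → r₀ x * G x)                                       ≡⟨ ∑-cong (upTo p) (λ x → sym (∑-*ʳ (G (+ x)) U (λ l → ⟦ + x ≈? + f l ⟧))) ⟩
        ∑[ x ∈ upTo p ] ∑[ l ∈ U ] ⟦ + x ≈? + f l ⟧ * G (+ x)       ≡⟨ ∑-swap (upTo p) U (λ x l → ⟦ + x ≈? + f l ⟧ * G (+ x)) ⟩
        ∑[ l ∈ U ] ∑[ x ∈ upTo p ] ⟦ + x ≈? + f l ⟧ * G (+ x)       ≡⟨ ∑-cong U (λ l → ∑ₚ-pick per (+ f l)) ⟩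
        ∑[ l ∈ U ] G (+ f l)                                        ∎
        where open ≡-Reasoning

    -- The squared norm of a counting function counts coincidences: r₀ is a sum of point masses at
    -- the values on `U`.
    E≡ : E ≡ ∑[ l ∈ U ] ∑[ l′ ∈ U ] ⟦ + f l ≈? + f l′ ⟧
    E≡ = pick-sum r₀-periodic

    private
      ∑ₚ-const : ∀ c → ∑ₚ (λ _ → c) ≡ P * c
      ∑ₚ-const c = trans (∑-const (upTo p) c) (cong (λ l → + l * c) (length-upTo p))

      ∑r₀ : ∑ₚ r₀ ≡ n
      ∑r₀ = trans (∑-cong (upTo p) λ x → sym (*-identityʳ (r₀ (+ x)))) (trans (pick-sum {λ _ → 1ℤ} (λ _ → refl))
        (trans (∑-const U 1ℤ) (*-identityʳ n)))

      g-mean : ∑ₚ g ≡ 0ℤ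
      g-mean = trans (∑-distrib-- (upTo p) (λ x → P * r₀ (+ x)) (λ _ → n))
        (trans (cong₂ _-_ (trans (∑-*ˡ P (upTo p) (λ x → r₀ (+ x))) (cong (P *_) ∑r₀)) (∑ₚ-const n)) (+-inverseʳ (P * n)))

      T^-periodic : ∀ k {φ} → Periodic φ → Periodic (T^ k φ)
      T^-periodic zero    per = per
      T^-periodic (suc k) per = T-periodic (T^-periodic k per)

      T^-mean : ∀ k → ∑ₚ (T^ k g) ≡ 0ℤ
      T^-mean zero    = g-mean
      T^-mean (suc k) = T-mean (T^-periodic k g-periodic) (T^-mean k)

      -- T is linear and multiplies constants by `W`, the total mass of its kernel.
      T^-g : ∀ k c → T^ k g c ≡ P * T^ k r₀ c - n * W ^ k
      T^-g zero    c = cong (_-_ (P * r₀ c)) (sym (*-identityʳ n))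
      T^-g (suc k) c = begin
        T (T^ k g) c
          ≡⟨ ∑-cong pairs (λ r → ∑-cong bs λ b → trans (cong (inClass (member r b) *_) (T^-g k (c - + f (member r b))))
                                                   (lem (inClass (member r b)) P (T^ k r₀ (c - + f (member r b))) (n * W ^ k))) ⟩
        ∑[ r ∈ pairs ] ∑[ b ∈ bs ] (P * X r b - inClass (member r b) * (n * W ^ k))
          ≡⟨ ∑-cong pairs (λ r → trans (∑-distrib-- bs (λ b → P * X r b) (λ b → inClass (member r b) * (n * W ^ k)))
               (cong₂ _-_ (∑-*ˡ P bs (X r)) (∑-*ʳ (n * W ^ k) bs (λ b → inClass (member r b))))) ⟩
        ∑[ r ∈ pairs ] (P * ∑ bs (X r) - (∑[ b ∈ bs ] inClass (member r b)) * (n * W ^ k))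
          ≡⟨ trans (∑-distrib-- pairs (λ r → P * ∑ bs (X r)) (λ r → (∑[ b ∈ bs ] inClass (member r b)) * (n * W ^ k)))
               (cong₂ _-_ (∑-*ˡ P pairs (λ r → ∑ bs (X r))) (∑-*ʳ (n * W ^ k) pairs (λ r → ∑[ b ∈ bs ] inClass (member r b)))) ⟩
        P * T (T^ k r₀) c - W * (n * W ^ k)
          ≡⟨ cong (_-_ (P * T (T^ k r₀) c)) (lem₂ W n (W ^ k)) ⟩
        P * T (T^ k r₀) c - n * (W * W ^ k) ∎
        where
        open ≡-Reasoning
        X : ℕ × ℕ → ℕ → ℤ
        X r b = inClass (member r b) * T^ k r₀ (c - + f (member r b))
        lem : ∀ i P x m → i * (P * x - m) ≡ P * (i * x) - i * m
        lem = solve-∀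
        lem₂ : ∀ a b c → a * (b * c) ≡ b * (a * c)
        lem₂ = solve-∀

    Λ≡ : let j = length pairs in + (j ℕ.* j ℕ.* j ℕ.* ((2 ℕ.* (B ℕ.* B ℕ.* (B ℕ.* B)) ℕ.+ p ℕ.* (2 ℕ.* (B ℕ.* B))) ℕ.* p)) ≡ Λ
    Λ≡ = trans (pos-* (j ℕ.* j ℕ.* j) (s ℕ.* p)) (cong₂ _*_
      (trans (pos-* (j ℕ.* j) j) (cong (_* J) (pos-* j j))) (trans (pos-* s p) (cong (_* P) s≡)))
      where
      j = length pairs
      s = 2 ℕ.* (B ℕ.* B ℕ.* (B ℕ.* B)) ℕ.+ p ℕ.* (2 ℕ.* (B ℕ.* B))
      B² : + (B ℕ.* B) ≡ + B * + B
      B² = pos-* B B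
      s≡ : + s ≡ stationary
      s≡ = trans (pos-+ (2 ℕ.* (B ℕ.* B ℕ.* (B ℕ.* B))) (p ℕ.* (2 ℕ.* (B ℕ.* B))))
        (cong₂ _+_ (trans (pos-* 2 (B ℕ.* B ℕ.* (B ℕ.* B))) (cong (+ 2 *_) (trans (pos-* (B ℕ.* B) (B ℕ.* B)) (cong₂ _*_ B² B²))))
                   (trans (pos-* p (2 ℕ.* (B ℕ.* B))) (cong (P *_) (trans (pos-* 2 (B ℕ.* B)) (cong (+ 2 *_) B²)))))

    private
      0≤Λ : 0ℤ ≤ Λ
      0≤Λ = subst (0ℤ ≤_) Λ≡ (+≤+ ℕ.z≤n)

      norm-T^ : ∀ k → norm (T^ k g) * norm (T^ k g) ≤ Λ ^ k * (norm g * norm g)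
      norm-T^ zero    = ≤-reflexive (sym (*-identityˡ (norm g * norm g)))
      norm-T^ (suc k) = begin
        norm (T (T^ k g)) * norm (T (T^ k g))           ≤⟨ Λ-bound (T^-periodic k g-periodic) (T^-mean k) ⟩
        Λ * (norm (T^ k g) * norm (T^ k g))             ≤⟨ *-monoˡ-≤-nonNeg Λ {{nonNegative 0≤Λ}} (norm-T^ k) ⟩
        Λ * (Λ ^ k * (norm g * norm g))                 ≡⟨ *-assoc Λ (Λ ^ k) (norm g * norm g) ⟨
        Λ * Λ ^ k * (norm g * norm g)                   ∎
        where open ≤-Reasoning

      -- The exact value is p²E - p n², a variance; the negative part is dropped.
      norm-g : norm g ≤ P * P * E
      norm-g = begin
        norm g
          ≡⟨ ∑-cong (upTo p) (λ x → lem₁ P (r₀ (+ x)) n) ⟩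
        ∑ₚ (λ x → P * P * (r₀ x * r₀ x) + - + 2 * (P * n) * r₀ x + n * n)
          ≡⟨ trans (∑-distrib-+ (upTo p) (λ x → P * P * (r₀ (+ x) * r₀ (+ x)) + - + 2 * (P * n) * r₀ (+ x)) (λ _ → n * n))
               (cong₂ _+_ (trans (∑-distrib-+ (upTo p) (λ x → P * P * (r₀ (+ x) * r₀ (+ x))) (λ x → - + 2 * (P * n) * r₀ (+ x)))
                            (cong₂ _+_ (∑-*ˡ (P * P) (upTo p) (λ x → r₀ (+ x) * r₀ (+ x)))
                                       (trans (∑-*ˡ (- + 2 * (P * n)) (upTo p) (λ x → r₀ (+ x))) (cong (- + 2 * (P * n) *_) ∑r₀))))
                          (∑ₚ-const (n * n))) ⟩
        P * P * E + - + 2 * (P * n) * n + P * (n * n)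
          ≡⟨ lem₂ (P * P * E) P n ⟩
        P * P * E - P * (n * n)
          ≤⟨ shrink 0≤PNN ⟩
        P * P * E ∎
        where
        open ≤-Reasoning
        lem₁ : ∀ P r n → (P * r - n) * (P * r - n) ≡ P * P * (r * r) + - + 2 * (P * n) * r + n * n
        lem₁ = solve-∀
        lem₂ : ∀ e P n → e + - + 2 * (P * n) * n + P * (n * n) ≡ e - P * (n * n)
        lem₂ = solve-∀
        0≤PNN : 0ℤ ≤ P * (n * n)
        0≤PNN = 0≤* {P} (+≤+ ℕ.z≤n) (0≤i*i n)
        shrink : ∀ {a b} → 0ℤ ≤ b → a - b ≤ a
        shrink {a} {b} 0≤b = ≤-trans (+-monoʳ-≤ a (neg-mono-≤ 0≤b)) (≤-reflexive (+-identityʳ a))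

      error : ℕ → ℤ → ℤ
      error k c = ∑[ l ∈ U ] T^ k g (c - + f l)

      -- One prime variable is summed by Cauchy-Schwarz against r₀, and the other sits inside g. In
      -- the fourth power each of them contributes E².
      error-bound : ∀ k c → fourth (error k c) ≤ fourth (P * E) * Λ ^ k
      error-bound k c = begin
        A * A * (A * A)                           ≤⟨ square-mono-≤ (0≤i*i A) A² ⟩
        E * norm G * (E * norm G)                 ≡⟨ lem₁ E (norm G) ⟩
        E * E * (norm G * norm G)                 ≤⟨ *-monoˡ-≤-nonNeg (E * E) {{nonNegative (0≤i*i E)}} (norm-T^ k) ⟩
        E * E * (Λ ^ k * (norm g * norm g))       ≡⟨ *-assoc (E * E) (Λ ^ k) (norm g * norm g) ⟨
        E * E * Λ ^ k * (norm g * norm g)         ≤⟨ *-monoˡ-≤-nonNeg (E * E * Λ ^ k) {{nonNegative 0≤EΛ}}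
                                                       (square-mono-≤ (0≤norm g) norm-g) ⟩
        E * E * Λ ^ k * (P * P * E * (P * P * E)) ≡⟨ lem₂ E (Λ ^ k) P ⟩
        fourth (P * E) * Λ ^ k                    ∎
        where
        open ≤-Reasoning
        G = T^ k g
        A = error k c
        G-periodic = T^-periodic k g-periodic
        0≤EΛ : 0ℤ ≤ E * E * Λ ^ k
        0≤EΛ = 0≤* (0≤i*i E) (0≤^ 0≤Λ k)
        A≡ : ∑ₚ (λ x → r₀ x * G (c - x)) ≡ A
        A≡ = pick-sum {λ x → G (c - x)} (λ d → G-periodic (sub-cong (≈-refl {c}) d))
        A² : A * A ≤ E * norm G
        A² = begin
          A * A                                                             ≡⟨ cong (λ t → t * t) A≡ ⟨
          ∑ₚ (λ x → r₀ x * G (c - x)) * ∑ₚ (λ x → r₀ x * G (c - x))         ≤⟨ cauchy-schwarz (upTo p) (λ x → r₀ (+ x)) (λ x → G (c - + x)) ⟩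
          E * ∑ₚ (λ x → G (c - x) * G (c - x))                              ≡⟨ cong (E *_) (∑ₚ-reflect {λ x → G x * G x} (λ d → cong₂ _*_ (G-periodic d) (G-periodic d)) c) ⟩
          E * norm G                                                        ∎
        lem₁ : ∀ a b → a * b * (a * b) ≡ a * a * (b * b)
        lem₁ = solve-∀
        lem₂ : ∀ E L P → E * E * L * (P * P * E * (P * P * E)) ≡ P * E * (P * E) * (P * E * (P * E)) * L
        lem₂ = solve-∀

      solutions-split : ∀ k c → P * solutions k c ≡ n * n * W ^ k + error k c
      solutions-split k c = begin
        P * solutions k c
          ≡⟨ ∑-*ˡ P U (λ l → T^ k r₀ (c - + f l)) ⟨
        ∑[ l ∈ U ] P * T^ k r₀ (c - + f l)
          ≡⟨ ∑-cong U (λ l → trans (lem₁ (P * T^ k r₀ (c - + f l)) (n * W ^ k)) (cong (_+_ (n * W ^ k)) (sym (T^-g k (c - + f l))))) ⟩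
        ∑[ l ∈ U ] (n * W ^ k + T^ k g (c - + f l))
          ≡⟨ ∑-distrib-+ U (λ _ → n * W ^ k) (λ l → T^ k g (c - + f l)) ⟩
        (∑[ l ∈ U ] n * W ^ k) + error k c
          ≡⟨ cong (_+ error k c) (trans (∑-const U (n * W ^ k)) (sym (*-assoc n n (W ^ k)))) ⟩
        n * n * W ^ k + error k c ∎
        where
        open ≡-Reasoning
        lem₁ : ∀ a b → a ≡ b + (a - b)
        lem₁ = solve-∀

    0≤W : 0ℤ ≤ W
    0≤W = ∑-nonneg pairs λ r → ∑-nonneg bs λ b → 0≤⟦⟧ ((+ member r b) ^ w ≈? h)

    private
      0≤main : ∀ k → 0ℤ ≤ n * n * W ^ k
      0≤main k = 0≤* (0≤i*i n) (0≤^ 0≤W k)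

    -- Without solutions the error would have to cancel the main term n² W^k.
    solutions-positive : ∀ k c → fourth (P * E) * Λ ^ k < fourth (n * n * W ^ k) → 0ℤ < solutions k c
    solutions-positive k c lt = ≰⇒> λ R≤0 → <⇒≱ lt (begin
      fourth M                    ≤⟨ fourth-mono (0≤main k) (M≤ R≤0) ⟩
      fourth (- error k c)        ≡⟨ lem₁ (error k c) ⟩
      fourth (error k c)          ≤⟨ error-bound k c ⟩
      fourth (P * E) * Λ ^ k      ∎)
      where
      open ≤-Reasoning
      M = n * n * W ^ k
      lem₁ : ∀ a → - a * - a * (- a * - a) ≡ a * a * (a * a)
      lem₁ = solve-∀
      lem₂ : ∀ a b → a ≡ a + b + - b
      lem₂ = solve-∀
      fourth-mono : ∀ {a b} → 0ℤ ≤ a → a ≤ b → fourth a ≤ fourth b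
      fourth-mono {a} 0≤a a≤b = square-mono-≤ (0≤i*i a) (square-mono-≤ 0≤a a≤b)
      M≤ : solutions k c ≤ 0ℤ → M ≤ - error k c
      M≤ R≤0 = begin
        M                                 ≡⟨ lem₂ M (error k c) ⟩
        M + error k c + - error k c       ≡⟨ cong (_+ - error k c) (solutions-split k c) ⟨
        P * solutions k c + - error k c   ≤⟨ +-monoˡ-≤ (- error k c) (≤-trans (*-monoˡ-≤-nonNeg P R≤0) (≤-reflexive (*-zeroʳ P))) ⟩
        0ℤ + - error k c                  ≡⟨ +-identityˡ (- error k c) ⟩
        - error k c                       ∎

    module _ (Good : ℕ → Set) (U-good : ∀ {l} → l ∈ U → Good l)
             (member-good : ∀ {r b} → r ∈ pairs → b ∈ bs → Good (member r b)) where

      private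
        ⟦⟧-positive : ∀ {A : Set} (d : Dec A) {X} → 0ℤ < ⟦ d ⟧ * X → A × 0ℤ < X
        ⟦⟧-positive (yes a) {X} lt = a , <-≤-trans lt (≤-reflexive (*-identityˡ X))
        ⟦⟧-positive (no _)  {X} lt = ⊥-elim (<-irrefl refl (<-≤-trans lt (≤-reflexive (*-zeroˡ X))))

        Sum : ℕ → ℤ → Set
        Sum m c = ∃ λ (u : Fin m → ℕ) → (∀ i → Good (u i)) × c ≈ + sumFin (λ i → f (u i))

        extend : ∀ {m c u₀} → Good u₀ → Sum m (c - + f u₀) → Sum (suc m) c
        extend {m} {c} {u₀} g₀ (u , good , d) = u′ , good′ , (begin
          c                                             ≡⟨ lem c (+ f u₀) ⟩
          + f u₀ + (c - + f u₀)                         ≈⟨ +-cong (≈-refl {+ f u₀}) d ⟩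
          + f u₀ + + sumFin (λ i → f (u i))             ≡⟨ pos-+ (f u₀) (sumFin (λ i → f (u i))) ⟨
          + (f u₀ ℕ.+ sumFin (λ i → f (u i)))           ∎)
          where
          open import Relation.Binary.Reasoning.Setoid ≈-setoid
          u′ : Fin (suc m) → ℕ
          u′ zero    = u₀
          u′ (suc i) = u i
          good′ : ∀ i → Good (u′ i)
          good′ zero    = g₀
          good′ (suc i) = good i
          lem : ∀ c a → c ≡ a + (c - a)
          lem = solve-∀

        ⟦⟧>0 : ∀ {A : Set} (d : Dec A) → 0ℤ < ⟦ d ⟧ → A
        ⟦⟧>0 (yes a) _  = a
        ⟦⟧>0 (no _)  lt = ⊥-elim (<-irrefl refl lt)

        -- A positive sum has a positive summand. Following these through the k applications of T
        -- recovers one variable each time, and r₀ at the end supplies a prime.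
        reach : ∀ k c → 0ℤ < T^ k r₀ c → Sum (suc k) c
        reach zero c lt = let (l , l∈ , pos) = ∑-positive U (λ l → ⟦ c ≈? + f l ⟧) lt in
          (λ _ → l) , (λ _ → U-good l∈) , ≈-trans (⟦⟧>0 (c ≈? + f l) pos) (≡⇒≈ (cong +_ (sym (ℕ.+-identityʳ (f l)))))
        reach (suc k) c lt =
          let (r , r∈ , lt₁) = ∑-positive pairs (λ r → ∑[ b ∈ bs ] inClass (member r b) * T^ k r₀ (c - + f (member r b))) lt
              (b , b∈ , lt₂) = ∑-positive bs (λ b → inClass (member r b) * T^ k r₀ (c - + f (member r b))) lt₁
              (_ , lt₃)      = ⟦⟧-positive ((+ member r b) ^ w ≈? h) lt₂
          in extend (member-good r∈ b∈) (reach k (c - + f (member r b)) lt₃)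

      solution : ∀ k c → 0ℤ < solutions k c → ∃ λ (u : Fin (suc (suc k)) → ℕ) → (∀ i → Good (u i)) × c ≈ + sumFin (λ i → f (u i))
      solution k c lt = let (l , l∈ , pos) = ∑-positive U (λ l → T^ k r₀ (c - + f l)) lt in
        extend (U-good l∈) (reach k (c - + f l) pos)

-- Classes of w-th powers, w-th roots of unity, and coincidences among prime values.

module Energy where
  open ListSum
  open Congruence
  open PrimeField
  open FermatQuotient
  open import Data.Nat.GCD using (gcd; gcd-GCD; gcd[m,n]∣m; gcd[m,n]∣n; module Bézout)
  open import Data.Integer hiding (suc)
  open import Data.Integer.Properties hiding (_≟_)
  open import Data.Integer.DivMod using (_%ℕ_; n%ℕd<d)
  open import Data.Integer.Tactic.RingSolver using (solve-∀)

  prime-∣-prime : ∀ {l m} → Prime l → Prime m → l ℕ.∣ m → l ≡ m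
  prime-∣-prime pl pm l∣m with prime⇒irreducible pm l∣m
  ... | inj₁ refl = contradiction (ℕ.nonTrivial⇒n>1 1 {{prime⇒nonTrivial pl}}) (ℕ.<-irrefl refl)
  ... | inj₂ l≡m  = l≡m

  module PowerClasses {p : ℕ} (pr : Prime p) {w : ℕ} (0<w : 0 ℕ.< w) where
    open Mod p
    open PrimeMod pr
    open Quotient pr
    private instance
      p≢0 : ℕ.NonZero p
      p≢0 = prime⇒nonZero pr

    d = gcd w (ℕ.pred p)

    private
      0<p-1 : 0 ℕ.< ℕ.pred p
      0<p-1 = ℕ.pred-mono-≤ (ℕ.nonTrivial⇒n>1 p {{prime⇒nonTrivial pr}})

      pos-factor : ∀ {a b c} → 0 ℕ.< c → c ≡ a ℕ.* b → 0 ℕ.< a × 0 ℕ.< b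
      pos-factor {zero}  {b} 0<c e = contradiction (sym e) (ℕ.<⇒≢ 0<c)
      pos-factor {suc a} {zero} 0<c e = contradiction (sym (trans e (ℕ.*-zeroʳ a))) (ℕ.<⇒≢ 0<c)
      pos-factor {suc a} {suc b} _ _ = ℕ.z<s , ℕ.z<s

    abstract
      -- (p-1)/gcd(w,p-1), made opaque so that later computations see it only through `e*d`.
      e : ℕ
      e = ℕ.quotient (gcd[m,n]∣n w (ℕ.pred p))

      e*d : ℕ.pred p ≡ e ℕ.* d
      e*d = ℕ._∣_.equality (gcd[m,n]∣n w (ℕ.pred p))

    0<e : 0 ℕ.< e
    0<e = proj₁ (pos-factor 0<p-1 e*d)

    0<d : 0 ℕ.< d
    0<d = proj₂ (pos-factor {e} {d} 0<p-1 e*d)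

    private
      power-one : ∀ {x} n k → x ^ n ≈ 1ℤ → x ^ (n ℕ.* k) ≈ 1ℤ
      power-one {x} n k d = ≈-trans (≡⇒≈ (sym (^-*-assoc x n k))) (≈-trans (^-cong k d) (≡⇒≈ (^-zeroˡ k)))

    -- The e-th roots of unity, which contain all w-th powers of units. Described by an equation,
    -- they can be counted by the root bound.
    classes : List ℕ
    classes = filter (λ y → (+ y) ^ e ≈? 1ℤ) (upTo p)

    classes-unique : Unique classes
    classes-unique = Unique.filter⁺ (λ y → (+ y) ^ e ≈? 1ℤ) (Unique.upTo⁺ p)

    private
      ∈-classes⁻ : ∀ {y} → y ∈ classes → y ℕ.< p × (+ y) ^ e ≈ 1ℤ
      ∈-classes⁻ y∈ = let (y∈′ , r) = ∈-filter⁻ (λ y → (+ y) ^ e ≈? 1ℤ) {xs = upTo p} y∈ in ∈-upTo⁻ y∈′ , r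

    classes-count : length classes ℕ.≤ e
    classes-count = power-roots-bound pr e 0<e classes-unique
      (All.tabulate λ y∈ → proj₁ (∈-classes⁻ y∈)) (All.tabulate λ y∈ → proj₂ (∈-classes⁻ y∈))

    class≉0 : ∀ {y} → y ∈ classes → ¬ + y ≈ 0ℤ
    class≉0 y∈ = unit-of (1≉0 pr) 0<e (proj₂ (∈-classes⁻ y∈))

    class-of : ℕ → ℕ
    class-of u = ((+ u) ^ w) %ℕ p

    class-of∈ : ∀ {u} → ¬ + u ≈ 0ℤ → class-of u ∈ classes
    class-of∈ {u} u≉0 = ∈-filter⁺ (λ y → (+ y) ^ e ≈? 1ℤ) (∈-upTo⁺ (n%ℕd<d ((+ u) ^ w) p))
      (≈-trans (^-cong e (≈-sym (≈-residue ((+ u) ^ w)))) (≈-trans (≡⇒≈ exponent) (power-one (ℕ.pred p) w′ (fermat pr (+ u) u≉0))))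
      where
      w′ = ℕ.quotient (gcd[m,n]∣m w (ℕ.pred p))
      w≡ : w ≡ w′ ℕ.* d
      w≡ = ℕ._∣_.equality (gcd[m,n]∣m w (ℕ.pred p))
      we : w ℕ.* e ≡ ℕ.pred p ℕ.* w′
      we = trans (cong (ℕ._* e) w≡) (trans (ℕ.*-assoc w′ d e) (trans (ℕ.*-comm w′ (d ℕ.* e))
        (cong (ℕ._* w′) (trans (ℕ.*-comm d e) (sym e*d)))))
      exponent : ((+ u) ^ w) ^ e ≡ (+ u) ^ (ℕ.pred p ℕ.* w′)
      exponent = trans (^-*-assoc (+ u) w e) (cong ((+ u) ^_) we)

    ∑-classes : ∀ {u} → ¬ + u ≈ 0ℤ → ∑[ y ∈ classes ] ⟦ (+ u) ^ w ≈? + y ⟧ ≡ 1ℤ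
    ∑-classes {u} u≉0 = trans (∑-single (λ y → ⟦ (+ u) ^ w ≈? + y ⟧) classes-unique (class-of∈ u≉0)
        (λ y y∈ y≢ → ⟦⟧-no ((+ u) ^ w ≈? + y) λ r → y≢ (residue-unique (proj₁ (∈-classes⁻ y∈)) (n%ℕd<d ((+ u) ^ w) p)
          (≈-trans (≈-sym r) (≈-residue ((+ u) ^ w))))))
      (⟦⟧-yes ((+ u) ^ w ≈? + class-of u) (≈-residue ((+ u) ^ w)))

    kernel : List ℕ
    kernel = filter (λ y → (+ y) ^ w ≈? 1ℤ) (upTo p)

    private
      ∈-kernel⁻ : ∀ {y} → y ∈ kernel → y ℕ.< p × (+ y) ^ w ≈ 1ℤ
      ∈-kernel⁻ y∈ = let (y∈′ , r) = ∈-filter⁻ (λ y → (+ y) ^ w ≈? 1ℤ) {xs = upTo p} y∈ in ∈-upTo⁻ y∈′ , r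

      ∈-kernel⁺ : ∀ {x} → x ^ w ≈ 1ℤ → x %ℕ p ∈ kernel
      ∈-kernel⁺ {x} r = ∈-filter⁺ (λ y → (+ y) ^ w ≈? 1ℤ) (∈-upTo⁺ (n%ℕd<d x p)) (≈-trans (^-cong w (≈-sym (≈-residue x))) r)

      -- d is an integral combination of w and p-1, and both exponents send x to 1. The identity in
      -- natural numbers has two sign patterns, both of the shape d + j b = i a.
      order-divides : ∀ {x} → x ^ w ≈ 1ℤ → x ^ d ≈ 1ℤ
      order-divides {x} r = from (Bézout.identity (gcd-GCD w (ℕ.pred p)))
        where
        open SetoidReasoning ≈-setoid
        r′ : x ^ ℕ.pred p ≈ 1ℤ
        r′ = fermat pr x (unit-of (1≉0 pr) 0<w r)
        relation : ∀ i a j b → x ^ a ≈ 1ℤ → x ^ b ≈ 1ℤ → d ℕ.+ j ℕ.* b ≡ i ℕ.* a → x ^ d ≈ 1ℤ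
        relation i a j b ra rb eq = begin
          x ^ d                        ≡⟨ *-identityʳ (x ^ d) ⟨
          x ^ d * 1ℤ                   ≈⟨ *-cong (≈-refl {x ^ d}) (power-one b j rb) ⟨
          x ^ d * x ^ (b ℕ.* j)        ≡⟨ ^-distribˡ-+-* x d (b ℕ.* j) ⟨
          x ^ (d ℕ.+ b ℕ.* j)          ≡⟨ cong (x ^_) (trans (cong (d ℕ.+_) (ℕ.*-comm b j)) (trans eq (ℕ.*-comm i a))) ⟩
          x ^ (a ℕ.* i)                ≈⟨ power-one a i ra ⟩
          1ℤ                           ∎
        from : Bézout.Identity d w (ℕ.pred p) → x ^ d ≈ 1ℤ
        from (Bézout.+- i j eq) = relation i w j (ℕ.pred p) r r′ eq
        from (Bézout.-+ i j eq) = relation j (ℕ.pred p) i w r′ r eq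

    -- The equation y^w = 1 itself allows w roots; passing to y^d = 1 first brings this down to d.
    kernel-count : length kernel ℕ.≤ d
    kernel-count = power-roots-bound pr d 0<d (Unique.filter⁺ (λ y → (+ y) ^ w ≈? 1ℤ) (Unique.upTo⁺ p))
      (All.tabulate λ y∈ → proj₁ (∈-kernel⁻ y∈)) (All.tabulate λ y∈ → order-divides (proj₂ (∈-kernel⁻ y∈)))

    module _ {h α : ℤ} (h≉0 : ¬ h ≈ 0ℤ) (α≉0 : ¬ α ≈ 0ℤ)
      (f : ℕ → ℕ) (f-spec : ∀ u → (+ u) ^ w ≈ h → + f u ≈ α * fq (+ u))
      (U : List ℕ) (U-unique : Unique U) (U-ok : ∀ {l} → l ∈ U → Prime l × l ℕ.< p × (+ l) ^ w ≈ h) where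

      private
        prime : ∀ {l} → l ∈ U → Prime l
        prime l∈ = proj₁ (U-ok l∈)
        below : ∀ {l} → l ∈ U → l ℕ.< p
        below l∈ = proj₁ (proj₂ (U-ok l∈))
        class : ∀ {l} → l ∈ U → (+ l) ^ w ≈ h
        class l∈ = proj₂ (proj₂ (U-ok l∈))
        unit : ∀ {l} → l ∈ U → ¬ + l ≈ 0ℤ
        unit l∈ = unit-of h≉0 0<w (class l∈)

        ratio : ℕ → ℕ → ℤ
        ratio l l′ = + l * inv (+ l′)

        ratio∈ : ∀ {l l′} → l ∈ U → l′ ∈ U → ratio l l′ %ℕ p ∈ kernel
        ratio∈ {l} {l′} l∈ l′∈ = ∈-kernel⁺ (begin
          ratio l l′ ^ w                        ≡⟨ *-^ (+ l) (inv (+ l′)) w ⟩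
          (+ l) ^ w * inv (+ l′) ^ w            ≈⟨ *-cong (≈-trans (class l∈) (≈-sym (class l′∈))) (≈-refl {inv (+ l′) ^ w}) ⟩
          (+ l′) ^ w * inv (+ l′) ^ w           ≡⟨ *-^ (+ l′) (inv (+ l′)) w ⟨
          (+ l′ * inv (+ l′)) ^ w               ≈⟨ ^-cong w (inv-spec (unit l′∈)) ⟩
          1ℤ ^ w                                ≡⟨ ^-zeroˡ w ⟩
          1ℤ                                    ∎)
          where open SetoidReasoning ≈-setoid

        same-residue : ∀ {x y} → x %ℕ p ≡ y %ℕ p → x ≈ y
        same-residue {x} {y} r = ≈-trans (≈-residue x) (≈-trans (≡⇒≈ (cong +_ r)) (≈-sym (≈-residue y)))

        cross : ∀ {l₁ l₁′ l₂ l₂′} → l₁′ ∈ U → l₂′ ∈ U → ratio l₁ l₁′ ≈ ratio l₂ l₂′ → + l₁ * + l₂′ ≈ + l₂ * + l₁′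
        cross {l₁} {l₁′} {l₂} {l₂′} ∈₁ ∈₂ r = begin
          + l₁ * + l₂′                                  ≡⟨ *-identityʳ (+ l₁ * + l₂′) ⟨
          + l₁ * + l₂′ * 1ℤ                             ≈⟨ *-cong (≈-refl {+ l₁ * + l₂′}) (inv-spec (unit ∈₁)) ⟨
          + l₁ * + l₂′ * (+ l₁′ * inv (+ l₁′))          ≡⟨ lem (+ l₁) (+ l₂′) (+ l₁′) (inv (+ l₁′)) ⟩
          ratio l₁ l₁′ * (+ l₁′ * + l₂′)                ≈⟨ *-cong r (≈-refl {+ l₁′ * + l₂′}) ⟩
          ratio l₂ l₂′ * (+ l₁′ * + l₂′)                ≡⟨ lem₂ (+ l₂) (inv (+ l₂′)) (+ l₁′) (+ l₂′) ⟩
          + l₂ * + l₁′ * (+ l₂′ * inv (+ l₂′))          ≈⟨ *-cong (≈-refl {+ l₂ * + l₁′}) (inv-spec (unit ∈₂)) ⟩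
          + l₂ * + l₁′ * 1ℤ                             ≡⟨ *-identityʳ (+ l₂ * + l₁′) ⟩
          + l₂ * + l₁′                                  ∎
          where
          open SetoidReasoning ≈-setoid
          lem : ∀ a b c i → a * b * (c * i) ≡ a * i * (c * b)
          lem = solve-∀
          lem₂ : ∀ a i c b → a * i * (c * b) ≡ a * c * (b * i)
          lem₂ = solve-∀

        coincide : ∀ {l l′} → l ∈ U → l′ ∈ U → + f l ≈ + f l′ → fq (+ l) ≈ fq (+ l′)
        coincide {l} {l′} l∈ l′∈ r = *-cancelˡ-≈ α α≉0
          (≈-trans (≈-sym (f-spec l (class l∈))) (≈-trans r (f-spec l′ (class l′∈))))

        -- Equal Fermat quotients lift the congruence l₁ l₂′ ≡ l₂ l₁′ to modulus p², where it is an equality of integers.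
        pair-injective : ∀ {l₁ l₁′ l₂ l₂′} → l₁ ∈ U → l₁′ ∈ U → l₂ ∈ U → l₂′ ∈ U → l₁ ≢ l₁′ →
          + f l₁ ≈ + f l₁′ → + f l₂ ≈ + f l₂′ → ratio l₁ l₁′ ≈ ratio l₂ l₂′ → (l₁ , l₁′) ≡ (l₂ , l₂′)
        pair-injective {l₁} {l₁′} {l₂} {l₂′} ∈₁ ∈₁′ ∈₂ ∈₂′ ne r₁ r₂ r =
          [ (λ l₁∣l₂ → conclude (prime-∣-prime (prime ∈₁) (prime ∈₂) l₁∣l₂))
          , (λ l₁∣l₁′ → contradiction (prime-∣-prime (prime ∈₁) (prime ∈₁′) l₁∣l₁′) ne) ]′
          (euclidsLemma l₂ l₁′ (prime ∈₁) (subst (l₁ ℕ.∣_) equal (ℕ.m∣m*n l₂′)))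
          where
          lifted : + l₁ * + l₂′ ≈₂ + l₂ * + l₁′
          lifted = ≈-lift (*-≉0 (unit ∈₂) (unit ∈₁′)) (cross {l₁} {l₁′} {l₂} {l₂′} ∈₁′ ∈₂′ r) (begin
            fq (+ l₁ * + l₂′)           ≈⟨ fq-* (unit ∈₁) (unit ∈₂′) ⟩
            fq (+ l₁) + fq (+ l₂′)      ≈⟨ +-cong (coincide ∈₁ ∈₁′ r₁) (≈-sym (coincide ∈₂ ∈₂′ r₂)) ⟩
            fq (+ l₁′) + fq (+ l₂)      ≡⟨ +-comm (fq (+ l₁′)) (fq (+ l₂)) ⟩
            fq (+ l₂) + fq (+ l₁′)      ≈⟨ fq-* (unit ∈₂) (unit ∈₁′) ⟨
            fq (+ l₂ * + l₁′)           ∎)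
            where open SetoidReasoning ≈-setoid
          equal : l₁ ℕ.* l₂′ ≡ l₂ ℕ.* l₁′
          equal = Mod.residue-unique (p ℕ.* p) (ℕ.*-mono-< (below ∈₁) (below ∈₂′)) (ℕ.*-mono-< (below ∈₂) (below ∈₁′))
            (≈₂-trans (≡⇒≈₂ (pos-* l₁ l₂′)) (≈₂-trans lifted (≡⇒≈₂ (sym (pos-* l₂ l₁′)))))
          conclude : l₁ ≡ l₂ → (l₁ , l₁′) ≡ (l₂ , l₂′)
          conclude refl = cong (l₁ ,_) (sym (ℕ.*-cancelˡ-≡ l₂′ l₁′ l₁ {{prime⇒nonZero (prime ∈₁)}} equal))

        Off : ℕ × ℕ → Set
        Off (l , l′) = l ≢ l′ × + f l ≈ + f l′

        off? : ∀ r → Dec (Off r)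
        off? (l , l′) = ¬? (l ℕ.≟ l′) ×-dec (+ f l ≈? + f l′)

        offDiagonal : List (ℕ × ℕ)
        offDiagonal = filter off? (cartesianProduct U U)

        ∈-off : ∀ {l l′} → (l , l′) ∈ offDiagonal → l ∈ U × l′ ∈ U × l ≢ l′ × + f l ≈ + f l′
        ∈-off r∈ = let (r∈′ , (ne , r)) = ∈-filter⁻ off? {xs = cartesianProduct U U} r∈
                       (l∈ , l′∈) = ∈-cartesianProduct⁻ U U r∈′ in l∈ , l′∈ , ne , r

        off-count : length offDiagonal ℕ.≤ length kernel
        off-count = length-injection (λ { (l , l′) → ratio l l′ %ℕ p })
          (Unique.filter⁺ off? (Unique.cartesianProduct⁺ U-unique U-unique))
          (λ {r} {r′} i j → inj {r} {r′} i j) (λ {r} r∈ → into {r} r∈)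
          where
          inj : ∀ {r r′} → r ∈ offDiagonal → r′ ∈ offDiagonal →
                ratio (proj₁ r) (proj₂ r) %ℕ p ≡ ratio (proj₁ r′) (proj₂ r′) %ℕ p → r ≡ r′
          inj {l₁ , l₁′} {l₂ , l₂′} r∈ r′∈ eq =
            let (∈₁ , ∈₁′ , ne , r₁) = ∈-off r∈ ; (∈₂ , ∈₂′ , _ , r₂) = ∈-off r′∈ in
            pair-injective ∈₁ ∈₁′ ∈₂ ∈₂′ ne r₁ r₂ (same-residue {ratio l₁ l₁′} {ratio l₂ l₂′} eq)
          into : ∀ {r} → r ∈ offDiagonal → ratio (proj₁ r) (proj₂ r) %ℕ p ∈ kernel
          into {l , l′} r∈ = let (l∈ , l′∈ , _) = ∈-off r∈ in ratio∈ l∈ l′∈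

      -- The ratios of the elements of `U` to its first element are distinct w-th roots of unity.
      class-count : length U ℕ.≤ d
      class-count = ℕ.≤-trans (count U refl) kernel-count
        where
        count : ∀ V → V ≡ U → length V ℕ.≤ length kernel
        count []       _    = ℕ.z≤n
        count (l₀ ∷ V) refl = length-injection (λ l → ratio l l₀ %ℕ p) U-unique
          (λ {l} {l′} l∈ l′∈ eq → residue-unique (below l∈) (below l′∈)
            (*-cancelˡ-≈ (+ l₀) (unit (here refl)) (≈-trans (≡⇒≈ (*-comm (+ l₀) (+ l)))
              (≈-trans (cross {l} {l₀} {l′} {l₀} (here refl) (here refl) (same-residue {ratio l l₀} {ratio l′ l₀} eq)) (≡⇒≈ (*-comm (+ l′) (+ l₀)))))))
          (λ l∈ → ratio∈ l∈ (here refl))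

      -- The diagonal contributes the length of `U`, at most d; off the diagonal, each w-th root of
      -- unity is the ratio of at most one coinciding pair.
      energy-bound : ∑[ l ∈ U ] ∑[ l′ ∈ U ] ⟦ + f l ≈? + f l′ ⟧ ≤ + 2 * + d
      energy-bound = begin
        ∑[ l ∈ U ] ∑[ l′ ∈ U ] ⟦ + f l ≈? + f l′ ⟧
          ≤⟨ ∑-mono U (λ l _ → ∑-mono U λ l′ _ → split (l ℕ.≟ l′) (+ f l ≈? + f l′)) ⟩
        ∑[ l ∈ U ] ∑[ l′ ∈ U ] (⟦ l ℕ.≟ l′ ⟧ + ⟦ off? (l , l′) ⟧)
          ≡⟨ ∑-cong U (λ l → ∑-distrib-+ U (λ l′ → ⟦ l ℕ.≟ l′ ⟧) (λ l′ → ⟦ off? (l , l′) ⟧)) ⟩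
        ∑[ l ∈ U ] ((∑[ l′ ∈ U ] ⟦ l ℕ.≟ l′ ⟧) + (∑[ l′ ∈ U ] ⟦ off? (l , l′) ⟧))
          ≡⟨ ∑-distrib-+ U (λ l → ∑[ l′ ∈ U ] ⟦ l ℕ.≟ l′ ⟧) (λ l → ∑[ l′ ∈ U ] ⟦ off? (l , l′) ⟧) ⟩
        (∑[ l ∈ U ] ∑[ l′ ∈ U ] ⟦ l ℕ.≟ l′ ⟧) + (∑[ l ∈ U ] ∑[ l′ ∈ U ] ⟦ off? (l , l′) ⟧)
          ≡⟨ cong₂ _+_ diagonal (trans (sym (∑-cartesianProduct U U (λ r → ⟦ off? r ⟧))) (∑-⟦⟧ off? (cartesianProduct U U))) ⟩
        + length U + + length offDiagonal
          ≤⟨ +-mono-≤ (+≤+ class-count) (+≤+ (ℕ.≤-trans off-count kernel-count)) ⟩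
        + d + + d
          ≡⟨ double (+ d) ⟩
        + 2 * + d ∎
        where
        open ≤-Reasoning
        split : ∀ {P Q : Set} (x : Dec P) (y : Dec Q) → ⟦ y ⟧ ≤ ⟦ x ⟧ + ⟦ ¬? x ×-dec y ⟧
        split x@(yes _) y     = ≤-trans (⟦⟧≤1 y) (+-monoʳ-≤ 1ℤ (0≤⟦⟧ (¬? x ×-dec y)))
        split (no _)  (yes _) = ≤-refl
        split (no _)  (no _)  = ≤-refl
        diagonal : ∑[ l ∈ U ] ∑[ l′ ∈ U ] ⟦ l ℕ.≟ l′ ⟧ ≡ + length U
        diagonal = trans (∑-cong-∈ U λ l l∈ → trans (∑-single (λ l′ → ⟦ l ℕ.≟ l′ ⟧) U-unique l∈
            (λ l′ _ ne → ⟦⟧-no (l ℕ.≟ l′) λ eq → ne (sym eq))) (⟦⟧-yes (l ℕ.≟ l) refl))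
          (trans (∑-const U 1ℤ) (*-identityʳ (+ length U)))

-- Chebyshev's lower bound for the number of primes.

module Chebyshev where
  open import Data.Nat
  open import Data.Nat.Properties
  open import Data.Nat.Divisibility
  open import Data.Nat.DivMod using (_/_; m/n*n≤m; m≡m%n+[m/n]*n; m%n<n; /-monoˡ-≤)
  open import Data.Nat.Combinatorics using (_C_; nCk+nC[k+1]≡[n+1]C[k+1]; nC1≡n)
  open import Data.Nat.Induction using (<-rec)
  open import Data.Nat.ListAction using (product)
  open import Data.Nat.ListAction.Properties using (∈⇒∣product)
  open import Data.Nat.Logarithm using (⌊log₂_⌋; ⌊log₂⌋-mono-≤; ⌊log₂[2^n]⌋≡n)
  open import Data.Nat.Primality.Factorisation using (factorise)
  open import Data.Nat.Tactic.RingSolver using (solve-∀)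
  open import Data.List.Relation.Unary.All.Properties using (all-filter)

  private
    pascal : ∀ n k → suc n C suc k ≡ n C k + n C suc k
    pascal n k = sym (nCk+nC[k+1]≡[n+1]C[k+1] n k)

  absorption : ∀ n k → suc k * (suc n C suc k) ≡ suc n * (n C k)
  absorption zero    zero    = refl
  absorption zero    (suc k) = *-zeroʳ (suc (suc k))
  absorption (suc n) zero    = trans (*-identityˡ _) (trans (nC1≡n (suc (suc n))) (sym (*-identityʳ (suc (suc n)))))
  absorption (suc n) (suc k) = begin
    suc (suc k) * (suc (suc n) C suc (suc k))
      ≡⟨ cong (suc (suc k) *_) (pascal (suc n) (suc k)) ⟩
    suc (suc k) * (x + suc n C suc (suc k))
      ≡⟨ lem₁ (suc k) x (suc n C suc (suc k)) ⟩
    x + (suc k * x + suc (suc k) * (suc n C suc (suc k)))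
      ≡⟨ cong (x +_) (cong₂ _+_ (absorption n k) (absorption n (suc k))) ⟩
    x + (suc n * (n C k) + suc n * (n C suc k))
      ≡⟨ cong (x +_) (trans (sym (*-distribˡ-+ (suc n) (n C k) (n C suc k))) (cong (suc n *_) (sym (pascal n k)))) ⟩
    suc (suc n) * x ∎
    where
    open ≡-Reasoning
    x = suc n C suc k
    lem₁ : ∀ k x y → suc k * (x + y) ≡ x + (k * x + suc k * y)
    lem₁ = solve-∀

  upper-absorption : ∀ n k → suc n * (suc n C suc k) ≡ suc k * (suc n C suc k) + suc n * (n C suc k)
  upper-absorption n k = trans (cong (suc n *_) (pascal n k)) (trans (*-distribˡ-+ (suc n) (n C k) (n C suc k))
    (cong (_+ suc n * (n C suc k)) (sym (absorption n k))))

  -- Induction along the recurrence 1/((m+1) C(n,m+1)) = 1/(m C(n−1,m)) − 1/(m C(n,m)) of Leibniz' harmonic triangle.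
  leibniz : ∀ {D M} → (∀ k → 0 < k → k ≤ M → k ∣ D) → ∀ m n → suc m ≤ n → n ≤ M → suc m * (n C suc m) ∣ D
  leibniz all zero    n       0<n n≤M = subst (_∣ _) (sym (trans (*-identityˡ (n C 1)) (nC1≡n n))) (all n 0<n n≤M)
  leibniz {D} all (suc m) (suc n) (s≤s m≤n) n≤M = subst (_∣ D) (sym (absorption n (suc m)))
    (combine (leibniz all m n m≤n (≤-trans (n≤1+n n) n≤M)) (leibniz all m (suc n) (≤-trans m≤n (n≤1+n n)) n≤M))
    where
    a = n C suc m
    b = suc n C suc m
    lem₁ : ∀ m q n a → m * (q * (n * a)) ≡ n * (q * (m * a))
    lem₁ = solve-∀
    lem₂ : ∀ m q b na → m * (q * na) + m * (q * (m * b)) ≡ m * (q * (m * b + na))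
    lem₂ = solve-∀
    combine : suc m * a ∣ D → suc m * b ∣ D → suc n * a ∣ D
    combine (divides q e) (divides q′ e′) = ∣m+n∣m⇒∣n (subst (suc n * a ∣_) split (divides q refl)) (divides q′ refl)
      where
      open ≡-Reasoning
      -- This says that D/((n+1)a) is q - q′, the harmonic-triangle recurrence multiplied by D and
      -- written without subtraction.
      split : q * (suc n * a) ≡ q′ * (suc n * a) + D
      split = *-cancelˡ-≡ _ _ (suc m) (begin
        suc m * (q * (suc n * a))                              ≡⟨ lem₁ (suc m) q (suc n) a ⟩
        suc n * (q * (suc m * a))                              ≡⟨ cong (suc n *_) (trans (sym e) e′) ⟩
        suc n * (q′ * (suc m * b))                             ≡⟨ lem₁ (suc m) q′ (suc n) b ⟨
        suc m * (q′ * (suc n * b))                             ≡⟨ cong (λ t → suc m * (q′ * t)) (upper-absorption n m) ⟩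
        suc m * (q′ * (suc m * b + suc n * a))                 ≡⟨ lem₂ (suc m) q′ b (suc n * a) ⟨
        suc m * (q′ * (suc n * a)) + suc m * (q′ * (suc m * b)) ≡⟨ cong (λ t → suc m * (q′ * (suc n * a)) + suc m * t) (sym e′) ⟩
        suc m * (q′ * (suc n * a)) + suc m * D                 ≡⟨ *-distribˡ-+ (suc m) (q′ * (suc n * a)) D ⟨
        suc m * (q′ * (suc n * a) + D)                         ∎)

  -- C(2n+2, n+1) is the sum of C(2n+1, n) and C(2n+1, n+1), each of which is at least C(2n, n).
  central-binomial : ∀ n → 2 ^ n ≤ (n + n) C n
  central-binomial zero    = ≤-refl
  central-binomial (suc n) = begin
    2 ^ n + (2 ^ n + 0)                        ≡⟨ cong (2 ^ n +_) (+-identityʳ (2 ^ n)) ⟩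
    2 ^ n + 2 ^ n                              ≤⟨ +-mono-≤ (≤-trans (central-binomial n) below) (≤-trans (central-binomial n) above) ⟩
    suc (n + n) C n + suc (n + n) C suc n      ≡⟨ pascal (suc (n + n)) n ⟨
    suc (suc (n + n)) C suc n                  ≡⟨ cong (λ t → suc t C suc n) (+-suc n n) ⟨
    suc (n + suc n) C suc n                    ∎
    where
    open ≤-Reasoning
    above : (n + n) C n ≤ suc (n + n) C suc n
    above = ≤-trans (m≤m+n _ _) (≤-reflexive (sym (pascal (n + n) n)))
    below : (n + n) C n ≤ suc (n + n) C n
    below = grow n
      where
      grow : ∀ k → (n + n) C k ≤ suc (n + n) C k
      grow zero    = ≤-refl
      grow (suc k) = ≤-trans (m≤n+m _ _) (≤-reflexive (sym (pascal (n + n) k)))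

  coprime-* : ∀ {a b m} → Coprime a m → Coprime b m → Coprime (a * b) m
  coprime-* ca cb {d} (d∣ab , d∣m) = cb (coprime-divisor (λ { (e∣d , e∣a) → ca (e∣a , ∣-trans e∣d d∣m) }) d∣ab , d∣m)

  prime-coprime : ∀ {ℓ m} → Prime ℓ → ¬ ℓ ∣ m → Coprime ℓ m
  prime-coprime pr ℓ∤m (d∣ℓ , d∣m) with prime⇒irreducible pr d∣ℓ
  ... | inj₁ d≡1 = d≡1
  ... | inj₂ refl = contradiction d∣m ℓ∤m

  coprime-^ : ∀ {a m} → Coprime a m → ∀ k → Coprime (a ^ k) m
  coprime-^ c zero    = Coprime.1-coprimeTo _
  coprime-^ c (suc k) = coprime-* c (coprime-^ c k)

  coprime-∣ : ∀ {a b D} → Coprime a b → a ∣ D → b ∣ D → a * b ∣ D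
  coprime-∣ {a} {b} c a∣D (divides q refl) = subst (_∣ q * b) (*-comm b a)
    (subst (b * a ∣_) (*-comm b q) (*-monoʳ-∣ b (coprime-divisor c (subst (a ∣_) (*-comm q b) a∣D))))

  split-power : ∀ {ℓ} → Prime ℓ → ∀ k → 0 < k → ∃₂ λ α m → k ≡ ℓ ^ α * m × ¬ ℓ ∣ m × 0 < m
  split-power {ℓ} pr = <-rec _ step
    where
    step : ∀ k → (∀ {j} → j < k → 0 < j → ∃₂ λ α m → j ≡ ℓ ^ α * m × ¬ ℓ ∣ m × 0 < m) →
           0 < k → ∃₂ λ α m → k ≡ ℓ ^ α * m × ¬ ℓ ∣ m × 0 < m
    step k rec 0<k with ℓ ∣? k
    ... | no ℓ∤k = 0 , k , sym (*-identityˡ k) , ℓ∤k , 0<k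
    ... | yes (divides zero e) = contradiction (subst (0 <_) e 0<k) (<-irrefl refl)
    ... | yes (divides c@(suc _) e) =
      let (α , m , e′ , ℓ∤m , 0<m) = rec (subst (c <_) (sym e) (m<m*n c ℓ (nonTrivial⇒n>1 ℓ {{prime⇒nonTrivial pr}}))) z<s in
      suc α , m , trans e (trans (cong (_* ℓ) e′) (trans (*-comm _ ℓ) (sym (*-assoc ℓ (ℓ ^ α) m)))) , ℓ∤m , 0<m

  -- The largest power of ℓ up to M with exponent at most the fuel. Fuel M suffices for primes,
  -- since α < 2^α ≤ ℓ^α ≤ M.
  maxPower : (M ℓ fuel : ℕ) → ℕ
  maxPower M ℓ zero       = 1
  maxPower M ℓ (suc fuel) with ℓ ^ suc fuel ≤? M
  ... | yes _ = ℓ ^ suc fuel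
  ... | no _  = maxPower M ℓ fuel

  maxPower≤ : ∀ {M} ℓ fuel → 0 < M → maxPower M ℓ fuel ≤ M
  maxPower≤ ℓ zero 0<M = 0<M
  maxPower≤ {M} ℓ (suc fuel) 0<M with ℓ ^ suc fuel ≤? M
  ... | yes le = le
  ... | no _   = maxPower≤ ℓ fuel 0<M

  0<maxPower : ∀ M {ℓ} fuel .{{_ : NonZero ℓ}} → 0 < maxPower M ℓ fuel
  0<maxPower M zero = z<s
  0<maxPower M {ℓ} (suc fuel) with ℓ ^ suc fuel ≤? M
  ... | yes _ = m^n>0 ℓ (suc fuel)
  ... | no _  = 0<maxPower M fuel

  ^∣maxPower : ∀ {M} ℓ fuel α → ℓ ^ α ≤ M → α ≤ fuel → ℓ ^ α ∣ maxPower M ℓ fuel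
  ^∣maxPower ℓ zero zero le z≤n = ∣-refl
  ^∣maxPower {M} ℓ (suc fuel) α le α≤ with ℓ ^ suc fuel ≤? M
  ... | yes _ = subst (ℓ ^ α ∣_) (trans (sym (^-distribˡ-+-* ℓ α (suc fuel ∸ α))) (cong (ℓ ^_) (m+[n∸m]≡n α≤))) (m∣m*n _)
  ... | no n  = ^∣maxPower ℓ fuel α le (<⇒≤pred (≤∧≢⇒< α≤ λ { refl → n le }))

  primesBelow : ℕ → List ℕ
  primesBelow N = filter prime? (upTo N)

  private
    module _ (M : ℕ) (0<M : 0 < M) where

      -- Their product plays the role of lcm(1,...,M): a common multiple that is at most M to the
      -- number of primes up to M.
      powers : List ℕ
      powers = map (λ ℓ → maxPower M ℓ M) (primesBelow (suc M))

      powers-product : ∀ ls → product (map (λ ℓ → maxPower M ℓ M) ls) ≤ M ^ length ls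
      powers-product []       = ≤-refl
      powers-product (ℓ ∷ ls) = *-mono-≤ (maxPower≤ ℓ M 0<M) (powers-product ls)

      n<2^n : ∀ n → n < 2 ^ n
      n<2^n zero    = z<s
      n<2^n (suc n) = ≤-trans (+-mono-≤ (m^n>0 2 n) (n<2^n n)) (+-monoʳ-≤ (2 ^ n) (m≤m+n (2 ^ n) 0))

      prime-power∣ : ∀ {ℓ} → Prime ℓ → ∀ α → ℓ ≤ M → ℓ ^ α ≤ M → ℓ ^ α ∣ product powers
      prime-power∣ {ℓ} pr α ℓ≤M le = ∣-trans
        (^∣maxPower ℓ M α le (≤-trans (<⇒≤ (n<2^n α)) (≤-trans (^-monoˡ-≤ α (nonTrivial⇒n>1 ℓ {{prime⇒nonTrivial pr}})) le)))
        (∈⇒∣product (∈-map⁺ (λ ℓ → maxPower M ℓ M) (∈-filter⁺ prime? (∈-upTo⁺ (s≤s ℓ≤M)) pr)))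

      prime-divisor : ∀ k → 1 < k → ∃ λ ℓ → Prime ℓ × ℓ ∣ k
      prime-divisor k 1<k with factorise k {{>-nonZero (<-trans z<s 1<k)}}
      ... | record { factors = [] ; isFactorisation = e } = contradiction 1<k (<-irrefl (sym e))
      ... | record { factors = ℓ ∷ ls ; isFactorisation = e ; factorsPrime = pr ∷ _ } = ℓ , pr , subst (ℓ ∣_) (sym e) (m∣m*n (product ls))

      -- Split off the full power of one prime divisor. It divides the product by construction, the
      -- smaller cofactor does so by induction, and the two are coprime.
      all-divide : ∀ k → 0 < k → k ≤ M → k ∣ product powers
      all-divide = <-rec _ step
        where
        step : ∀ k → (∀ {j} → j < k → 0 < j → j ≤ M → j ∣ product powers) → 0 < k → k ≤ M → k ∣ product powers
        step (suc zero)      rec 0<k k≤M = 1∣ _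
        step k@(suc (suc _)) rec 0<k k≤M = go (prime-divisor k (s≤s z<s))
          where
          go : (∃ λ ℓ → Prime ℓ × ℓ ∣ k) → k ∣ product powers
          go (ℓ , pr , ℓ∣k) with split-power pr k 0<k
          ... | zero  , m , e , ℓ∤m , 0<m = contradiction (subst (ℓ ∣_) (trans e (*-identityˡ m)) ℓ∣k) ℓ∤m
          ... | suc α , m , e , ℓ∤m , 0<m = subst (_∣ product powers) (sym e)
            (coprime-∣ (coprime-^ (prime-coprime pr ℓ∤m) (suc α))
              (prime-power∣ pr (suc α) (≤-trans (∣⇒≤ ℓ∣k) k≤M) (≤-trans (subst (ℓ ^ suc α ≤_) (sym e) (m≤m*n _ m {{>-nonZero 0<m}})) k≤M))
              (rec m<k 0<m (≤-trans (<⇒≤ m<k) k≤M)))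
            where
            1<ℓ^ : 1 < ℓ ^ suc α
            1<ℓ^ = <-≤-trans (nonTrivial⇒n>1 ℓ {{prime⇒nonTrivial pr}}) (m≤m*n ℓ (ℓ ^ α) {{m^n≢0 ℓ α {{prime⇒nonZero pr}}}})
            m<k : m < k
            m<k = subst (m <_) (trans (*-comm m (ℓ ^ suc α)) (sym e)) (m<m*n m (ℓ ^ suc α) {{>-nonZero 0<m}} 1<ℓ^)

      product-positive : 0 < product powers
      product-positive = positive (all-filter prime? (upTo (suc M)))
        where
        positive : ∀ {ls} → All Prime ls → 0 < product (map (λ ℓ → maxPower M ℓ M) ls)
        positive []         = z<s
        positive (pr ∷ prs) = *-mono-≤ (0<maxPower M M {{prime⇒nonZero pr}}) (positive prs)

  <2^log : ∀ N → N < 2 ^ suc ⌊log₂ N ⌋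
  <2^log N = ≰⇒> λ le → <-irrefl refl (≤-trans (≤-reflexive (sym (⌊log₂[2^n]⌋≡n (suc ⌊log₂ N ⌋)))) (⌊log₂⌋-mono-≤ le))

  2^-cancel-≤ : ∀ {m n} → 2 ^ m ≤ 2 ^ n → m ≤ n
  2^-cancel-≤ {m} {n} le = ≮⇒≥ λ n<m → <⇒≱ (^-monoʳ-< 2 (s≤s (s≤s z≤n)) n<m) le

  1≤log : ∀ {N} → 2 ≤ N → 1 ≤ ⌊log₂ N ⌋
  1≤log 2≤N = ⌊log₂⌋-mono-≤ 2≤N

  -- With n = ⌊M/2⌋, the multiple n C(2n, n) of a number at least 2^n divides a number at most M^π ≤
  -- 2^((L+1)π), so n ≤ (L+1)π. The constant 8 comes from N ≤ 4n and L + 1 ≤ 2L.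
  chebyshev : ∀ N → 3 ≤ N → N ≤ 8 * (⌊log₂ N ⌋ * length (primesBelow N))
  chebyshev (suc M) (s≤s 2≤M) = begin
    suc M                    ≤⟨ s≤s M≤ ⟩
    suc (1 + n * 2)          ≤⟨ +-monoˡ-≤ (n * 2) (*-monoˡ-≤ 2 1≤n) ⟩
    n * 2 + n * 2            ≡⟨ lem₁ n ⟩
    4 * n                    ≤⟨ *-monoʳ-≤ 4 n≤ ⟩
    4 * (suc L * π)          ≤⟨ *-monoʳ-≤ 4 (*-monoˡ-≤ π (+-monoˡ-≤ L (1≤log {suc M} (s≤s (≤-trans (s≤s z≤n) 2≤M))))) ⟩
    4 * ((L + L) * π)        ≡⟨ lem₂ L π ⟩
    8 * (L * π)              ∎
    where
    open ≤-Reasoning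
    n = M / 2
    L = ⌊log₂ suc M ⌋
    π = length (primesBelow (suc M))
    0<M = ≤-trans (s≤s z≤n) 2≤M
    M≤ : M ≤ 1 + n * 2
    M≤ = ≤-trans (≤-reflexive (m≡m%n+[m/n]*n M 2)) (+-monoˡ-≤ (n * 2) (≤-pred (m%n<n M 2)))
    1≤n : 1 ≤ n
    1≤n = /-monoˡ-≤ 2 2≤M
    lem₁ : ∀ n → n * 2 + n * 2 ≡ 4 * n
    lem₁ = solve-∀
    lem₂ : ∀ L π → 4 * ((L + L) * π) ≡ 8 * (L * π)
    lem₂ = solve-∀
    D = product (powers M 0<M)
    2n≤M : n + n ≤ M
    2n≤M = ≤-trans (≤-reflexive (trans (cong (n +_) (sym (+-identityʳ n))) (*-comm 2 n))) (m/n*n≤m M 2)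
    n*C∣D : ∀ n → 1 ≤ n → n + n ≤ M → n * ((n + n) C n) ∣ D
    n*C∣D (suc n) _ le = leibniz (all-divide M 0<M) n (suc n + suc n) (m≤m+n (suc n) (suc n)) le
    n≤ : n ≤ suc L * π
    n≤ = 2^-cancel-≤ (begin
      2 ^ n                    ≤⟨ central-binomial n ⟩
      (n + n) C n              ≤⟨ m≤n*m ((n + n) C n) n {{>-nonZero 1≤n}} ⟩
      n * ((n + n) C n)        ≤⟨ ∣⇒≤ {{>-nonZero (product-positive M 0<M)}} (n*C∣D n 1≤n 2n≤M) ⟩
      D                        ≤⟨ powers-product M 0<M (primesBelow (suc M)) ⟩
      M ^ π                    ≤⟨ ^-monoˡ-≤ π (≤-trans (n≤1+n M) (<⇒≤ (<2^log (suc M)))) ⟩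
      (2 ^ suc L) ^ π          ≡⟨ ^-*-assoc 2 (suc L) π ⟩
      2 ^ (suc L * π)          ∎)

-- A positive proportion of the pairs in a box is coprime.

module CoprimePairs where
  open ListSum
  open import Data.Nat.GCD using (gcd; gcd[m,n]∣m; gcd[m,n]∣n; gcd[m,n]≢0)
  open import Data.Integer hiding (suc)
  open import Data.Integer.Properties hiding (_≟_)
  open import Data.Integer.Tactic.RingSolver using (solve-∀)

  range : ℕ → List ℕ
  range n = applyUpTo suc n

  range-unique : ∀ n → Unique (range n)
  range-unique n = Unique.applyUpTo⁺₁ suc n λ i<j _ e → ℕ.<⇒≢ i<j (ℕ.suc-injective e)

  ∈-range⁻ : ∀ {n i} → i ∈ range n → 0 ℕ.< i × i ℕ.≤ n
  ∈-range⁻ i∈ with ∈-applyUpTo⁻ suc i∈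
  ... | j , j<n , refl = ℕ.s≤s ℕ.z≤n , j<n

  ∈-range⁺ : ∀ {n i} → 0 ℕ.< i → i ℕ.≤ n → i ∈ range n
  ∈-range⁺ {i = suc i} _ i<n = ∈-applyUpTo⁺ suc i<n

  coprimePairs : ℕ → ℕ → List (ℕ × ℕ)
  coprimePairs A V = filter (λ r → coprime? (proj₁ r) (proj₂ r)) (cartesianProduct (range A) (range V))

  coprimePairs-unique : ∀ A V → Unique (coprimePairs A V)
  coprimePairs-unique A V = Unique.filter⁺ (λ r → coprime? (proj₁ r) (proj₂ r)) (Unique.cartesianProduct⁺ (range-unique A) (range-unique V))

  ∈-coprimePairs⁻ : ∀ {A V a v} → (a , v) ∈ coprimePairs A V → (0 ℕ.< a × a ℕ.≤ A) × (0 ℕ.< v × v ℕ.≤ V) × Coprime a v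
  ∈-coprimePairs⁻ {A} {V} r∈ =
    let (r∈′ , c) = ∈-filter⁻ (λ r → coprime? (proj₁ r) (proj₂ r)) {xs = cartesianProduct (range A) (range V)} r∈
        (a∈ , v∈) = ∈-cartesianProduct⁻ (range A) (range V) r∈′
    in ∈-range⁻ a∈ , ∈-range⁻ v∈ , c

  private
    multiples : ℕ → ℕ → ℤ
    multiples k n = ∑[ i ∈ range n ] ⟦ k ℕ.∣? i ⟧

    multiples-bound : ∀ k .{{_ : ℕ.NonZero k}} n → + k * multiples k n ≤ + n
    multiples-bound k n = begin
      + k * multiples k n             ≡⟨ cong (+ k *_) (∑-⟦⟧ (k ℕ.∣?_) (range n)) ⟩
      + k * + length ms               ≡⟨ pos-* k (length ms) ⟨
      + (k ℕ.* length ms)             ≤⟨ +≤+ (ℕ.*-monoʳ-≤ k (ℕ.≤-trans (length-injection (ℕ._/ k) unique injective into)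
                                                               (ℕ.≤-reflexive (length-applyUpTo suc (n ℕ./ k))))) ⟩
      + (k ℕ.* (n ℕ./ k))             ≤⟨ +≤+ (ℕ.≤-trans (ℕ.≤-reflexive (ℕ.*-comm k (n ℕ./ k))) (ℕ.m/n*n≤m n k)) ⟩
      + n                             ∎
      where
      open ≤-Reasoning
      ms = filter (k ℕ.∣?_) (range n)
      unique : Unique ms
      unique = Unique.filter⁺ (k ℕ.∣?_) (range-unique n)
      ∈ms : ∀ {i} → i ∈ ms → (0 ℕ.< i × i ℕ.≤ n) × k ℕ.∣ i
      ∈ms i∈ = let (i∈′ , d) = ∈-filter⁻ (k ℕ.∣?_) {xs = range n} i∈ in ∈-range⁻ i∈′ , d
      injective : ∀ {i j} → i ∈ ms → j ∈ ms → i ℕ./ k ≡ j ℕ./ k → i ≡ j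
      injective i∈ j∈ e = trans (sym (ℕ.m/n*n≡m (proj₂ (∈ms i∈)))) (trans (cong (ℕ._* k) e) (ℕ.m/n*n≡m (proj₂ (∈ms j∈))))
      into : ∀ {i} → i ∈ ms → i ℕ./ k ∈ range (n ℕ./ k)
      into {i} i∈ = let ((0<i , i≤n) , d) = ∈ms i∈ in
        ∈-range⁺ (ℕ.m≥n⇒m/n>0 (ℕ.∣⇒≤ {{ℕ.>-nonZero 0<i}} d)) (ℕ./-monoˡ-≤ k i≤n)

    0≤multiples : ∀ k n → 0ℤ ≤ multiples k n
    0≤multiples k n = ∑-nonneg (range n) λ i → 0≤⟦⟧ (k ℕ.∣? i)

    -- Telescoping with 1/k² ≤ 1/(k−1) − 1/k for k ≥ 3, and 1/4 for k = 2.
    ∑-inverse-squares : (t : ℕ → ℤ) (X : ℤ) → 0ℤ ≤ X → (∀ j → 0ℤ ≤ t j) → (∀ j → + (2 ℕ.+ j) * + (2 ℕ.+ j) * t j ≤ X) →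
                        ∀ n → + 4 * ∑ (downFrom n) t ≤ + 3 * X
    ∑-inverse-squares t X 0≤X 0≤t bound zero = *-monoˡ-≤-nonNeg (+ 3) 0≤X
    ∑-inverse-squares t X 0≤X 0≤t bound (suc n) = *-cancelˡ-≤-pos _ _ (+ (2 ℕ.+ n)) (begin
      K n * (+ 4 * S (suc n))               ≡⟨ +-identityʳ _ ⟨
      K n * (+ 4 * S (suc n)) + 0ℤ          ≤⟨ +-monoʳ-≤ (K n * (+ 4 * S (suc n))) (*-monoˡ-≤-nonNeg (+ 4) 0≤X) ⟩
      K n * (+ 4 * S (suc n)) + + 4 * X     ≤⟨ strong n ⟩
      K n * (+ 3 * X)                       ∎)
      where
      open ≤-Reasoning
      S : ℕ → ℤ
      S n = ∑ (downFrom n) t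
      K : ℕ → ℤ
      K n = + (2 ℕ.+ n)
      strong : ∀ n → K n * (+ 4 * S (suc n)) + + 4 * X ≤ K n * (+ 3 * X)
      strong zero = begin
        + 2 * (+ 4 * (t 0 + 0ℤ)) + + 4 * X      ≡⟨ lem (t 0) X ⟩
        + 2 * (+ 2 * + 2 * t 0) + + 4 * X       ≤⟨ +-monoˡ-≤ (+ 4 * X) (*-monoˡ-≤-nonNeg (+ 2) (bound 0)) ⟩
        + 2 * X + + 4 * X                       ≡⟨ lem₂ X ⟩
        + 2 * (+ 3 * X)                         ∎
        where
        lem : ∀ t X → + 2 * (+ 4 * (t + 0ℤ)) + + 4 * X ≡ + 2 * (+ 2 * + 2 * t) + + 4 * X
        lem = solve-∀
        lem₂ : ∀ X → + 2 * X + + 4 * X ≡ + 2 * (+ 3 * X)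
        lem₂ = solve-∀
      strong (suc n) = *-cancelˡ-≤-pos _ _ (K n) (begin
        K n * (K (suc n) * (+ 4 * (t (suc n) + S (suc n))) + + 4 * X)
          ≡⟨ lem₁ (K n) (t (suc n)) (S (suc n)) X ⟩
        (1ℤ + K n) * (K n * (+ 4 * S (suc n)) + + 4 * X) + + 4 * (K n * (1ℤ + K n) * t (suc n)) - + 4 * X
          ≤⟨ +-monoˡ-≤ (- (+ 4 * X)) (+-mono-≤ (*-monoˡ-≤-nonNeg (K (suc n)) (strong n)) (*-monoˡ-≤-nonNeg (+ 4) small)) ⟩
        (1ℤ + K n) * (K n * (+ 3 * X)) + + 4 * X - + 4 * X
          ≡⟨ lem₂ (K n) X ⟩
        K n * (K (suc n) * (+ 3 * X)) ∎)
        where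
        lem₁ : ∀ k t S X → k * ((1ℤ + k) * (+ 4 * (t + S)) + + 4 * X)
                         ≡ (1ℤ + k) * (k * (+ 4 * S) + + 4 * X) + + 4 * (k * (1ℤ + k) * t) - + 4 * X
        lem₁ = solve-∀
        lem₂ : ∀ k X → (1ℤ + k) * (k * (+ 3 * X)) + + 4 * X - + 4 * X ≡ k * ((1ℤ + k) * (+ 3 * X))
        lem₂ = solve-∀
        small : K n * (1ℤ + K n) * t (suc n) ≤ X
        small = ≤-trans (*-monoʳ-≤-nonNeg (t (suc n)) {{nonNegative (0≤t (suc n))}}
          (*-monoʳ-≤-nonNeg (K (suc n)) {K n} {K (suc n)} (+≤+ (ℕ.n≤1+n (2 ℕ.+ n))))) (bound (suc n))

    -- The offset 2 leaves out the trivial common divisor 1.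
    common : ℕ → ℕ → ℕ → ℤ
    common a v j = ⟦ (2 ℕ.+ j) ℕ.∣? a ⟧ * ⟦ (2 ℕ.+ j) ℕ.∣? v ⟧

    0≤common : ∀ a v j → 0ℤ ≤ common a v j
    0≤common a v j = 0≤⟦⟧*⟦⟧ ((2 ℕ.+ j) ℕ.∣? a) ((2 ℕ.+ j) ℕ.∣? v)

    -- The gcd itself, when it is at least 2, is one of the divisors on the right; it is in range
    -- because it is at most a.
    cover : ∀ A {a v} → 0 ℕ.< a → a ℕ.≤ A → 1ℤ ≤ ⟦ coprime? a v ⟧ + ∑ (downFrom A) (common a v)
    cover A {a} {v} 0<a a≤A = split (coprime? a v)
      where
      split : (d : Dec (Coprime a v)) → 1ℤ ≤ ⟦ d ⟧ + ∑ (downFrom A) (common a v)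
      split (yes _) = ≤-trans (≤-reflexive (sym (+-identityʳ 1ℤ))) (+-monoʳ-≤ 1ℤ (∑-nonneg (downFrom A) (0≤common a v)))
      split (no ¬c) = ≤-trans (from-gcd (gcd a v) refl) (≤-reflexive (sym (+-identityˡ _)))
        where
        from-gcd : ∀ k → gcd a v ≡ k → 1ℤ ≤ ∑ (downFrom A) (common a v)
        from-gcd zero          e = contradiction e (gcd[m,n]≢0 a v (inj₁ (λ e → ℕ.<⇒≢ 0<a (sym e))))
        from-gcd (suc zero)    e = contradiction (λ {i} → gcd≡1⇒coprime e {i}) ¬c
        from-gcd (suc (suc j)) e = ≤-trans (≤-reflexive (sym (cong₂ _*_ (⟦⟧-yes ((2 ℕ.+ j) ℕ.∣? a) ∣a) (⟦⟧-yes ((2 ℕ.+ j) ℕ.∣? v) ∣v))))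
          (∑-member (common a v) (0≤common a v) (∈-downFrom⁺ (ℕ.<-≤-trans (ℕ.n≤1+n (suc j)) (ℕ.≤-trans (ℕ.∣⇒≤ {{ℕ.>-nonZero 0<a}} ∣a) a≤A))))
          where
          ∣a : (2 ℕ.+ j) ℕ.∣ a
          ∣a = subst (ℕ._∣ a) e (gcd[m,n]∣m a v)
          ∣v : (2 ℕ.+ j) ℕ.∣ v
          ∣v = subst (ℕ._∣ v) e (gcd[m,n]∣n a v)

  -- At most AV/k² pairs share the divisor k, and the reciprocal squares from k = 2 on add up to at
  -- most 1/4 + 1/2. As 3/4 < 1, a union bound over all k, prime or not, is enough.
  coprimePairs-count : ∀ A V → A ℕ.* V ℕ.≤ 4 ℕ.* length (coprimePairs A V)
  coprimePairs-count A V = drop‿+≤+ (subst₂ _≤_ (sym (pos-* A V)) (sym (pos-* 4 (length (coprimePairs A V)))) (finish (begin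
    + A * + V
      ≡⟨ size ⟨
    ∑[ r ∈ box ] 1ℤ
      ≤⟨ ∑-mono box (λ { (a , v) r∈ → let (a∈ , _) = ∈-cartesianProduct⁻ (range A) (range V) r∈ ; (0<a , a≤A) = ∈-range⁻ a∈ in cover A {a} {v} 0<a a≤A }) ⟩
    ∑[ r ∈ box ] (⟦ coprime? (proj₁ r) (proj₂ r) ⟧ + ∑ (downFrom A) (common (proj₁ r) (proj₂ r)))
      ≡⟨ ∑-distrib-+ box (λ r → ⟦ coprime? (proj₁ r) (proj₂ r) ⟧) (λ r → ∑ (downFrom A) (common (proj₁ r) (proj₂ r))) ⟩
    (∑[ r ∈ box ] ⟦ coprime? (proj₁ r) (proj₂ r) ⟧) + (∑[ r ∈ box ] ∑ (downFrom A) (common (proj₁ r) (proj₂ r)))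
      ≡⟨ cong₂ _+_ (∑-⟦⟧ (λ r → coprime? (proj₁ r) (proj₂ r)) box) (trans (∑-swap box (downFrom A) (λ r → common (proj₁ r) (proj₂ r))) (∑-cong (downFrom A) factor)) ⟩
    J + (∑[ j ∈ downFrom A ] t j) ∎)))
    where
    open ≤-Reasoning
    box = cartesianProduct (range A) (range V)
    J = + length (coprimePairs A V)
    t : ℕ → ℤ
    t j = multiples (2 ℕ.+ j) A * multiples (2 ℕ.+ j) V
    one : ∀ n → ∑[ i ∈ range n ] 1ℤ ≡ + n
    one n = trans (∑-const (range n) 1ℤ) (trans (*-identityʳ _) (cong +_ (length-applyUpTo suc n)))
    size : ∑[ r ∈ box ] 1ℤ ≡ + A * + V
    size = trans (∑-cartesianProduct (range A) (range V) (λ _ → 1ℤ)) (trans (∑-cong (range A) λ _ → one V)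
      (trans (∑-const (range A) (+ V)) (cong (λ l → + l * + V) (length-applyUpTo suc A))))
    factor : ∀ j → ∑[ r ∈ box ] common (proj₁ r) (proj₂ r) j ≡ t j
    factor j = trans (∑-cartesianProduct (range A) (range V) (λ r → common (proj₁ r) (proj₂ r) j))
      (sym (∑-* (range A) (range V) (λ a → ⟦ (2 ℕ.+ j) ℕ.∣? a ⟧) (λ v → ⟦ (2 ℕ.+ j) ℕ.∣? v ⟧)))
    t-bound : ∀ j → + (2 ℕ.+ j) * + (2 ℕ.+ j) * t j ≤ + A * + V
    t-bound j = begin
      k * k * (m * m′)          ≡⟨ lem k m m′ ⟩
      k * m * (k * m′)          ≤⟨ *-monoˡ-≤-nonNeg (k * m) {{nonNegative (0≤* {k} (+≤+ ℕ.z≤n) (0≤multiples (2 ℕ.+ j) A))}} (multiples-bound (2 ℕ.+ j) V) ⟩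
      k * m * + V               ≤⟨ *-monoʳ-≤-nonNeg (+ V) (multiples-bound (2 ℕ.+ j) A) ⟩
      + A * + V                 ∎
      where
      k = + (2 ℕ.+ j)
      m = multiples (2 ℕ.+ j) A
      m′ = multiples (2 ℕ.+ j) V
      lem : ∀ k m n → k * k * (m * n) ≡ k * m * (k * n)
      lem = solve-∀
    ∑t : + 4 * ∑ (downFrom A) t ≤ + 3 * (+ A * + V)
    ∑t = ∑-inverse-squares t (+ A * + V) (0≤* {+ A} {+ V} (+≤+ ℕ.z≤n) (+≤+ ℕ.z≤n))
           (λ j → 0≤* (0≤multiples (2 ℕ.+ j) A) (0≤multiples (2 ℕ.+ j) V)) t-bound A
    finish : + A * + V ≤ J + ∑ (downFrom A) t → + A * + V ≤ + 4 * J
    finish le = begin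
      X                                         ≡⟨ lem₁ X ⟩
      + 4 * X - + 3 * X                         ≤⟨ +-mono-≤ (*-monoˡ-≤-nonNeg (+ 4) le) (neg-mono-≤ ∑t) ⟩
      + 4 * (J + ∑ (downFrom A) t) - + 4 * ∑ (downFrom A) t ≡⟨ lem₂ J (∑ (downFrom A) t) ⟩
      + 4 * J                                   ∎
      where
      X = + A * + V
      lem₁ : ∀ X → X ≡ + 4 * X - + 3 * X
      lem₁ = solve-∀
      lem₂ : ∀ J s → + 4 * (J + s) - + 4 * s ≡ + 4 * J
      lem₂ = solve-∀

-- The hypothesis makes the main term exceed the error term.

module Arithmetic where
  open import Data.Nat
  open import Data.Nat.Properties
  open import Data.Nat.Tactic.RingSolver using (solve-∀)

  ^-distribʳ-* : ∀ a b k → (a * b) ^ k ≡ a ^ k * b ^ k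
  ^-distribʳ-* a b zero    = refl
  ^-distribʳ-* a b (suc k) = trans (cong (a * b *_) (^-distribʳ-* a b k)) (lem a b (a ^ k) (b ^ k))
    where
    lem : ∀ a b x y → a * b * (x * y) ≡ a * x * (b * y)
    lem = solve-∀

  ^-swap : ∀ a m k → (a ^ m) ^ k ≡ (a ^ k) ^ m
  ^-swap a m k = trans (^-*-assoc a m k) (trans (cong (a ^_) (*-comm m k)) (sym (^-*-assoc a k m)))

  0<* : ∀ {a b} → 0 < a → 0 < b → 0 < a * b
  0<* = *-mono-≤

  0<^ : ∀ {a} k → 0 < a → 0 < a ^ k
  0<^ {a} k 0<a = m^n>0 a {{>-nonZero 0<a}} k

  isqrt : ∀ n → ∃ λ b → b * b ≤ n × n < suc b * suc b
  isqrt zero    = 0 , z≤n , s≤s z≤n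
  isqrt (suc n) with isqrt n
  ... | b , lo , hi with suc b * suc b ≤? suc n
  ...   | yes le = suc b , le , ≤-<-trans hi (*-mono-< (n<1+n (suc b)) (n<1+n (suc b)))
  ...   | no gt  = b , ≤-trans lo (n≤1+n n) , ≰⇒> gt

  -- Abstract, since multiplication by these literals must not unfold.
  abstract
    c₀ c₁ : ℕ
    c₀ = 8 ^ 16
    c₁ = 4 * 72 * 72

    c₀-power : ∀ x → (8 * x) ^ 16 ≡ c₀ * x ^ 16
    c₀-power x = ^-distribʳ-* 8 x 16

    c₁-product : ∀ y → 72 * y * (72 * y) * 4 ≡ c₁ * (y * y)
    c₁-product = solve-∀

  -- 8^16 in `c₀` comes from Chebyshev's 8 and 4·72² in `c₁` from p ≤ 4B² and N² ≤ 72JB. The factor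
  -- 256 is the square of 2⁴ from E ≤ 2d, and 16 is the square of the 4 in the bound for Λ.
  constant : ℕ → ℕ
  constant k = c₀ * 256 * (c₁ * 16) ^ k

  -- The first summand serves the comparison of main term and error, the second forces N² ≥ 16p; the
  -- successor makes both comparisons strict.
  threshold : ℕ → ℕ
  threshold k = suc (constant k + 16 ^ (2 * k + 8))

  module _ {k p N d L : ℕ} (0<p : 0 < p) (0<L : 0 < L)
    (hyp : threshold k * p ^ (11 * k + 24) * L ^ 16 ≤ d ^ (8 * suc k) * N ^ (4 * k + 16)) where

    private
      strictly : ∀ c → c < threshold k → c * p ^ (11 * k + 24) * L ^ 16 < d ^ (8 * suc k) * N ^ (4 * k + 16)
      strictly c lt = <-≤-trans (*-monoˡ-< (L ^ 16) {{>-nonZero (0<^ 16 0<L)}} (*-monoˡ-< (p ^ (11 * k + 24)) {{>-nonZero (0<^ (11 * k + 24) 0<p)}} lt)) hyp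

    -- If N² < 16p, then by d ≤ p the right side of the hypothesis is at most 16^(2k+8) p^(10k+16),
    -- too small for the left side.
    N-large : d ≤ p → 16 * p ≤ N * N
    N-large d≤p = ≮⇒≥ λ small → <⇒≱ (strictly (16 ^ (2 * k + 8)) (s≤s (m≤n+m (16 ^ (2 * k + 8)) (constant k)))) (begin
      d ^ (8 * suc k) * N ^ (4 * k + 16)                        ≤⟨ *-monoˡ-≤ (N ^ (4 * k + 16)) (^-monoˡ-≤ (8 * suc k) d≤p) ⟩
      p ^ (8 * suc k) * N ^ (4 * k + 16)                        ≡⟨ cong (p ^ (8 * suc k) *_) N-power ⟩
      p ^ (8 * suc k) * (N * N) ^ (2 * k + 8)                   ≤⟨ *-monoʳ-≤ (p ^ (8 * suc k)) (^-monoˡ-≤ (2 * k + 8) (<⇒≤ small)) ⟩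
      p ^ (8 * suc k) * (16 * p) ^ (2 * k + 8)                  ≡⟨ cong (p ^ (8 * suc k) *_) (^-distribʳ-* 16 p (2 * k + 8)) ⟩
      p ^ (8 * suc k) * (16 ^ (2 * k + 8) * p ^ (2 * k + 8))    ≡⟨ comm (p ^ (8 * suc k)) (16 ^ (2 * k + 8)) (p ^ (2 * k + 8)) ⟩
      16 ^ (2 * k + 8) * (p ^ (8 * suc k) * p ^ (2 * k + 8))    ≡⟨ cong (16 ^ (2 * k + 8) *_) (^-distribˡ-+-* p (8 * suc k) (2 * k + 8)) ⟨
      16 ^ (2 * k + 8) * p ^ (8 * suc k + (2 * k + 8))          ≤⟨ *-monoʳ-≤ (16 ^ (2 * k + 8)) (^-monoʳ-≤ p {{>-nonZero 0<p}} exponents) ⟩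
      16 ^ (2 * k + 8) * p ^ (11 * k + 24)                      ≡⟨ *-identityʳ _ ⟨
      16 ^ (2 * k + 8) * p ^ (11 * k + 24) * 1                  ≤⟨ *-monoʳ-≤ (16 ^ (2 * k + 8) * p ^ (11 * k + 24)) (0<^ 16 0<L) ⟩
      16 ^ (2 * k + 8) * p ^ (11 * k + 24) * L ^ 16             ∎)
      where
      open ≤-Reasoning
      comm : ∀ a b c → a * (b * c) ≡ b * (a * c)
      comm = solve-∀
      half : ∀ k → 4 * k + 16 ≡ 2 * (2 * k + 8)
      half = solve-∀
      N-power : N ^ (4 * k + 16) ≡ (N * N) ^ (2 * k + 8)
      N-power = trans (cong (N ^_) (half k)) (trans (sym (^-*-assoc N 2 (2 * k + 8))) (cong (λ t → (N * t) ^ (2 * k + 8)) (*-identityʳ N)))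
      exponents : 8 * suc k + (2 * k + 8) ≤ 11 * k + 24
      exponents = ≤-trans (m≤m+n (8 * suc k + (2 * k + 8)) (k + 8)) (≤-reflexive (lem k))
        where
        lem : ∀ k → 8 * suc k + (2 * k + 8) + (k + 8) ≡ 11 * k + 24
        lem = solve-∀

    module _ {e B J n W π : ℕ} (e*d≤p : e * d ≤ p) (B²≤p : B * B ≤ p) (p≤4B² : p ≤ 4 * (B * B))
      (0<B : 0 < B) (0<J : 0 < J) (JB≤eW : J * B ≤ e * W) (π≤en : π ≤ e * n) (N≤8Lπ : N ≤ 8 * (L * π))
      (N²≤72JB : N * N ≤ 72 * (J * B)) where

      private
        s = 2 * (B * B * (B * B)) + p * (2 * (B * B))
        Λ = J * J * J * (s * p)

        -- B² ≤ p lets the degenerate quadruples dominate the 2B⁴ roots.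
        Λ≤ : Λ ≤ J * J * J * (B * B) * (4 * (p * p))
        Λ≤ = begin
          J * J * J * (s * p)                                   ≤⟨ *-monoʳ-≤ (J * J * J) (*-monoˡ-≤ p (+-monoˡ-≤ (p * (2 * (B * B))) (*-monoʳ-≤ 2 (*-monoʳ-≤ (B * B) B²≤p)))) ⟩
          J * J * J * ((2 * (B * B * p) + p * (2 * (B * B))) * p) ≡⟨ lem J B p ⟩
          J * J * J * (B * B) * (4 * (p * p))                   ∎
          where
          open ≤-Reasoning
          lem : ∀ J B p → J * J * J * ((2 * (B * B * p) + p * (2 * (B * B))) * p) ≡ J * J * J * (B * B) * (4 * (p * p))
          lem = solve-∀

        -- (JB)⁴ = x y, where x is the part shared with the bound for Λ, so that x^k cancels.
        x = J * J * J * (B * B)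
        y = J * (B * B)

        module _ (small : (n * n * W ^ k) ^ 4 ≤ (p * (2 * d)) ^ 4 * Λ ^ k) where
          open ≤-Reasoning

          -- Multiplication of the assumed inequality by e^8 (e^4)^k turns n and W into π and JB on
          -- the left; on the right e^4 d^4 is absorbed by p^4.
          step₁ : π ^ 8 * (x * y) ^ k ≤ (e ^ 4) ^ suc k * (16 * p ^ 8) * (x * (4 * (p * p))) ^ k
          step₁ = begin
            π ^ 8 * (x * y) ^ k
              ≡⟨ cong (λ t → π ^ 8 * t ^ k) (lem₀ J B) ⟩
            π ^ 8 * ((J * B) ^ 4) ^ k
              ≤⟨ *-mono-≤ (^-monoˡ-≤ 8 π≤en) (^-monoˡ-≤ k (^-monoˡ-≤ 4 JB≤eW)) ⟩
            (e * n) ^ 8 * ((e * W) ^ 4) ^ k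
              ≡⟨ cong ((e * n) ^ 8 *_) (trans (cong (_^ k) (^-distribʳ-* e W 4)) (trans (^-distribʳ-* (e ^ 4) (W ^ 4) k) (cong ((e ^ 4) ^ k *_) (^-swap W 4 k)))) ⟩
            (e * n) ^ 8 * ((e ^ 4) ^ k * (W ^ k) ^ 4)
              ≡⟨ cong (_* ((e ^ 4) ^ k * (W ^ k) ^ 4)) (trans (^-distribʳ-* e n 8) (cong (e ^ 8 *_) (^-distribˡ-+-* n 4 4))) ⟩
            e ^ 8 * (n ^ 4 * n ^ 4) * ((e ^ 4) ^ k * (W ^ k) ^ 4)
              ≡⟨ lem₁ (e ^ 8) (n ^ 4) ((e ^ 4) ^ k) ((W ^ k) ^ 4) ⟩
            (e ^ 4) ^ k * e ^ 8 * (n ^ 4 * n ^ 4 * (W ^ k) ^ 4)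
              ≡⟨ cong ((e ^ 4) ^ k * e ^ 8 *_) (trans (cong (_* (W ^ k) ^ 4) (sym (^-distribʳ-* n n 4))) (sym (^-distribʳ-* (n * n) (W ^ k) 4))) ⟩
            (e ^ 4) ^ k * e ^ 8 * (n * n * W ^ k) ^ 4
              ≤⟨ *-monoʳ-≤ ((e ^ 4) ^ k * e ^ 8) small ⟩
            (e ^ 4) ^ k * e ^ 8 * ((p * (2 * d)) ^ 4 * Λ ^ k)
              ≡⟨ cong₂ (λ t u → (e ^ 4) ^ k * t * (u * Λ ^ k)) (^-distribˡ-+-* e 4 4)
                   (trans (^-distribʳ-* p (2 * d) 4) (cong (p ^ 4 *_) (^-distribʳ-* 2 d 4))) ⟩
            (e ^ 4) ^ k * (e ^ 4 * e ^ 4) * (p ^ 4 * (16 * d ^ 4) * Λ ^ k)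
              ≡⟨ lem₂ (e ^ 4) (p ^ 4) (d ^ 4) ((e ^ 4) ^ k) (Λ ^ k) ⟩
            (e ^ 4) ^ suc k * (16 * (p ^ 4 * (e ^ 4 * d ^ 4))) * Λ ^ k
              ≡⟨ cong (λ t → (e ^ 4) ^ suc k * (16 * (p ^ 4 * t)) * Λ ^ k) (sym (^-distribʳ-* e d 4)) ⟩
            (e ^ 4) ^ suc k * (16 * (p ^ 4 * (e * d) ^ 4)) * Λ ^ k
              ≤⟨ *-mono-≤ (*-monoʳ-≤ ((e ^ 4) ^ suc k) (*-monoʳ-≤ 16 (*-monoʳ-≤ (p ^ 4) (^-monoˡ-≤ 4 e*d≤p)))) (^-monoˡ-≤ k Λ≤) ⟩
            (e ^ 4) ^ suc k * (16 * (p ^ 4 * p ^ 4)) * (x * (4 * (p * p))) ^ k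
              ≡⟨ cong (λ t → (e ^ 4) ^ suc k * (16 * t) * (x * (4 * (p * p))) ^ k) (sym (^-distribˡ-+-* p 4 4)) ⟩
            (e ^ 4) ^ suc k * (16 * p ^ 8) * (x * (4 * (p * p))) ^ k ∎
            where
            lem₀ : ∀ J B → J * J * J * (B * B) * (J * (B * B)) ≡ J * B * (J * B * (J * B * (J * B * 1)))
            lem₀ = solve-∀
            lem₁ : ∀ e n a w → e * (n * n) * (a * w) ≡ a * e * (n * n * w)
            lem₁ = solve-∀
            lem₂ : ∀ e p d a l → a * (e * e) * (p * (16 * d) * l) ≡ e * a * (16 * (p * (e * d))) * l
            lem₂ = solve-∀

          step₂ : π ^ 8 * y ^ k ≤ (e ^ 4) ^ suc k * (16 * p ^ 8) * (4 * (p * p)) ^ k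
          step₂ = *-cancelˡ-≤ (x ^ k) {{>-nonZero (0<^ k (0<* (0<* (0<* 0<J 0<J) 0<J) (0<* 0<B 0<B)))}} (begin
            x ^ k * (π ^ 8 * y ^ k)                                              ≡⟨ lem (x ^ k) (π ^ 8) (y ^ k) ⟩
            π ^ 8 * (x ^ k * y ^ k)                                              ≡⟨ cong (π ^ 8 *_) (^-distribʳ-* x y k) ⟨
            π ^ 8 * (x * y) ^ k                                                  ≤⟨ step₁ ⟩
            (e ^ 4) ^ suc k * (16 * p ^ 8) * (x * (4 * (p * p))) ^ k             ≡⟨ cong ((e ^ 4) ^ suc k * (16 * p ^ 8) *_) (^-distribʳ-* x (4 * (p * p)) k) ⟩
            (e ^ 4) ^ suc k * (16 * p ^ 8) * (x ^ k * (4 * (p * p)) ^ k)         ≡⟨ lem ((e ^ 4) ^ suc k * (16 * p ^ 8)) (x ^ k) ((4 * (p * p)) ^ k) ⟩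
            x ^ k * ((e ^ 4) ^ suc k * (16 * p ^ 8) * (4 * (p * p)) ^ k)         ∎)
            where
            lem : ∀ a b c → a * (b * c) ≡ b * (a * c)
            lem = solve-∀

          -- y = (JB)B is of order N²√p. Squared it bounds N⁴p, with p ≤ 4B² as the substitute for
          -- the square root.
          N⁴p≤ : N ^ 4 * p ≤ c₁ * (y * y)
          N⁴p≤ = begin
            N ^ 4 * p                                       ≡⟨ lem₁ N p ⟩
            N * N * (N * N) * p                             ≤⟨ *-mono-≤ (*-mono-≤ N²≤72JB N²≤72JB) p≤4B² ⟩
            72 * (J * B) * (72 * (J * B)) * (4 * (B * B))   ≡⟨ *-assoc (72 * (J * B) * (72 * (J * B))) 4 (B * B) ⟨
            72 * (J * B) * (72 * (J * B)) * 4 * (B * B)     ≡⟨ cong (_* (B * B)) (c₁-product (J * B)) ⟩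
            c₁ * (J * B * (J * B)) * (B * B)                ≡⟨ lem₂ c₁ J B ⟩
            c₁ * (y * y)                                    ∎
            where
            lem₁ : ∀ N p → N * (N * (N * (N * 1))) * p ≡ N * N * (N * N) * p
            lem₁ = solve-∀
            lem₂ : ∀ c J B → c * (J * B * (J * B)) * (B * B) ≡ c * (J * (B * B) * (J * (B * B)))
            lem₂ = solve-∀

          -- The square of `step₂`; the squaring is needed to apply `N⁴p≤` and doubles fourth powers
          -- to eighth ones. Chebyshev's bound enters to the 16th power, which produces L^16.
          step₃ : N ^ 16 * (N ^ 4 * p) ^ k ≤ c₀ * L ^ 16 * c₁ ^ k * ((e ^ 8) ^ suc k * (256 * p ^ 16) * (16 * p ^ 3 * p) ^ k)
          step₃ = begin
            N ^ 16 * (N ^ 4 * p) ^ k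
              ≤⟨ *-mono-≤ (^-monoˡ-≤ 16 N≤8Lπ) (^-monoˡ-≤ k N⁴p≤) ⟩
            (8 * (L * π)) ^ 16 * (c₁ * (y * y)) ^ k
              ≡⟨ cong₂ _*_ (trans (c₀-power (L * π)) (cong (c₀ *_) (trans (^-distribʳ-* L π 16) (cong (L ^ 16 *_) (^-distribˡ-+-* π 8 8)))))
                   (trans (^-distribʳ-* c₁ (y * y) k) (cong (c₁ ^ k *_) (^-distribʳ-* y y k))) ⟩
            c₀ * (L ^ 16 * (π ^ 8 * π ^ 8)) * (c₁ ^ k * (y ^ k * y ^ k))
              ≡⟨ lem₁ c₀ (L ^ 16) (π ^ 8) (c₁ ^ k) (y ^ k) ⟩
            c₀ * L ^ 16 * c₁ ^ k * (π ^ 8 * y ^ k * (π ^ 8 * y ^ k))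
              ≤⟨ *-monoʳ-≤ (c₀ * L ^ 16 * c₁ ^ k) (*-mono-≤ step₂ step₂) ⟩
            c₀ * L ^ 16 * c₁ ^ k * (a * (16 * p ^ 8) * b * (a * (16 * p ^ 8) * b))
              ≡⟨ cong (c₀ * L ^ 16 * c₁ ^ k *_) (lem₂ a (p ^ 8) b) ⟩
            c₀ * L ^ 16 * c₁ ^ k * (a * a * (256 * (p ^ 8 * p ^ 8)) * (b * b))
              ≡⟨ cong (c₀ * L ^ 16 * c₁ ^ k *_) (cong₂ _*_ (cong₂ (λ t u → t * (256 * u)) aa (sym (^-distribˡ-+-* p 8 8))) bb) ⟩
            c₀ * L ^ 16 * c₁ ^ k * ((e ^ 8) ^ suc k * (256 * p ^ 16) * (16 * p ^ 3 * p) ^ k) ∎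
            where
            a = (e ^ 4) ^ suc k
            b = (4 * (p * p)) ^ k
            lem₁ : ∀ c l q d y → c * (l * (q * q)) * (d * (y * y)) ≡ c * l * d * (q * y * (q * y))
            lem₁ = solve-∀
            lem₂ : ∀ a q b → a * (16 * q) * b * (a * (16 * q) * b) ≡ a * a * (256 * (q * q)) * (b * b)
            lem₂ = solve-∀
            aa : a * a ≡ (e ^ 8) ^ suc k
            aa = trans (sym (^-distribʳ-* (e ^ 4) (e ^ 4) (suc k))) (cong (_^ suc k) (sym (^-distribˡ-+-* e 4 4)))
            lem₃ : ∀ p → 4 * (p * p) * (4 * (p * p)) ≡ 16 * (p * (p * (p * 1))) * p
            lem₃ = solve-∀
            bb : b * b ≡ (16 * p ^ 3 * p) ^ k
            bb = trans (sym (^-distribʳ-* (4 * (p * p)) (4 * (p * p)) k)) (cong (_^ k) (lem₃ p))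

          step₄ : N ^ 16 * (N ^ 4) ^ k ≤ constant k * L ^ 16 * ((e ^ 8) ^ suc k * (p ^ 16 * (p ^ 3) ^ k))
          step₄ = *-cancelˡ-≤ (p ^ k) {{>-nonZero (0<^ k 0<p)}} (begin
            p ^ k * (N ^ 16 * (N ^ 4) ^ k)              ≡⟨ lem₁ (p ^ k) (N ^ 16) ((N ^ 4) ^ k) ⟩
            N ^ 16 * ((N ^ 4) ^ k * p ^ k)              ≡⟨ cong (N ^ 16 *_) (^-distribʳ-* (N ^ 4) p k) ⟨
            N ^ 16 * (N ^ 4 * p) ^ k                    ≤⟨ step₃ ⟩
            c₀ * L ^ 16 * c₁ ^ k * ((e ^ 8) ^ suc k * (256 * p ^ 16) * (16 * p ^ 3 * p) ^ k)
              ≡⟨ cong (λ t → c₀ * L ^ 16 * c₁ ^ k * ((e ^ 8) ^ suc k * (256 * p ^ 16) * t))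
                   (trans (^-distribʳ-* (16 * p ^ 3) p k) (cong (_* p ^ k) (^-distribʳ-* 16 (p ^ 3) k))) ⟩
            c₀ * L ^ 16 * c₁ ^ k * ((e ^ 8) ^ suc k * (256 * p ^ 16) * (16 ^ k * (p ^ 3) ^ k * p ^ k))
              ≡⟨ lem₂ c₀ (L ^ 16) (c₁ ^ k) ((e ^ 8) ^ suc k) (p ^ 16) (16 ^ k) ((p ^ 3) ^ k) (p ^ k) ⟩
            p ^ k * (c₀ * 256 * (c₁ ^ k * 16 ^ k) * L ^ 16 * ((e ^ 8) ^ suc k * (p ^ 16 * (p ^ 3) ^ k)))
              ≡⟨ cong (λ t → p ^ k * (c₀ * 256 * t * L ^ 16 * ((e ^ 8) ^ suc k * (p ^ 16 * (p ^ 3) ^ k)))) (sym (^-distribʳ-* c₁ 16 k)) ⟩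
            p ^ k * (constant k * L ^ 16 * ((e ^ 8) ^ suc k * (p ^ 16 * (p ^ 3) ^ k))) ∎)
            where
            lem₁ : ∀ a b c → a * (b * c) ≡ b * (c * a)
            lem₁ = solve-∀
            lem₂ : ∀ c l d e q u v w → c * l * d * (e * (256 * q) * (u * v * w)) ≡ w * (c * 256 * (d * u) * l * (e * (q * v)))
            lem₂ = solve-∀

          -- Multiplication by d^(8(k+1)) eliminates e through e d ≤ p; the outcome contradicts the
          -- hypothesis.
          step₅ : d ^ (8 * suc k) * N ^ (4 * k + 16) ≤ constant k * p ^ (11 * k + 24) * L ^ 16
          step₅ = begin
            d ^ (8 * suc k) * N ^ (4 * k + 16)
              ≡⟨ cong₂ _*_ (sym (^-*-assoc d 8 (suc k))) (trans (^-distribˡ-+-* N (4 * k) 16) (trans (cong (_* N ^ 16) (sym (^-*-assoc N 4 k))) (*-comm ((N ^ 4) ^ k) (N ^ 16)))) ⟩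
            (d ^ 8) ^ suc k * (N ^ 16 * (N ^ 4) ^ k)
              ≤⟨ *-monoʳ-≤ ((d ^ 8) ^ suc k) step₄ ⟩
            (d ^ 8) ^ suc k * (constant k * L ^ 16 * ((e ^ 8) ^ suc k * (p ^ 16 * (p ^ 3) ^ k)))
              ≡⟨ lem ((d ^ 8) ^ suc k) (constant k) (L ^ 16) ((e ^ 8) ^ suc k) (p ^ 16) ((p ^ 3) ^ k) ⟩
            constant k * ((e ^ 8) ^ suc k * (d ^ 8) ^ suc k * (p ^ 16 * (p ^ 3) ^ k)) * L ^ 16
              ≡⟨ cong (λ t → constant k * (t * (p ^ 16 * (p ^ 3) ^ k)) * L ^ 16)
                   (trans (sym (^-distribʳ-* (e ^ 8) (d ^ 8) (suc k))) (cong (_^ suc k) (sym (^-distribʳ-* e d 8)))) ⟩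
            constant k * (((e * d) ^ 8) ^ suc k * (p ^ 16 * (p ^ 3) ^ k)) * L ^ 16
              ≤⟨ *-monoˡ-≤ (L ^ 16) (*-monoʳ-≤ (constant k) (*-monoˡ-≤ (p ^ 16 * (p ^ 3) ^ k) (^-monoˡ-≤ (suc k) (^-monoˡ-≤ 8 e*d≤p)))) ⟩
            constant k * ((p ^ 8) ^ suc k * (p ^ 16 * (p ^ 3) ^ k)) * L ^ 16
              ≡⟨ cong (λ t → constant k * t * L ^ 16) collect ⟩
            constant k * p ^ (11 * k + 24) * L ^ 16 ∎
            where
            lem : ∀ d c l e q v → d * (c * l * (e * (q * v))) ≡ c * (e * d * (q * v)) * l
            lem = solve-∀
            exponent : ∀ k → 8 * suc k + (16 + 3 * k) ≡ 11 * k + 24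
            exponent = solve-∀
            collect : (p ^ 8) ^ suc k * (p ^ 16 * (p ^ 3) ^ k) ≡ p ^ (11 * k + 24)
            collect = trans (cong₂ _*_ (^-*-assoc p 8 (suc k)) (trans (cong (p ^ 16 *_) (^-*-assoc p 3 k)) (sym (^-distribˡ-+-* p 16 (3 * k)))))
              (trans (sym (^-distribˡ-+-* p (8 * suc k) (16 + 3 * k))) (cong (p ^_) (exponent k)))

      main-beats-error : (p * (2 * d)) ^ 4 * Λ ^ k < (n * n * W ^ k) ^ 4
      main-beats-error = ≰⇒> λ small → <⇒≱ (strictly (constant k) (s≤s (m≤m+n (constant k) (16 ^ (2 * k + 8))))) (step₅ small)

-- The sizes of the ranges for a, v and b.

module Sizes where
  open CoprimePairs
  open import Data.Nat
  open import Data.Nat.Properties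
  open import Data.Nat.DivMod using (_/_; _%_; m*n/n≡m; /-monoˡ-≤; m/n*n≤m; m/n≤m; m≡m%n+[m/n]*n; m%n<n; m%n≤n)
  open import Data.Nat.Tactic.RingSolver using (solve-∀)

  module Lengths {N p B : ℕ} (B²≤p : B * B ≤ p) (0<B : 0 < B) (16p≤N² : 16 * p ≤ N * N) where
    private instance
      B≢0 : NonZero B
      B≢0 = >-nonZero 0<B

    -- v ≤ V and ab < AB ≤ V give v + ab < 2V ≤ N: each of the two summands gets half of the
    -- available range.
    V A J : ℕ
    V = N / 2
    A = V / B
    J = length (coprimePairs A V)

    4B≤N : 4 * B ≤ N
    4B≤N = ≮⇒≥ λ N<4B → <⇒≱ (*-mono-< N<4B N<4B) (begin
      4 * B * (4 * B)     ≡⟨ lem B ⟩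
      16 * (B * B)          ≤⟨ *-monoʳ-≤ 16 B²≤p ⟩
      16 * p                  ≤⟨ 16p≤N² ⟩
      N * N                   ∎)
      where
      open ≤-Reasoning
      lem : ∀ B → 4 * B * (4 * B) ≡ 16 * (B * B)
      lem = solve-∀

    2B≤V : 2 * B ≤ V
    2B≤V = begin
      2 * B                  ≡⟨ m*n/n≡m (2 * B) 2 ⟨
      2 * B * 2 / 2      ≤⟨ /-monoˡ-≤ 2 (≤-trans (≤-reflexive (lem B)) 4B≤N) ⟩
      V                        ∎
      where
      open ≤-Reasoning
      lem : ∀ B → 2 * B * 2 ≡ 4 * B
      lem = solve-∀

    0<V : 0 < V
    0<V = ≤-trans (≤-trans 0<B (m≤n*m B 2)) 2B≤V

    2V≤N : V + V ≤ N
    2V≤N = ≤-trans (≤-reflexive (lem V)) (m/n*n≤m N 2)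
      where
      lem : ∀ V → V + V ≡ V * 2
      lem = solve-∀

    N≤3V : N ≤ 3 * V
    N≤3V = begin
      N                        ≡⟨ m≡m%n+[m/n]*n N 2 ⟩
      N % 2 + V * 2      ≤⟨ +-monoˡ-≤ (V * 2) (≤-trans (≤-pred (m%n<n N 2)) 0<V) ⟩
      V + V * 2            ≡⟨ lem V ⟩
      3 * V                  ∎
      where
      open ≤-Reasoning
      lem : ∀ V → V + V * 2 ≡ 3 * V
      lem = solve-∀

    AB≤V : A * B ≤ V
    AB≤V = m/n*n≤m V B

    A≤V : A ≤ V
    A≤V = m/n≤m V B

    -- Rounding V/B down loses at most B, which is at most V/2 because N² ≥ 16p.
    V≤2AB : V ≤ 2 * (A * B)
    V≤2AB = +-cancelˡ-≤ V V (2 * (A * B)) (begin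
      V + V                               ≡⟨ lem₁ V ⟩
      2 * V                               ≡⟨ cong (2 *_) (m≡m%n+[m/n]*n V B) ⟩
      2 * (V % B + A * B)           ≤⟨ *-monoʳ-≤ 2 (+-monoˡ-≤ (A * B) (m%n≤n V B)) ⟩
      2 * (B + A * B)                 ≡⟨ *-distribˡ-+ 2 B (A * B) ⟩
      2 * B + 2 * (A * B)           ≤⟨ +-monoˡ-≤ (2 * (A * B)) 2B≤V ⟩
      V + 2 * (A * B)                 ∎)
      where
      open ≤-Reasoning
      lem₁ : ∀ V → V + V ≡ 2 * V
      lem₁ = solve-∀

    -- 72 = 3·3·2·4: N ≤ 3V twice, V ≤ 2AB once, and the density 1/4 of coprime pairs.
    N²≤72JB : N * N ≤ 72 * (J * B)
    N²≤72JB = begin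
      N * N                                  ≤⟨ *-mono-≤ N≤3V N≤3V ⟩
      3 * V * (3 * V)                    ≤⟨ *-monoˡ-≤ (3 * V) (*-monoʳ-≤ 3 V≤2AB) ⟩
      3 * (2 * (A * B)) * (3 * V)    ≡⟨ lem₁ A B V ⟩
      18 * (A * V * B)                   ≤⟨ *-monoʳ-≤ 18 (*-monoˡ-≤ B (coprimePairs-count A V)) ⟩
      18 * (4 * J * B)                   ≡⟨ lem₂ J B ⟩
      72 * (J * B)                         ∎
      where
      open ≤-Reasoning
      lem₁ : ∀ A B V → 3 * (2 * (A * B)) * (3 * V) ≡ 18 * (A * V * B)
      lem₁ = solve-∀
      lem₂ : ∀ J B → 18 * (4 * J * B) ≡ 72 * (J * B)
      lem₂ = solve-∀

    0<JB : 0 < J * B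
    0<JB = n≢0⇒n>0 λ e → <⇒≱ (*-mono-< 0<N 0<N) (subst (λ t → N * N ≤ 72 * t) e N²≤72JB)
      where
      0<N : 0 < N
      0<N = ≤-trans (≤-trans 0<B (m≤n*m B 4)) 4B≤N

    0<J : 0 < J
    0<J = n≢0⇒n>0 λ e → <-irrefl refl (subst (λ t → 0 < t * B) e 0<JB)

    value-bounds : ∀ {a v b} → (a , v) ∈ coprimePairs A V → b < B → 0 < v + a * b × v + a * b < N
    value-bounds {a} {v} {b} r∈ b<B = let ((0<a , a≤A) , (0<v , v≤V) , _) = ∈-coprimePairs⁻ {A} {V} r∈ in
      ≤-trans 0<v (m≤m+n v (a * b)) , (begin-strict
        v + a * b       <⟨ +-monoʳ-< v (*-monoʳ-< a {{>-nonZero 0<a}} b<B) ⟩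
        v + a * B       ≤⟨ +-mono-≤ v≤V (≤-trans (*-monoˡ-≤ B a≤A) AB≤V) ⟩
        V + V             ≤⟨ 2V≤N ⟩
        N                   ∎)
      where open ≤-Reasoning

-- Assembly: choice of parameters and classes, and the solution for every residue.

module Main where
  open import Defs
  open ListSum
  open Congruence
  open PrimeField
  open FermatQuotient
  open Count
  open Energy
  open Chebyshev
  open CoprimePairs
  open Arithmetic
  open Sizes
  import Data.Nat.Tactic.RingSolver as ℕ
  open import Data.Nat.Logarithm using (⌊log₂_⌋)
  open import Data.Integer hiding (suc)
  open import Data.Integer.Properties hiding (_≟_)
  open import Data.Integer.Tactic.RingSolver using (solve-∀)
  open import Data.Fin as Fin using (Fin)
  import Data.Fin.Properties as Fin

  sumFin-cong : ∀ {n} {f g : Fin n → ℕ} → (∀ i → f i ≡ g i) → sumFin f ≡ sumFin g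
  sumFin-cong {zero}  e = refl
  sumFin-cong {suc n} e = cong₂ ℕ._+_ (e Fin.zero) (sumFin-cong (λ i → e (Fin.suc i)))

  private
    +fourth : ∀ x → + (x ℕ.^ 4) ≡ fourth (+ x)
    +fourth x = trans (cong +_ (lem x)) (trans (pos-* (x ℕ.* x) (x ℕ.* x)) (cong₂ _*_ (pos-* x x) (pos-* x x)))
      where
      lem : ∀ x → x ℕ.* (x ℕ.* (x ℕ.* (x ℕ.* 1))) ≡ x ℕ.* x ℕ.* (x ℕ.* x)
      lem = ℕ.solve-∀

  module _ (k p w N : ℕ) (pr : Prime p) (p≢2 : p ≢ 2) (0<w : 0 ℕ.< w) (w<p : w ℕ.< p) (2≤N : 2 ℕ.≤ N) (N≤p : N ℕ.≤ p) where
    open Mod p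
    open PrimeMod pr
    open Quotient pr using (fq; q-fq)
    open PowerClasses pr {w} 0<w
    private instance
      p≢0 : ℕ.NonZero p
      p≢0 = prime⇒nonZero pr
    private
      0<p : 0 ℕ.< p
      0<p = ℕ.>-nonZero⁻¹ p

      f : ℕ → ℕ
      f u = q p w u

      -- On the class h the polynomial quotient is this constant times f.
      α : ℤ → ℤ
      α h = - (+ w * h)

      -- The bounds 0 < w < p keep w invertible modulo p.
      α≉0 : ∀ {h} → ¬ h ≈ 0ℤ → ¬ α h ≈ 0ℤ
      α≉0 {h} h≉0 r = *-≉0 (small≉0 0<w w<p) h≉0 (≈-trans (≡⇒≈ (sym (neg-involutive (+ w * h)))) (neg-cong r))

      f-spec : ∀ {h} → ¬ h ≈ 0ℤ → ∀ u → (+ u) ^ w ≈ h → + f u ≈ α h * fq (+ u)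
      f-spec {h} h≉0 u r = ≈-trans (q-fq w u (unit-of h≉0 0<w r)) (*-cong (neg-cong (*-cong (≈-refl {+ w}) r)) (≈-refl {fq (+ u)}))

      e*d≤p : e ℕ.* d ℕ.≤ p
      e*d≤p = ℕ.≤-trans (ℕ.≤-reflexive (sym e*d)) (ℕ.pred[n]≤n)

      d≤p : d ℕ.≤ p
      d≤p = ℕ.≤-trans (ℕ.m≤n*m d e {{ℕ.>-nonZero 0<e}}) e*d≤p

      -- Every unit lies in exactly one of the at most e classes, so the class counts add up to the
      -- length of the list and one of them reaches the average.
      pigeonhole-classes : ∀ {I : Set} (xs : List I) (u : I → ℕ) → 0 ℕ.< length xs → (∀ {i} → i ∈ xs → 0 ℕ.< u i × u i ℕ.< p) →
        ∃ λ h → h ∈ classes × + length xs ≤ + e * (∑[ i ∈ xs ] ⟦ (+ u i) ^ w ≈? + h ⟧)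
      pigeonhole-classes xs u 0<l ok =
        let (h , h∈ , le) = pigeonhole classes (λ h → ∑[ i ∈ xs ] ⟦ (+ u i) ^ w ≈? + h ⟧) e classes-count
                              (λ h → ∑-nonneg xs λ i → 0≤⟦⟧ ((+ u i) ^ w ≈? + h)) (subst (0ℤ <_) (sym total) (+<+ 0<l))
        in h , h∈ , ≤-trans (≤-reflexive (sym total)) le
        where
        total : ∑[ h ∈ classes ] ∑[ i ∈ xs ] ⟦ (+ u i) ^ w ≈? + h ⟧ ≡ + length xs
        total = trans (∑-swap classes xs (λ h i → ⟦ (+ u i) ^ w ≈? + h ⟧))
          (trans (∑-cong-∈ xs λ i i∈ → let (0<u , u<p) = ok i∈ in ∑-classes (small≉0 0<u u<p))
            (trans (∑-const xs 1ℤ) (*-identityʳ (+ length xs))))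

    module _ (hyp : threshold k ℕ.* p ℕ.^ (11 ℕ.* k ℕ.+ 24) ℕ.* ⌊log₂ N ⌋ ℕ.^ 16
                    ℕ.≤ d ℕ.^ (8 ℕ.* suc k) ℕ.* N ℕ.^ (4 ℕ.* k ℕ.+ 16)) where
      private
        L = ⌊log₂ N ⌋
        0<L : 0 ℕ.< L
        0<L = 1≤log 2≤N

        B : ℕ
        B = proj₁ (isqrt p)
        B²≤p : B ℕ.* B ℕ.≤ p
        B²≤p = proj₁ (proj₂ (isqrt p))
        p<[1+B]² : p ℕ.< suc B ℕ.* suc B
        p<[1+B]² = proj₂ (proj₂ (isqrt p))
        0<B : 0 ℕ.< B
        0<B = ℕ.n≢0⇒n>0 λ B≡0 → ℕ.<⇒≱ 0<p (ℕ.≤-pred (subst (λ t → p ℕ.< suc t ℕ.* suc t) B≡0 p<[1+B]²))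
        B≤p : B ℕ.≤ p
        B≤p = ℕ.≤-trans (ℕ.m≤m*n B B {{ℕ.>-nonZero 0<B}}) B²≤p
        p≤4B² : p ℕ.≤ 4 ℕ.* (B ℕ.* B)
        p≤4B² = ℕ.≤-trans (ℕ.<⇒≤ p<[1+B]²) (ℕ.≤-trans (ℕ.*-mono-≤ 1+B≤2B 1+B≤2B) (ℕ.≤-reflexive (lem B)))
          where
          1+B≤2B : suc B ℕ.≤ B ℕ.+ B
          1+B≤2B = ℕ.+-monoˡ-≤ B 0<B
          lem : ∀ B → (B ℕ.+ B) ℕ.* (B ℕ.+ B) ≡ 4 ℕ.* (B ℕ.* B)
          lem = ℕ.solve-∀

        open Lengths {N} {p} {B} B²≤p 0<B (N-large {k} {p} {N} {d} {L} 0<p 0<L hyp d≤p)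

        pairs : List (ℕ × ℕ)
        pairs = coprimePairs A V

        pairs-ok : ∀ {a v} → (a , v) ∈ pairs → 0 ℕ.< a × a ℕ.< p × v ℕ.< p × Coprime a v
        pairs-ok r∈ = let ((0<a , a≤A) , (0<v , v≤V) , cop) = ∈-coprimePairs⁻ {A} {V} r∈ in
          0<a , ℕ.≤-<-trans (ℕ.≤-trans a≤A A≤V) V<p , ℕ.≤-<-trans v≤V V<p , λ {i} → cop {i}
          where
          V<p : V ℕ.< p
          V<p = ℕ.<-≤-trans (ℕ.m<m+n V 0<V) (ℕ.≤-trans 2V≤N N≤p)

        triples : List ((ℕ × ℕ) × ℕ)
        triples = cartesianProduct pairs (upTo B)

        value : (ℕ × ℕ) × ℕ → ℕ
        value ((a , v) , b) = v ℕ.+ a ℕ.* b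

        triples-length : length triples ≡ J ℕ.* B
        triples-length = trans (length-cartesianProduct pairs (upTo B)) (cong (J ℕ.*_) (length-upTo B))

        value-ok : ∀ {τ} → τ ∈ triples → 0 ℕ.< value τ × value τ ℕ.< N
        value-ok {(a , v) , b} τ∈ = let (r∈ , b∈) = ∈-cartesianProduct⁻ pairs (upTo B) τ∈ in value-bounds r∈ (∈-upTo⁻ b∈)

        class₁ = pigeonhole-classes triples value (subst (0 ℕ.<_) (sym triples-length) 0<JB)
          (λ {τ} τ∈ → let (0<u , u<N) = value-ok {τ} τ∈ in 0<u , ℕ.<-≤-trans u<N N≤p)
        h₁ : ℕ
        h₁ = proj₁ class₁
        h₁≉0 : ¬ + h₁ ≈ 0ℤ
        h₁≉0 = class≉0 (proj₁ (proj₂ class₁))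

        primes : List ℕ
        primes = primesBelow N

        primes-ok : ∀ {l} → l ∈ primes → Prime l × l ℕ.< N
        primes-ok l∈ = let (l∈′ , pl) = ∈-filter⁻ prime? {xs = upTo N} l∈ in pl , ∈-upTo⁻ l∈′

        π = length primes

        3≤N : 3 ℕ.≤ N
        3≤N = ℕ.≤-trans (ℕ.≤-trans (ℕ.n≤1+n 3) (ℕ.*-monoʳ-≤ 4 0<B)) 4B≤N

        N≤8Lπ : N ℕ.≤ 8 ℕ.* (L ℕ.* π)
        N≤8Lπ = chebyshev N 3≤N

        0<π : 0 ℕ.< π
        0<π = ℕ.n≢0⇒n>0 λ π≡0 → ℕ.<⇒≱ (ℕ.<-≤-trans ℕ.z<s 2≤N)
          (ℕ.≤-trans N≤8Lπ (ℕ.≤-reflexive (trans (cong (λ t → 8 ℕ.* (L ℕ.* t)) π≡0) (cong (8 ℕ.*_) (ℕ.*-zeroʳ L)))))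

        -- The class of the primes is chosen independently of `h₁`: one enters only the coincidence
        -- count, the other only the operator.
        class₀ = pigeonhole-classes primes (λ l → l) 0<π
          (λ l∈ → let (pl , l<N) = primes-ok l∈ in ℕ.>-nonZero⁻¹ _ {{prime⇒nonZero pl}} , ℕ.<-≤-trans l<N N≤p)
        h₀ : ℕ
        h₀ = proj₁ class₀
        h₀≉0 : ¬ + h₀ ≈ 0ℤ
        h₀≉0 = class≉0 (proj₁ (proj₂ class₀))

        U : List ℕ
        U = filter (λ l → (+ l) ^ w ≈? + h₀) primes

        U-ok : ∀ {l} → l ∈ U → Prime l × l ℕ.< p × (+ l) ^ w ≈ + h₀
        U-ok l∈ = let (l∈′ , r) = ∈-filter⁻ (λ l → (+ l) ^ w ≈? + h₀) {xs = primes} l∈ ; (pl , l<N) = primes-ok l∈′ in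
          pl , ℕ.<-≤-trans l<N N≤p , r

        U-unique : Unique U
        U-unique = Unique.filter⁺ (λ l → (+ l) ^ w ≈? + h₀) (Unique.filter⁺ prime? (Unique.upTo⁺ N))

        n = length U

        π≤en : π ℕ.≤ e ℕ.* n
        π≤en = drop‿+≤+ (≤-trans (proj₂ (proj₂ class₀)) (≤-reflexive
          (trans (cong (+ e *_) (∑-⟦⟧ (λ l → (+ l) ^ w ≈? + h₀) primes)) (sym (pos-* e n)))))

        open Counting pr p≢2 0<w (α≉0 h₁≉0) B≤p h₁≉0 f (f-spec h₁≉0) pairs (coprimePairs-unique A V) pairs-ok U

        Wₙ = ∣ W ∣
        W≡ : + Wₙ ≡ W
        W≡ = 0≤i⇒+∣i∣≡i 0≤W

        JB≤eW : J ℕ.* B ℕ.≤ e ℕ.* Wₙ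
        JB≤eW = drop‿+≤+ (begin
          + (J ℕ.* B)                                              ≡⟨ cong +_ triples-length ⟨
          + length triples                                         ≤⟨ proj₂ (proj₂ class₁) ⟩
          + e * (∑[ τ ∈ triples ] ⟦ (+ value τ) ^ w ≈? + h₁ ⟧)     ≡⟨ cong (+ e *_) (∑-cartesianProduct pairs (upTo B) (λ τ → ⟦ (+ value τ) ^ w ≈? + h₁ ⟧)) ⟩
          + e * W                                                  ≡⟨ cong (+ e *_) (sym W≡) ⟩
          + e * + Wₙ                                               ≡⟨ pos-* e Wₙ ⟨
          + (e ℕ.* Wₙ)                                             ∎)
          where open ≤-Reasoning

        E≤ : E ≤ + (2 ℕ.* d)
        E≤ = ≤-trans (≤-reflexive E≡) (≤-trans
          (energy-bound h₀≉0 (α≉0 h₀≉0) f (f-spec h₀≉0) U U-unique U-ok) (≤-reflexive (sym (pos-* 2 d))))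

        Eₙ = ∣ E ∣
        E≡Eₙ : + Eₙ ≡ E
        E≡Eₙ = 0≤i⇒+∣i∣≡i 0≤E

        Λₙ = J ℕ.* J ℕ.* J ℕ.* ((2 ℕ.* (B ℕ.* B ℕ.* (B ℕ.* B)) ℕ.+ p ℕ.* (2 ℕ.* (B ℕ.* B))) ℕ.* p)

        inequality : fourth (+ p * E) * Λ ^ k < fourth (+ n * + n * W ^ k)
        inequality = begin-strict
          fourth (+ p * E) * Λ ^ k
            ≡⟨ cong₂ (λ x y → fourth (+ p * x) * y ^ k) (sym E≡Eₙ) (sym Λ≡) ⟩
          fourth (+ p * + Eₙ) * (+ Λₙ) ^ k
            ≡⟨ cong₂ (λ x y → fourth x * y) (sym (pos-* p Eₙ)) (sym (pos-^ Λₙ k)) ⟩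
          fourth (+ (p ℕ.* Eₙ)) * + (Λₙ ℕ.^ k)
            ≡⟨ cong (_* + (Λₙ ℕ.^ k)) (sym (+fourth (p ℕ.* Eₙ))) ⟩
          + ((p ℕ.* Eₙ) ℕ.^ 4) * + (Λₙ ℕ.^ k)
            ≡⟨ pos-* ((p ℕ.* Eₙ) ℕ.^ 4) (Λₙ ℕ.^ k) ⟨
          + ((p ℕ.* Eₙ) ℕ.^ 4 ℕ.* Λₙ ℕ.^ k)
            ≤⟨ +≤+ (ℕ.*-monoˡ-≤ (Λₙ ℕ.^ k) (ℕ.^-monoˡ-≤ 4 (ℕ.*-monoʳ-≤ p (drop‿+≤+ (≤-trans (≤-reflexive E≡Eₙ) E≤))))) ⟩
          + ((p ℕ.* (2 ℕ.* d)) ℕ.^ 4 ℕ.* Λₙ ℕ.^ k)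
            <⟨ +<+ (main-beats-error {k} {p} {N} {d} {L} 0<p 0<L hyp {e} {B} {J} {n} {Wₙ} {π}
                      e*d≤p B²≤p p≤4B² 0<B 0<J JB≤eW π≤en N≤8Lπ N²≤72JB) ⟩
          + ((n ℕ.* n ℕ.* Wₙ ℕ.^ k) ℕ.^ 4)
            ≡⟨ +fourth (n ℕ.* n ℕ.* Wₙ ℕ.^ k) ⟩
          fourth (+ (n ℕ.* n ℕ.* Wₙ ℕ.^ k))
            ≡⟨ cong fourth (trans (pos-* (n ℕ.* n) (Wₙ ℕ.^ k)) (cong₂ _*_ (pos-* n n) (trans (pos-^ Wₙ k) (cong (_^ k) W≡)))) ⟩
          fourth (+ n * + n * W ^ k) ∎
          where open ≤-Reasoning

      -- Two primes from `U` and k members v + ab, all below N, represent each residue c.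
      solvable : WaringSolvable w N p (suc (suc k))
      solvable c c<p =
        let (u , u<N , r) = solution (ℕ._< N) (λ l∈ → proj₂ (primes-ok (proj₁ (∈-filter⁻ (λ l → (+ l) ^ w ≈? + h₀) {xs = primes} l∈))))
                              (λ {r} {b} r∈ b∈ → proj₂ (value-bounds r∈ (∈-upTo⁻ b∈))) k (+ c) (solutions-positive k (+ c) inequality)
            total = sumFin (λ i → f (u i))
            same : sumFin (λ i → f (Fin.toℕ (Fin.fromℕ< (u<N i)))) ≡ total
            same = sumFin-cong λ i → cong f (Fin.toℕ-fromℕ< (u<N i))
        in (λ i → Fin.fromℕ< (u<N i)) , trans (cong (ℕ._% p) same) (%ℕ-small (+ total) c<p (≈-sym r))

open import Defs
open import Data.Nat using (ℕ; _+_; _*_; _^_; _∸_; _<_; _≤_; NonZero)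
open import Data.Nat.GCD using (gcd)
open import Data.Nat.Primality using (Prime)
open import Data.Nat.Logarithm using (⌊log₂_⌋)
open import Data.Product using (Σ; _×_)
open import Relation.Binary.PropositionalEquality using (_≢_)

open import Data.Nat using (suc; z≤n; s≤s)
open import Data.Nat.Properties using (≤-refl; ≤-reflexive; ≤-trans)
open import Data.Nat.Tactic.RingSolver using (solve-∀)
open import Data.Product using (_,_)
open import Relation.Binary.PropositionalEquality using (_≡_; sym; cong; cong₂)
open Arithmetic using (threshold)
open Main using (solvable)

theorem5 : (s : ℕ) → 3 ≤ s →
    Σ ℕ λ C → 1 ≤ C ×
    ((p w N : ℕ) .{{_ : NonZero p}} → Prime p → p ≢ 2 →
    1 ≤ w → w < p → 2 ≤ N → N ≤ p →
    C * p ^ (11 * s + 2) * ⌊log₂ N ⌋ ^ 16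
    ≤ gcd w (p ∸ 1) ^ (8 * (s ∸ 1)) * N ^ (4 * s + 8) →
    WaringNumber≤ w N p s)
-- s = k + 2: two prime variables and k applications of the operator. The witness for the Waring
-- number is s itself, and only the exponents have to be rewritten in terms of k.
theorem5 (suc (suc k)) (s≤s (s≤s _)) = threshold k , s≤s z≤n ,
  λ p w N pr p≢2 0<w w<p 2≤N N≤p hyp → suc (suc k) , s≤s z≤n , ≤-refl ,
    solvable k p w N pr p≢2 0<w w<p 2≤N N≤p
      (≤-trans (≤-reflexive (cong (λ m → threshold k * p ^ m * ⌊log₂ N ⌋ ^ 16) (sym (exponent₁ k))))
        (≤-trans hyp (≤-reflexive (cong (λ m → gcd w (p ∸ 1) ^ (8 * suc k) * N ^ m) (exponent₂ k)))))
  where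
  exponent₁ : ∀ k → 11 * suc (suc k) + 2 ≡ 11 * k + 24
  exponent₁ = solve-∀
  exponent₂ : ∀ k → 4 * suc (suc k) + 8 ≡ 4 * k + 16
  exponent₂ = solve-∀
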